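{- Let $n\ge1$, $\mathbf s\in\mathbb N^n$. For any two $\mathbf s$-arcs $\alpha,\alpha'$, the join irreducible $\mathbf s$-tree $\mathcal T_\vee(\alpha)$ forces $\mathcal T_\vee(\alpha')$ in the $\mathbf s$-weak order if and only if $\alpha$ is a subarc of $\alpha'$. That is, the forcing order on join irreducible $\mathbf s$-trees coincides with the subarc order on $\mathbf s$-arcs.
   Context: $[n]=\{1,\dots,n\}$, $]i,j[=\{i+1,\dots,j-1\}$, $\mathbf s=(s_1,\dots,s_n)$, $s_i\in\mathbb N$ (zeros allowed). An $\mathbf s$-tree is a rooted plane tree with internal nodes labeled bijectively by $[n]$, root with one child, node $j$ with $s_j+1$ ordered children each a leaf or a node $>j$. $\mathrm{pos}(\mathcal T,i,j)$ ($i<j$) = min of $s_i$ and the number of outgoing edges of $i$ strictly right of the path from the root to $j$. $\mathbf s$-weak order: $\mathcal T\le\mathcal T'$ iff $\mathrm{pos}(\mathcal T,i,j)\le\mathrm{pos}(\mathcal T',i,j)$ for all $i<j$; it is a finite lattice. Congruences and forcing: a congruence of a lattice $L$ is an equivalence relation with $x\equiv x',y\equiv y'\Rightarrow x\vee y\equiv x'\vee y'$ and $x\wedge y\equiv x'\wedge y'$. A join irreducible $j$ (covering a unique element $j_*$) is contracted by $\equiv$ if $j\equiv j_*$. For join irreducibles $j,j'$, $j$ forces $j'$ if every congruence contracting $j$ also contracts $j'$. $\mathbf s$-arcs: $(i,j,A,B,r)$ with $1\le i<j\le n$, $A\sqcup B=\{k\in]i,j[:s_k\ne0\}$, $r\in\{1,\dots,s_i\}$.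 Combs: the right $\mathbf s$-comb on $J\subseteq[n]$ is the increasing tree on $J$ where each $j\in J$ has $s_j+1$ outgoing edges, all leaves except the rightmost, which goes to the next element of $J$. $\mathcal T_\vee(i,j,A,B,r)$ is obtained from the right comb on $[n]\setminus(A\cup\{j\})$ by replacing the $(r+1)$-st outgoing edge of $i$ counted from the right (a leaf) by the right comb on $A\cup\{j\}$; these are exactly the join irreducible $\mathbf s$-trees. Subarcs: $\alpha=(i,j,A,B,r)$ is a subarc of $\alpha'=(i',j',A',B',r')$ if $i'\le i<j\le j'$; $A\subseteq A'$ and $B\subseteq B'$; if $s_j=0$ then $j=j'$; if $i'=i$ then $r=r'$; if $i'<i$ then either ($i\in A'$ and $r=1$) or ($i\in B'$ and $r=s_i$). -}

module Defs where

open import Data.Nat as ℕ using (ℕ; zero; suc; _∸_; _⊓_; _≡ᵇ_; _<ᵇ_)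
open import Data.Bool using (Bool; true; false; T; if_then_else_; _∧_)
open import Data.Fin as Fin using (Fin; toℕ)
open import Data.Fin.Subset using (Subset; _∈_; _∉_; _⊆_; _∪_; ⁅_⁆)
open import Data.Fin.Subset.Properties using (_∈?_)
open import Data.List as List using (List; []; _∷_; _++_; [_]; replicate; allFin; filter; head; map; foldr)
open import Data.Maybe using (Maybe; just; nothing)
open import Data.Product using (Σ; _×_; _,_; proj₁)
open import Data.Sum using (_⊎_)
open import Data.Empty using (⊥)
open import Data.Vec as Vec using (Vec; lookup; tabulate; toList)
open import Relation.Nullary using (¬_; does)
open import Relation.Nullary.Decidable using (_×-dec_)
open import Relation.Binary.PropositionalEquality using (_≡_; _≢_)
open import Relation.Binary.Structures using (IsEquivalence)
open import Function.Bundles using (_⇔_)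

module _ {A : Set} (_≤_ : A → A → Set) where

  IsJoin : A → A → A → Set
  IsJoin x y z = (x ≤ z) × (y ≤ z) × (∀ w → x ≤ w → y ≤ w → z ≤ w)

  IsMeet : A → A → A → Set
  IsMeet x y z = (z ≤ x) × (z ≤ y) × (∀ w → w ≤ x → w ≤ y → w ≤ z)

  record IsCongruence (R : A → A → Set) : Set where
    field
      isEquivalence : IsEquivalence R
      join-compat : ∀ x x' y y' z z' → R x x' → R y y' →
                    IsJoin x y z → IsJoin x' y' z' → R z z'
      meet-compat : ∀ x x' y y' z z' → R x x' → R y y' →
                    IsMeet x y z → IsMeet x' y' z' → R z z'

  _⋖_ : A → A → Set
  y ⋖ x = (y ≤ x) × (y ≢ x) × (∀ z → y ≤ z → z ≤ x → (z ≡ y) ⊎ (z ≡ x))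

  -- R contracts the (join irreducible) x: x is R-related to its lower cover
  Contracts : (A → A → Set) → A → Set
  Contracts R x = ∀ y → y ⋖ x → R x y

  Forces : A → A → Set₁
  Forces j j' = ∀ (R : A → A → Set) → IsCongruence R → Contracts R j → Contracts R j'

-- s-trees.  Nodes 1..n of the paper are Fin n (node k+1 is k).
-- A raw tree lists, for every node k, its children from left to right;
-- `nothing` is a leaf, `just m` is the node m.  The root (not stored)
-- has the single child node 1 (i.e. Fin.zero).

sum : List ℕ → ℕ
sum = foldr ℕ._+_ 0

all : {X : Set} → (X → Bool) → List X → Bool
all p = foldr (λ x b → p x ∧ b) true

Raw : ℕ → Set
Raw n = Vec (List (Maybe (Fin n))) n

module _ {n : ℕ} (s : Fin n → ℕ) where

  private
    isJust≡ : Fin n → Maybe (Fin n) → ℕ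
    isJust≡ m (just k) = if toℕ m ≡ᵇ toℕ k then 1 else 0
    isJust≡ m nothing  = 0

    childOK : Fin n → Maybe (Fin n) → Bool
    childOK k (just m) = toℕ k <ᵇ toℕ m
    childOK k nothing  = true

  occurrences : Raw n → Fin n → ℕ
  occurrences t m = sum (map (isJust≡ m) (List.concat (toList t)))

  valid : Raw n → Bool
  valid t = all (λ k → (List.length (lookup t k) ≡ᵇ suc (s k))
                       ∧ all (childOK k) (lookup t k)
                       ∧ (occurrences t k ≡ᵇ (if toℕ k ≡ᵇ 0 then 0 else 1)))
                (allFin n)

  STree : Set
  STree = Σ (Raw n) (λ t → T (valid t))

  private
    findIdx : Fin n → List (Maybe (Fin n)) → Maybe ℕ
    findIdx m []             = nothing
    findIdx m (nothing ∷ xs) = Data.Maybe.map suc (findIdx m xs)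
      where import Data.Maybe
    findIdx m (just k ∷ xs)  =
      if toℕ m ≡ᵇ toℕ k then just 0 else Data.Maybe.map suc (findIdx m xs)
      where import Data.Maybe

    firstJust : {B : Set} → List (Maybe B) → Maybe B
    firstJust []             = nothing
    firstJust (just b ∷ _)   = just b
    firstJust (nothing ∷ xs) = firstJust xs

  -- parent of node m together with the (0-based, from the left) index of
  -- the edge from the parent to m
  parent : Raw n → Fin n → Maybe (Fin n × ℕ)
  parent t m = firstJust (map (λ p → Data.Maybe.map (p ,_) (findIdx m (lookup t p)))
                              (allFin n))
    where import Data.Maybe

  -- edges (node, child index) on the path from the root to m
  -- (fuel n suffices since paths have length < n)
  pathF : ℕ → Raw n → Fin n → List (Fin n × ℕ)
  pathF zero    t m = []
  pathF (suc f) t m with parent t m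
  ... | nothing      = []
  ... | just (p , c) = pathF f t p ++ [ (p , c) ]

  path : Raw n → Fin n → List (Fin n × ℕ)
  path t m = pathF n t m

  private
    lookupEdge : Fin n → List (Fin n × ℕ) → Maybe ℕ
    lookupEdge i [] = nothing
    lookupEdge i ((p , c) ∷ xs) = if toℕ i ≡ᵇ toℕ p then just c else lookupEdge i xs

    diverge : List (Fin n × ℕ) → List (Fin n × ℕ) → Maybe (ℕ × ℕ)
    diverge ((p , c) ∷ xs) ((q , d) ∷ ys) = if c ≡ᵇ d then diverge xs ys else just (c , d)
    diverge _ _ = nothing

  -- number of outgoing edges of i strictly to the right of the path from
  -- the root to j
  edgesRight : Raw n → Fin n → Fin n → ℕ
  edgesRight t i j with lookupEdge i (path t j)
  ... | just c  = s i ∸ c            -- i on the path, path uses edge c of i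
  ... | nothing with diverge (path t i) (path t j)
  ...   | just (ci , cj) = if cj <ᵇ ci then suc (s i) else 0  -- i right / left of path
  ...   | nothing        = 0

  pos : Raw n → Fin n → Fin n → ℕ
  pos t i j = s i ⊓ edgesRight t i j

  _≤w_ : STree → STree → Set
  T₁ ≤w T₂ = ∀ i j → i Fin.< j → pos (proj₁ T₁) i j ℕ.≤ pos (proj₁ T₂) i j

  record Arc : Set where
    field
      i j   : Fin n
      i<j   : i Fin.< j
      A B   : Subset n
      disj  : ∀ k → k ∈ A → k ∈ B → ⊥
      cover : ∀ k → ((k ∈ A) ⊎ (k ∈ B)) ⇔ ((i Fin.< k) × (k Fin.< j) × (s k ≢ 0))
      r     : ℕ
      1≤r   : 1 ℕ.≤ r
      r≤s   : r ℕ.≤ s i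

  record Subarc (α α' : Arc) : Set where
    private
      module a = Arc α
      module a' = Arc α'
    field
      i'≤i  : a'.i Fin.≤ a.i
      j≤j'  : a.j Fin.≤ a'.j
      A⊆A'  : a.A ⊆ a'.A
      B⊆B'  : a.B ⊆ a'.B
      s0    : s a.j ≡ 0 → a.j ≡ a'.j
      same  : a'.i ≡ a.i → a.r ≡ a'.r
      less  : a'.i Fin.< a.i →
              ((a.i ∈ a'.A) × (a.r ≡ 1)) ⊎ ((a.i ∈ a'.B) × (a.r ≡ s a.i))

  nextIn : Subset n → Fin n → Maybe (Fin n)
  nextIn J k = head (filter (λ m → (k Fin.<? m) ×-dec (m ∈? J)) (allFin n))

  -- the raw tree T∨(i,j,A,B,r): right comb on [n] ∖ (A ∪ {j}), with the
  -- (r+1)-st edge of i from the right replaced by the right comb on A ∪ {j}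
  tveeRaw : Arc → Raw n
  tveeRaw α = tabulate children
    where
      open Arc α
      J₁ : Subset n
      J₁ = A ∪ ⁅ j ⁆
      J₀ : Subset n
      J₀ = Data.Fin.Subset.∁ J₁
        where import Data.Fin.Subset
      children : Fin n → List (Maybe (Fin n))
      children k with does (k ∈? J₁) | does (toℕ k ℕ.≟ toℕ i)
      ... | true  | _    = replicate (s k) nothing ++ [ nextIn J₁ k ]
      ... | false | false = replicate (s k) nothing ++ [ nextIn J₀ k ]
      ... | false | true  = replicate (s i ∸ r) nothing ++ [ nextIn J₁ i ]
                            ++ replicate (r ∸ 1) nothing ++ [ nextIn J₀ i ]

{-# OPTIONS --safe #-}
-- An s-tree is determined by its function (i , k) ↦ pos(i,k), and the functions f that arise are
-- those with f i k ≤ s i such that, for i < j < k, f j k > 0 implies f i j ≤ f i k and f j k < s j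
-- implies f i k ≤ f i j.  The theorem is proved for these functions.
--
-- If α is a subarc of α′, first extend its right end and then its left end.  Each step is witnessed
-- by an explicit element w: a congruence collapsing T∨(α) with its lower cover collapses
-- T∨(α) ∨ w with w, and meeting with T∨(α′) collapses T∨(α′) with its lower cover.
--
-- Conversely, call two trees equivalent if they lie above the same T∨(β) for β a subarc of α′.
-- Meets preserve this relation.  It can equally be defined with the meet irreducibles of these β,
-- because the two inequalities on f exchange the two families by induction on the length of β;
-- so joins preserve it too.  It separates T∨(α′) from its lower cover, and it contracts T∨(α)
-- for every α that is not a subarc of α′.
module Submission where

open import Defs
open import Data.Nat as ℕ using (ℕ; zero; suc; _+_; _∸_; _⊓_; _≡ᵇ_; _<ᵇ_; _≤_; _<_; z≤n; s≤s)
import Data.Nat.Properties as ℕₚ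
open import Data.Bool using (Bool; true; false; T; if_then_else_; _∧_)
open import Data.Bool.Properties using (T-∧; T-irrelevant)
open import Data.Fin as Fin using (Fin; toℕ)
import Data.Fin.Properties as Finₚ
open import Data.Fin.Subset using (Subset; _∈_; _∉_; _⊆_; _∪_; _∩_; ∁; ⁅_⁆)
open import Data.Fin.Subset.Properties using (_∈?_; x∈⁅x⁆; x∈⁅y⁆⇒x≡y; x∈p∪q⁻; x∈p∩q⁻; x∈p∩q⁺; p⊆p∪q; q⊆p∪q; _⊆?_; x∈p⇒x∉∁p; x∉p⇒x∈∁p; x∈∁p⇒x∉p)
import Data.Fin.Induction as FinI
open import Data.List as List using (List; []; _∷_; _++_; [_]; replicate; allFin; filter; head; map; length)
open import Data.List.Properties using (++-assoc; length-replicate; length-++)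
open import Data.List.Membership.Propositional using () renaming (_∈_ to _∈ˡ_)
open import Data.List.Membership.Propositional.Properties using (∈-allFin)
open import Data.List.Relation.Unary.Any using () renaming (here to hereᵃ; there to thereᵃ)
open import Data.Maybe using (Maybe; just; nothing)
import Data.Maybe
open import Data.Maybe.Properties using (just-injective)
open import Data.Product using (Σ; ∃; ∃₂; _×_; _,_; proj₁; proj₂)
open import Data.Sum using (_⊎_; inj₁; inj₂)
open import Data.Empty using (⊥-elim)
open import Data.Vec as Vec using (Vec; lookup; tabulate; toList)
import Data.Vec.Properties as Vecₚ
open import Function using (_∘_; id)
open import Function.Bundles using (_⇔_; Equivalence; mk⇔)
open import Induction.WellFounded using (Acc; acc)
open import Relation.Nullary using (¬_; Dec; yes; no; does)
open import Relation.Nullary.Decidable using (_×-dec_; _→-dec_; ¬?; decidable-stable; toSum; _⊎-dec_; dec-true)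
open import Relation.Nullary.Negation using (contradiction)
open import Relation.Unary using (Decidable)
open import Relation.Binary.Definitions using (tri<; tri≈; tri>)
open import Relation.Binary.Structures using (IsEquivalence)
open import Relation.Binary.PropositionalEquality hiding ([_]; isEquivalence)

-- The clauses of `Subarc` are the conditions under which changing a single entry sets off `up` or
-- `down`. T∨(α) and its lower cover differ only at (i , j). For i in A′, raising this entry from 0
-- to 1 makes `up` applicable to an earlier row, whence r = 1. For i in B′, lowering it from s i to
-- s i - 1 makes `down` applicable, whence r = s i. Moving j to the right relies on a positive entry
-- in row j, whence s j ≠ 0. Each w is built so that this reaction carries the change over to the
-- larger arc. In the converse the obstacle is the join: lying above a join irreducible is a
-- condition stable under meets only. The remedy is a dichotomy: if all entries of f that T∨(β)
-- requires are large enough, except the one at the two ends of β, then f lies below the meet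
-- irreducible of β. So a shortest failure in one family is an instance of the other. Joins and
-- meets of arbitrary trees are never computed; those that occur are recognised by their universal
-- property.

data At {X : Set} : List X → ℕ → X → Set where
  here  : ∀ {x xs} → At (x ∷ xs) 0 x
  there : ∀ {x y xs c} → At xs c y → At (x ∷ xs) (suc c) y

module _ {X : Set} where

  At-functional : ∀ {xs : List X} {c y z} → At xs c y → At xs c z → y ≡ z
  At-functional here      here      = refl
  At-functional (there a) (there b) = At-functional a b

  At-bound : ∀ {xs : List X} {c y} → At xs c y → c < length xs
  At-bound here      = s≤s z≤n
  At-bound (there a) = s≤s (At-bound a)

  At-total : ∀ (xs : List X) {c} → c < length xs → ∃ (At xs c)
  At-total (x ∷ xs) {zero}  _       = x , here
  At-total (x ∷ xs) {suc c} (s≤s l) = let y , a = At-total xs l in y , there a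

  At-ext : ∀ {xs ys : List X} → length xs ≡ length ys →
           (∀ {c y z} → At xs c y → At ys c z → y ≡ z) → xs ≡ ys
  At-ext {[]}     {[]}     _ _ = refl
  At-ext {x ∷ xs} {y ∷ ys} l e =
    cong₂ _∷_ (e here here) (At-ext (ℕₚ.suc-injective l) (λ a b → e (there a) (there b)))

  all-elim : ∀ {p : X → Bool} {xs c y} → T (all p xs) → At xs c y → T (p y)
  all-elim {p} {x ∷ xs} t here      = proj₁ (Equivalence.to (T-∧ {p x}) t)
  all-elim {p} {x ∷ xs} t (there a) = all-elim (proj₂ (Equivalence.to (T-∧ {p x}) t)) a

  all-intro : ∀ {p : X → Bool} xs → (∀ {c y} → At xs c y → T (p y)) → T (all p xs)
  all-intro     []       h = _
  all-intro {p} (x ∷ xs) h = Equivalence.from (T-∧ {p x}) (h here , all-intro xs (h ∘ there))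

  ∈⇒At : ∀ {x : X} {xs} → x ∈ˡ xs → ∃ λ c → At xs c x
  ∈⇒At (hereᵃ refl) = 0 , here
  ∈⇒At (thereᵃ i)   = let c , a = ∈⇒At i in suc c , there a

-- Counting the occurrences of a node

module Occurrences {n : ℕ} (m : Fin n) (g : Maybe (Fin n) → ℕ)
  (g-nothing : g nothing ≡ 0)
  (g-just : ∀ k → g (just k) ≡ (if toℕ m ≡ᵇ toℕ k then 1 else 0)) where

  -- The summand of `occurrences` is private; it enters as `g`, through the two equations that
  -- determine it.
  count : List (Maybe (Fin n)) → ℕ
  count xs = sum (map g xs)

  count-++ : ∀ xs ys → count (xs ++ ys) ≡ count xs + count ys
  count-++ []       ys = refl
  count-++ (x ∷ xs) ys = trans (cong (g x +_) (count-++ xs ys)) (sym (ℕₚ.+-assoc (g x) _ _))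

  hit : g (just m) ≡ 1
  hit with toℕ m ≡ᵇ toℕ m in e | g-just m
  ... | true  | q = q
  ... | false | q = ⊥-elim (subst T e (ℕₚ.≡⇒≡ᵇ (toℕ m) _ refl))

  miss : ∀ y → y ≢ just m → g y ≡ 0
  miss nothing  _ = g-nothing
  miss (just k) ne with toℕ m ≡ᵇ toℕ k in e | g-just k
  ... | false | q = q
  ... | true  | q = contradiction (cong just (sym (Finₚ.toℕ-injective
                      (ℕₚ.≡ᵇ⇒≡ (toℕ m) (toℕ k) (subst T (sym e) _))))) ne

  hit? : ∀ y → Dec (y ≡ just m)
  hit? nothing = no λ ()
  hit? (just k) with k Fin.≟ m
  ... | yes e = yes (cong just e)
  ... | no ne = no (ne ∘ just-injective)

  count≥1 : ∀ {xs c} → At xs c (just m) → 1 ≤ count xs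
  count≥1 here      = ℕₚ.≤-trans (ℕₚ.≤-reflexive (sym hit)) (ℕₚ.m≤m+n _ _)
  count≥1 (there a) = ℕₚ.≤-trans (count≥1 a) (ℕₚ.m≤n+m _ _)

  count≡0 : ∀ xs → (∀ {c} → ¬ At xs c (just m)) → count xs ≡ 0
  count≡0 []       h = refl
  count≡0 (x ∷ xs) h = cong₂ _+_ (miss x λ { refl → h here }) (count≡0 xs (h ∘ there))

  count-ex : ∀ xs → 1 ≤ count xs → ∃ λ c → At xs c (just m)
  count-ex (x ∷ xs) l with hit? x
  ... | yes refl = 0 , here
  ... | no ne    = let c , a = count-ex xs (subst (λ z → 1 ≤ z + count xs) (miss x ne) l)
                   in suc c , there a

  count≤1⇒unique : ∀ {xs} → count xs ≤ 1 → ∀ {c d} → At xs c (just m) → At xs d (just m) → c ≡ d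
  count≤1⇒unique l here      here      = refl
  count≤1⇒unique l here      (there b) = contradiction
    (ℕₚ.≤-trans (ℕₚ.+-mono-≤ (ℕₚ.≤-reflexive (sym hit)) (count≥1 b)) l) λ { (s≤s ()) }
  count≤1⇒unique l (there b) here      = contradiction
    (ℕₚ.≤-trans (ℕₚ.+-mono-≤ (ℕₚ.≤-reflexive (sym hit)) (count≥1 b)) l) λ { (s≤s ()) }
  count≤1⇒unique l (there a) (there b) =
    cong suc (count≤1⇒unique (ℕₚ.≤-trans (ℕₚ.m≤n+m _ _) l) a b)

  unique⇒count≤1 : ∀ xs → (∀ {c d} → At xs c (just m) → At xs d (just m) → c ≡ d) → count xs ≤ 1
  unique⇒count≤1 []       u = z≤n
  unique⇒count≤1 (x ∷ xs) u with hit? x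
  ... | yes refl = ℕₚ.≤-reflexive (cong₂ _+_ hit (count≡0 xs λ a → contradiction (u here (there a)) λ ()))
  ... | no ne    = subst (λ z → z + count xs ≤ 1) (sym (miss x ne))
                     (unique⇒count≤1 xs λ a b → ℕₚ.suc-injective (u (there a) (there b)))

  total : ∀ {k} → Vec (List (Maybe (Fin n))) k → ℕ
  total t = count (List.concat (toList t))

  total≥1 : ∀ {k} (t : Vec (List (Maybe (Fin n))) k) p {c} → At (lookup t p) c (just m) → 1 ≤ total t
  total≥1 (xs Vec.∷ t) p a = subst (1 ≤_) (sym (count-++ xs _)) (lem p a)
    where
    lem : ∀ p {c} → At (lookup (xs Vec.∷ t) p) c (just m) → 1 ≤ count xs + total t
    lem Fin.zero    a = ℕₚ.≤-trans (count≥1 a) (ℕₚ.m≤m+n _ _)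
    lem (Fin.suc p) a = ℕₚ.≤-trans (total≥1 t p a) (ℕₚ.m≤n+m _ _)

  total≡0 : ∀ {k} (t : Vec (List (Maybe (Fin n))) k) →
            (∀ p {c} → ¬ At (lookup t p) c (just m)) → total t ≡ 0
  total≡0 Vec.[]       h = refl
  total≡0 (xs Vec.∷ t) h = trans (count-++ xs _)
    (cong₂ _+_ (count≡0 xs (h Fin.zero)) (total≡0 t (h ∘ Fin.suc)))

  total-ex : ∀ {k} (t : Vec (List (Maybe (Fin n))) k) → 1 ≤ total t →
             ∃₂ λ p c → At (lookup t p) c (just m)
  total-ex (xs Vec.∷ t) l with count xs ℕ.≟ 0 | subst (1 ≤_) (count-++ xs _) l
  ... | yes e | l′ = let p , c , a = total-ex t (subst (λ z → 1 ≤ z + total t) e l′)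
                     in Fin.suc p , c , a
  ... | no ne | _  = let c , a = count-ex xs (ℕₚ.n≢0⇒n>0 ne) in Fin.zero , c , a

  total≤1⇒unique : ∀ {k} (t : Vec (List (Maybe (Fin n))) k) → total t ≤ 1 → ∀ p q {c d} →
                   At (lookup t p) c (just m) → At (lookup t q) d (just m) → p ≡ q × c ≡ d
  total≤1⇒unique (xs Vec.∷ t) l p q a b = lem (subst (_≤ 1) (count-++ xs _) l) p q a b
    where
    lem : count xs + total t ≤ 1 → ∀ p q {c d} → At (lookup (xs Vec.∷ t) p) c (just m) →
          At (lookup (xs Vec.∷ t) q) d (just m) → p ≡ q × c ≡ d
    lem l Fin.zero Fin.zero a b = refl , count≤1⇒unique (ℕₚ.≤-trans (ℕₚ.m≤m+n _ _) l) a b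
    lem l Fin.zero (Fin.suc q) a b =
      contradiction (ℕₚ.≤-trans (ℕₚ.+-mono-≤ (count≥1 a) (total≥1 t q b)) l) λ { (s≤s ()) }
    lem l (Fin.suc p) Fin.zero a b =
      contradiction (ℕₚ.≤-trans (ℕₚ.+-mono-≤ (count≥1 b) (total≥1 t p a)) l) λ { (s≤s ()) }
    lem l (Fin.suc p) (Fin.suc q) a b =
      let e , e′ = total≤1⇒unique t (ℕₚ.≤-trans (ℕₚ.m≤n+m _ _) l) p q a b in cong Fin.suc e , e′

  unique⇒total≤1 : ∀ {k} (t : Vec (List (Maybe (Fin n))) k) →
                   (∀ p q {c d} → At (lookup t p) c (just m) → At (lookup t q) d (just m) → p ≡ q × c ≡ d) →
                   total t ≤ 1
  unique⇒total≤1 Vec.[]       u = z≤n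
  unique⇒total≤1 (xs Vec.∷ t) u with count xs ℕ.≟ 0
  ... | yes e = subst (_≤ 1) (sym (trans (count-++ xs _) (cong (_+ total t) e)))
                  (unique⇒total≤1 t λ p q a b → let e , e′ = u (Fin.suc p) (Fin.suc q) a b
                                                in Finₚ.suc-injective e , e′)
  ... | no ne = let c , a = count-ex xs (ℕₚ.n≢0⇒n>0 ne) in
    subst (_≤ 1) (sym (trans (count-++ xs _) (trans (cong (count xs +_)
        (total≡0 t λ p b → contradiction (proj₁ (u Fin.zero (Fin.suc p) a b)) λ ())) (ℕₚ.+-identityʳ _))))
      (unique⇒count≤1 xs λ a b → proj₂ (u Fin.zero Fin.zero a b))

-- Well-formed trees

module Validity {n : ℕ} (s : Fin n → ℕ) where

  Child : Raw n → Fin n → ℕ → Fin n → Set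
  Child t p c m = At (lookup t p) c (just m)

  -- The occurrence count of `valid` is split into existence and uniqueness of the parent edge. That
  -- node 0 is nobody's child is a consequence of `lt`.
  record WellFormed (t : Raw n) : Set where
    field
      len  : ∀ k → length (lookup t k) ≡ suc (s k)
      lt   : ∀ {p c m} → Child t p c m → p Fin.< m
      par  : ∀ m → 0 < toℕ m → ∃₂ λ p c → Child t p c m
      uniq : ∀ {p q c d m} → Child t p c m → Child t q d m → p ≡ q × c ≡ d

  -- The child test of `valid` is private, hence the parameter `ok`.
  valid⇒wellFormed : ∀ t → T (valid s t) → WellFormed t
  valid⇒wellFormed t = go _ (λ k m → ℕₚ.<ᵇ⇒< (toℕ k) (toℕ m))
    where
    go : (ok : Fin n → Maybe (Fin n) → Bool) → (∀ k m → T (ok k (just m)) → k Fin.< m) →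
         T (all (λ k → (length (lookup t k) ≡ᵇ suc (s k)) ∧ all (ok k) (lookup t k)
                       ∧ (occurrences s t k ≡ᵇ (if toℕ k ≡ᵇ 0 then 0 else 1))) (allFin n)) →
         WellFormed t
    go ok ok⇒< v = record
      { len  = λ k → ℕₚ.≡ᵇ⇒≡ _ _ (proj₁ (at k))
      ; lt   = λ {p} {_} {m} a → ok⇒< p m (all-elim (proj₁ (proj₂ (at p))) a)
      ; par  = λ m l → Occurrences.total-ex m _ refl (λ _ → refl) t
                 (ℕₚ.≤-reflexive (sym (trans (occ m) (if-pos m l))))
      ; uniq = λ {p} {q} {_} {_} {m} → Occurrences.total≤1⇒unique m _ refl (λ _ → refl) t
                 (ℕₚ.≤-trans (ℕₚ.≤-reflexive (occ m)) (if≤1 m)) p q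
      }
      where
      at : ∀ k → T (length (lookup t k) ≡ᵇ suc (s k)) × T (all (ok k) (lookup t k))
                 × T (occurrences s t k ≡ᵇ (if toℕ k ≡ᵇ 0 then 0 else 1))
      at k = let x , y = Equivalence.to (T-∧ {length (lookup t k) ≡ᵇ suc (s k)})
                           (all-elim v (proj₂ (∈⇒At (∈-allFin k))))
             in x , Equivalence.to (T-∧ {all (ok k) (lookup t k)}) y
      occ : ∀ m → occurrences s t m ≡ (if toℕ m ≡ᵇ 0 then 0 else 1)
      occ m = ℕₚ.≡ᵇ⇒≡ _ _ (proj₂ (proj₂ (at m)))
      if-pos : ∀ (m : Fin n) → 0 < toℕ m → (if toℕ m ≡ᵇ 0 then 0 else 1) ≡ 1
      if-pos (Fin.suc m) _ = refl
      if≤1 : ∀ (m : Fin n) → (if toℕ m ≡ᵇ 0 then 0 else 1) ≤ 1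
      if≤1 Fin.zero    = z≤n
      if≤1 (Fin.suc m) = s≤s z≤n

  wellFormed⇒valid : ∀ t → WellFormed t → T (valid s t)
  wellFormed⇒valid t w = all-intro (allFin n) λ {_} {k} _ →
    Equivalence.from T-∧ (ℕₚ.≡⇒≡ᵇ _ _ (len k) , Equivalence.from T-∧
      ( all-intro (lookup t k) (λ { {_} {just m} a → ℕₚ.<⇒<ᵇ (lt a) ; {_} {nothing} a → _ })
      , ℕₚ.≡⇒≡ᵇ (occurrences s t k) _ (occ k)))
    where
    open WellFormed w
    occ : ∀ k → occurrences s t k ≡ (if toℕ k ≡ᵇ 0 then 0 else 1)
    occ k with toℕ k in e
    ... | zero  = Occurrences.total≡0 k _ refl (λ _ → refl) t
                    λ p a → contradiction (subst (toℕ p <_) e (lt a)) λ ()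
    ... | suc _ = let p , c , a = par k (subst (0 <_) (sym e) (s≤s z≤n)) in
      ℕₚ.≤-antisym (Occurrences.unique⇒total≤1 k _ refl (λ _ → refl) t (λ p q → uniq))
                   (Occurrences.total≥1 k _ refl (λ _ → refl) t p a)

-- Paths, relative positions of two nodes, and the values of `pos`

module Paths {n : ℕ} (s : Fin n → ℕ) where
  open Validity s

  -- `findIdx`, `firstJust`, `lookupEdge` and `diverge` are private, so they cannot be named.
  -- Each block below has a solved definition: it is `parent` or `edgesRight` with the subterm
  -- abstracted by the `with` turned into an argument.
  mutual
    parentAmong : Raw n → Fin n → List (Fin n) → Maybe (Fin n × ℕ)
    parentAmong = _

    parentAmong-allFin : ∀ t m → parentAmong t m (allFin n) ≡ parent s t m
    parentAmong-allFin t m with allFin n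
    ... | ps = refl

  mutual
    parentVia : Raw n → Fin n → Fin n → List (Fin n) →
                (Maybe ℕ → Maybe (Fin n × ℕ)) → List (Maybe (Fin n)) → Maybe (Fin n × ℕ)
    parentVia = _

    parentVia-lookup : ∀ t m p ps →
      parentVia t m p ps (Data.Maybe.map (p ,_)) (lookup t p) ≡ parentAmong t m (p ∷ ps)
    parentVia-lookup t m p ps with Data.Maybe.map {B = Fin n × ℕ} (_,_ {B = λ _ → ℕ} p) | lookup t p
    ... | φ | xs = refl

  mutual
    rightOf : Raw n → Fin n → Fin n → List (Fin n × ℕ) → ℕ
    rightOf = _

    rightOf-path : ∀ t i j → rightOf t i j (path s t j) ≡ edgesRight s t i j
    rightOf-path t i j with path s t j
    ... | xs = refl

  mutual
    rightOfDiverging : Raw n → Fin n → Fin n → List (Fin n × ℕ) → List (Fin n × ℕ) → ℕ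
    rightOfDiverging = _

    rightOfDiverging-path : ∀ t i j →
      rightOfDiverging t i j (path s t i) (path s t j) ≡ rightOf t i j []
    rightOfDiverging-path t i j with path s t i | path s t j
    ... | xs | ys = refl

  ≡ᵇ-refl : ∀ k → (k ≡ᵇ k) ≡ true
  ≡ᵇ-refl zero    = refl
  ≡ᵇ-refl (suc k) = ≡ᵇ-refl k

  ≢⇒≡ᵇ-false : ∀ {k l} → k ≢ l → (k ≡ᵇ l) ≡ false
  ≢⇒≡ᵇ-false {k} {l} ne with k ≡ᵇ l in e
  ... | false = refl
  ... | true  = contradiction (ℕₚ.≡ᵇ⇒≡ k l (subst T (sym e) _)) ne

  ≢⇒toℕ-≡ᵇ-false : ∀ {k l : Fin n} → k ≢ l → (toℕ k ≡ᵇ toℕ l) ≡ false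
  ≢⇒toℕ-≡ᵇ-false ne = ≢⇒≡ᵇ-false (ne ∘ Finₚ.toℕ-injective)

  module _ (t : Raw n) (m p : Fin n) (ps : List (Fin n)) where

    -- The search applies `map suc` after each recursive call. With the continuation `φ` as an
    -- argument, these successors accumulate in `φ` and the induction on the list goes through.
    parentVia-miss : ∀ {φ} → φ nothing ≡ nothing → ∀ xs → (∀ {c} → ¬ At xs c (just m)) →
                     parentVia t m p ps φ xs ≡ parentAmong t m ps
    parentVia-miss eq [] h rewrite eq = refl
    parentVia-miss {φ} eq (nothing ∷ xs) h =
      parentVia-miss {φ ∘ Data.Maybe.map suc} eq xs (h ∘ there)
    parentVia-miss {φ} eq (just k ∷ xs) h
      rewrite ≢⇒toℕ-≡ᵇ-false {m} {k} (λ { refl → h here }) =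
      parentVia-miss {φ ∘ Data.Maybe.map suc} eq xs (h ∘ there)

    parentVia-hit : ∀ {φ b xs c} → φ (just c) ≡ just b → At xs c (just m) →
                    (∀ {d} → At xs d (just m) → d ≡ c) → parentVia t m p ps φ xs ≡ just b
    parentVia-hit eq here u rewrite ≡ᵇ-refl (toℕ m) | eq = refl
    parentVia-hit {φ} {xs = nothing ∷ xs} eq (there a) u =
      parentVia-hit {φ ∘ Data.Maybe.map suc} eq a (ℕₚ.suc-injective ∘ u ∘ there)
    parentVia-hit {φ} {xs = just k ∷ xs} eq (there a) u
      rewrite ≢⇒toℕ-≡ᵇ-false {m} {k} (λ { refl → contradiction (u here) λ () }) =
      parentVia-hit {φ ∘ Data.Maybe.map suc} eq a (ℕₚ.suc-injective ∘ u ∘ there)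

    parentAmong-miss : (∀ {c} → ¬ Child t p c m) → parentAmong t m (p ∷ ps) ≡ parentAmong t m ps
    parentAmong-miss h = trans (sym (parentVia-lookup t m p ps))
      (parentVia-miss {φ = Data.Maybe.map (p ,_)} refl (lookup t p) h)

    parentAmong-hit : ∀ {c} → Child t p c m → (∀ {d} → Child t p d m → d ≡ c) →
                      parentAmong t m (p ∷ ps) ≡ just (p , c)
    parentAmong-hit a u = trans (sym (parentVia-lookup t m p ps))
      (parentVia-hit {φ = Data.Maybe.map (p ,_)} refl a u)

  -- Stands in for the private edge lookup of `edgesRight`, with a test by decidable equality so
  -- that a match identifies the two nodes. `rightOf-just` and `rightOf-nothing` are the link.
  edgeOf : Fin n → List (Fin n × ℕ) → Maybe ℕ
  edgeOf i []             = nothing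
  edgeOf i ((p , c) ∷ xs) = if does (i Fin.≟ p) then just c else edgeOf i xs

  edgeOf-++ : ∀ {i} xs {ys} → edgeOf i xs ≡ nothing → edgeOf i (xs ++ ys) ≡ edgeOf i ys
  edgeOf-++ []               e = refl
  edgeOf-++ {i} ((p , c) ∷ xs) e with i Fin.≟ p
  ... | no _ = edgeOf-++ xs e

  edgeOf-++ˡ : ∀ {i c} xs {ys} → edgeOf i xs ≡ just c → edgeOf i (xs ++ ys) ≡ just c
  edgeOf-++ˡ {i} ((p , c) ∷ xs) e with i Fin.≟ p
  ... | yes _ = e
  ... | no _  = edgeOf-++ˡ xs e

  edgeOf-here : ∀ i c {xs} → edgeOf i ((i , c) ∷ xs) ≡ just c
  edgeOf-here i c with i Fin.≟ i
  ... | yes _ = refl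
  ... | no ne = contradiction refl ne

  edgeOf-≢ : ∀ i p c xs → i ≢ p → edgeOf i ((p , c) ∷ xs) ≡ edgeOf i xs
  edgeOf-≢ i p c xs ne with i Fin.≟ p
  ... | yes e = contradiction e ne
  ... | no _  = refl

  rightOf-just : ∀ t {i j c} xs → edgeOf i xs ≡ just c → rightOf t i j xs ≡ s i ∸ c
  rightOf-just t {i} ((p , d) ∷ xs) e with i Fin.≟ p
  rightOf-just t {i} ((p , d) ∷ xs) refl | yes refl rewrite ≡ᵇ-refl (toℕ i) = refl
  ... | no ne rewrite ≢⇒toℕ-≡ᵇ-false ne = rightOf-just t xs e

  rightOf-nothing : ∀ t {i j} xs → edgeOf i xs ≡ nothing → rightOf t i j xs ≡ rightOf t i j []
  rightOf-nothing t [] e = refl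
  rightOf-nothing t {i} ((p , d) ∷ xs) e with i Fin.≟ p
  ... | no ne rewrite ≢⇒toℕ-≡ᵇ-false ne = rightOf-nothing t xs e

  rightOfDiverging-at : ∀ t i j xs {h h′ c d ys zs} → c ≢ d →
    rightOfDiverging t i j (xs ++ (h , c) ∷ ys) (xs ++ (h′ , d) ∷ zs)
      ≡ (if d <ᵇ c then suc (s i) else 0)
  rightOfDiverging-at t i j []             ne rewrite ≢⇒≡ᵇ-false ne = refl
  rightOfDiverging-at t i j ((p , c) ∷ xs) ne rewrite ≡ᵇ-refl c     = rightOfDiverging-at t i j xs ne

  module _ {t : Raw n} (w : WellFormed t) where
    open WellFormed w

    Child-bound : ∀ {p c m} → Child t p c m → c ≤ s p
    Child-bound {p} a = ℕₚ.≤-pred (subst (_ <_) (len p) (At-bound a))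

    parent-Child : ∀ {p c m} → Child t p c m → parent s t m ≡ just (p , c)
    parent-Child {p} {c} {m} a = trans (sym (parentAmong-allFin t m)) (go (∈-allFin p))
      where
      go : ∀ {ps} → p ∈ˡ ps → parentAmong t m ps ≡ just (p , c)
      go {q ∷ ps} i with q Fin.≟ p
      ... | yes refl = parentAmong-hit t m q ps a λ b → proj₂ (uniq b a)
      go {q ∷ ps} (hereᵃ e)  | no ne = contradiction (sym e) ne
      go {q ∷ ps} (thereᵃ i) | no ne = trans
        (parentAmong-miss t m q ps λ b → ne (proj₁ (uniq b a))) (go i)

    parent-root : ∀ {m} → toℕ m ≡ 0 → parent s t m ≡ nothing
    parent-root {m} e = trans (sym (parentAmong-allFin t m)) (go (allFin n))
      where
      go : ∀ ps → parentAmong t m ps ≡ nothing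
      go []       = refl
      go (q ∷ ps) = trans
        (parentAmong-miss t m q ps λ b → contradiction (subst (toℕ q <_) e (lt b)) λ ()) (go ps)

    data Path : Fin n → List (Fin n × ℕ) → Set where
      root : ∀ {m} → toℕ m ≡ 0 → Path m []
      snoc : ∀ {p c m xs} → Path p xs → Child t p c m → Path m (xs ++ [ (p , c) ])

    -- A parent has a smaller index than its child, so the index of `m` bounds its depth.
    pathF-Path : ∀ f m → toℕ m ≤ f → Path m (pathF s f t m)
    pathF-Path zero    m l = root (ℕₚ.n≤0⇒n≡0 l)
    pathF-Path (suc f) m l with toℕ m ℕ.≟ 0
    ... | yes e rewrite parent-root {m} e = root e
    ... | no ne with par m (ℕₚ.n≢0⇒n>0 ne)
    ...   | p , c , a rewrite parent-Child a =
      snoc (pathF-Path f p (ℕₚ.≤-pred (ℕₚ.≤-trans (lt a) l))) a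

    path-Path : ∀ m → Path m (path s t m)
    path-Path m = pathF-Path n m (ℕₚ.<⇒≤ (Finₚ.toℕ<n m))

    -- `Sub h c k` places `k` in the subtree that hangs from edge `c` of `h`. It grows at the lower
    -- end, as `Path` does, so that inductions on the two run in parallel.
    data Sub : Fin n → ℕ → Fin n → Set where
      base : ∀ {h c k} → Child t h c k → Sub h c k
      step : ∀ {h c p d k} → Sub h c p → Child t p d k → Sub h c k

    Sub⇒< : ∀ {h c k} → Sub h c k → h Fin.< k
    Sub⇒< (base a)   = lt a
    Sub⇒< (step b a) = ℕₚ.<-trans (Sub⇒< b) (lt a)

    Sub-trans : ∀ {g c h d k} → Sub g c h → Sub h d k → Sub g c k
    Sub-trans a (base b)   = step a b
    Sub-trans a (step b x) = step (Sub-trans a b) x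

    Sub-bound : ∀ {h c k} → Sub h c k → c ≤ s h
    Sub-bound (base a)   = Child-bound a
    Sub-bound (step b _) = Sub-bound b

    Sub-first : ∀ {h c k} → Sub h c k → ∃ λ k′ → Child t h c k′ × (k′ ≡ k ⊎ ∃ λ d → Sub k′ d k)
    Sub-first (base a)   = _ , a , inj₁ refl
    Sub-first (step b x) with Sub-first b
    ... | k′ , a , inj₁ refl    = k′ , a , inj₂ (_ , base x)
    ... | k′ , a , inj₂ (d , e) = k′ , a , inj₂ (d , step e x)

    edgeOf-< : ∀ {m xs h} → Path m xs → m Fin.≤ h → edgeOf h xs ≡ nothing
    edgeOf-< (root _) _ = refl
    edgeOf-< {h = h} (snoc {xs = xs} P a) m≤h =
      trans (edgeOf-++ xs (edgeOf-< P (ℕₚ.≤-trans (ℕₚ.<⇒≤ (lt a)) m≤h)))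
            (edgeOf-≢ h _ _ [] λ { refl → ℕₚ.≤⇒≯ m≤h (lt a) })

    edgeOf-Sub : ∀ {h c k xs} → Sub h c k → Path k xs → edgeOf h xs ≡ just c
    edgeOf-Sub (base a)   (root e)   = contradiction (subst (_ <_) e (lt a)) λ ()
    edgeOf-Sub (step b a) (root e)   = contradiction (subst (_ <_) e (lt a)) λ ()
    edgeOf-Sub {h} {c} (base a) (snoc {xs = xs} P x) with uniq a x
    ... | refl , refl = trans (edgeOf-++ xs (edgeOf-< P ℕₚ.≤-refl)) (edgeOf-here h c {[]})
    edgeOf-Sub (step b a) (snoc {xs = xs} P x) with uniq a x
    ... | refl , refl = edgeOf-++ˡ xs (edgeOf-Sub b P)

    edgeOf-just : ∀ {h c k xs} → Path k xs → edgeOf h xs ≡ just c → Sub h c k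
    edgeOf-just {h} (snoc {p} {xs = xs} P a) e with edgeOf h xs in eq
    ... | just d  = step (edgeOf-just P (trans eq (trans (sym (edgeOf-++ˡ xs eq)) e))) a
    ... | nothing with h Fin.≟ p | trans (sym (edgeOf-++ xs eq)) e
    ...   | yes refl | refl = base a

    Sub-prefix : ∀ {h c k xs ys} → Path h xs → Sub h c k → Path k ys →
                 ∃ λ zs → ys ≡ xs ++ (h , c) ∷ zs
    Sub-prefix P (base a)   (root e) = contradiction (subst (_ <_) e (lt a)) λ ()
    Sub-prefix P (step b a) (root e) = contradiction (subst (_ <_) e (lt a)) λ ()
    Sub-prefix {xs = xs} P (base a) (snoc Q x) with uniq a x
    ... | refl , refl = [] , cong (_++ _) (Path-functional Q P)
      where
      Path-functional : ∀ {m xs ys} → Path m xs → Path m ys → xs ≡ ys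
      Path-functional (root _) (root _) = refl
      Path-functional (root e) (snoc _ a) = contradiction (subst (_ <_) e (lt a)) λ ()
      Path-functional (snoc _ a) (root e) = contradiction (subst (_ <_) e (lt a)) λ ()
      Path-functional (snoc P a) (snoc Q b) with uniq a b
      ... | refl , refl = cong (_++ _) (Path-functional P Q)
    Sub-prefix {xs = xs} P (step b a) (snoc Q x) with uniq a x
    ... | refl , refl with Sub-prefix P b Q
    ...   | zs , refl = zs ++ _ , ++-assoc xs _ _

    Sub-functional : ∀ {h c d k} → Sub h c k → Sub h d k → c ≡ d
    Sub-functional {k = k} a b = just-injective
      (trans (sym (edgeOf-Sub a (path-Path k))) (edgeOf-Sub b (path-Path k)))

    data Position (i k : Fin n) : Set where
      same  : i ≡ k → Position i k
      below : ∀ {c} → Sub i c k → Position i k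
      above : ∀ {c} → Sub k c i → Position i k
      apart : ∀ {h c d} → Sub h c i → Sub h d k → c ≢ d → Position i k

    root-Sub : ∀ {r i} → toℕ r ≡ 0 → toℕ i ≢ 0 → ∃ λ c → Sub r c i
    root-Sub {r} {i} e ne = go (path-Path i) ne
      where
      go : ∀ {i xs} → Path i xs → toℕ i ≢ 0 → ∃ λ c → Sub r c i
      go (root e′) ne = contradiction e′ ne
      go (snoc {p} P a) ne with toℕ p ℕ.≟ 0
      ... | yes e′ with Finₚ.toℕ-injective (trans e (sym e′))
      ...   | refl = _ , base a
      go (snoc {p} P a) ne | no ne′ = let c , b = go P ne′ in c , step b a

    -- Induction along the path to `k`. The last edge of the path decides only when `i` lies below
    -- the parent of `k`: through another edge the two nodes part there, through the same edge `i`
    -- is `k` or lies below it.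
    position : ∀ i k → Position i k
    position i k = go (path-Path k)
      where
      go : ∀ {k xs} → Path k xs → Position i k
      go (root e) with toℕ i ℕ.≟ 0
      ... | yes e′ = same (Finₚ.toℕ-injective (trans e′ (sym e)))
      ... | no ne  = above (proj₂ (root-Sub e ne))
      go (snoc {p} {c} P a) with go P
      ... | same refl      = below (base a)
      ... | below b        = below (step b a)
      ... | apart x y ne   = apart x (step y a) ne
      ... | above {d} b with d ℕ.≟ c
      ...   | no ne = apart b (base a) ne
      ...   | yes refl with Sub-first b
      ...     | k′ , a′ , r with At-functional a a′ | r
      ...       | refl | inj₁ refl    = same refl
      ...       | refl | inj₂ (_ , x) = above x

    pos-Sub : ∀ {i c k} → Sub i c k → pos s t i k ≡ s i ∸ c
    pos-Sub {i} {c} {k} a = trans (cong (s i ⊓_) (trans (sym (rightOf-path t i k))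
      (rightOf-just t (path s t k) (edgeOf-Sub a (path-Path k))))) (ℕₚ.m≥n⇒m⊓n≡n (ℕₚ.m∸n≤m (s i) c))

    edgesRight-apart : ∀ {h c d i k} → i Fin.< k → Sub h c i → Sub h d k → c ≢ d →
                       edgesRight s t i k ≡ (if d <ᵇ c then suc (s i) else 0)
    edgesRight-apart {h} {c} {d} {i} {k} i<k a b ne
      with Sub-prefix (path-Path h) a (path-Path i) | Sub-prefix (path-Path h) b (path-Path k)
    ... | ys , e | zs , e′ = trans (sym (rightOf-path t i k))
      (trans (rightOf-nothing t (path s t k) notOn)
      (trans (sym (rightOfDiverging-path t i k))
      (trans (cong₂ (rightOfDiverging t i k) e e′) (rightOfDiverging-at t i k (path s t h) ne))))
      where
      -- A path to `k` through `i` would put `k` below `h` at both edges `c` and `d`.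
      notOn : edgeOf i (path s t k) ≡ nothing
      notOn with edgeOf i (path s t k) in eq
      ... | nothing = refl
      ... | just _  = contradiction
        (Sub-functional (Sub-trans a (edgeOf-just (path-Path k) eq)) b) ne

    pos-right : ∀ {h c d i k} → i Fin.< k → Sub h c i → Sub h d k → c < d → pos s t i k ≡ 0
    pos-right {c = c} {d} {i} i<k a b l
      rewrite edgesRight-apart i<k a b (ℕₚ.<⇒≢ l) with d <ᵇ c in e
    ... | false = ℕₚ.⊓-zeroʳ (s i)
    ... | true  = contradiction (ℕₚ.<ᵇ⇒< d c (subst T (sym e) _)) (ℕₚ.<⇒≯ l)

    -- All `suc (s i)` edges of `i` lie right of the path here; the minimum in `pos` cuts this to
    -- `s i`.
    pos-left : ∀ {h c d i k} → i Fin.< k → Sub h c i → Sub h d k → d < c → pos s t i k ≡ s i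
    pos-left {c = c} {d} {i} i<k a b l
      rewrite edgesRight-apart i<k a b (≢-sym (ℕₚ.<⇒≢ l)) with d <ᵇ c in e
    ... | true  = ℕₚ.m≤n⇒m⊓n≡m (ℕₚ.n≤1+n (s i))
    ... | false = contradiction (ℕₚ.<⇒<ᵇ l) (subst T e)

-- Extremal elements of decidable predicates

module _ {n : ℕ} {P : Fin n → Set} (P? : Decidable P) where

  IsLargest : Fin n → Set
  IsLargest p = P p × (∀ {q} → p Fin.< q → ¬ P q)

  largest : ∀ p → P p → ∃ IsLargest
  largest p = go p (FinI.>-wellFounded p)
    where
    go : ∀ p → Acc Fin._>_ p → P p → ∃ IsLargest
    go p (acc r) x with Finₚ.any? (λ q → (p Fin.<? q) ×-dec P? q)
    ... | yes (q , l , y) = go q (r l) y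
    ... | no h            = p , x , λ l y → h (_ , l , y)

  smallest : ∀ p → P p → ∃ λ q → P q × (∀ {r} → r Fin.< q → ¬ P r)
  smallest p = go p (FinI.<-wellFounded p)
    where
    go : ∀ p → Acc Fin._<_ p → P p → ∃ λ q → P q × (∀ {r} → r Fin.< q → ¬ P r)
    go p (acc r) x with Finₚ.any? (λ q → (q Fin.<? p) ×-dec P? q)
    ... | yes (q , l , y) = go q (r l) y
    ... | no h            = p , x , λ l y → h (_ , l , y)

IsFirst : ∀ {n} → (Fin n → Set) → Maybe (Fin n) → Set
IsFirst P (just m) = P m × (∀ {k} → k Fin.< m → ¬ P k)
IsFirst P nothing  = ∀ {k} → ¬ P k

first : ∀ {n} {P : Fin n → Set} → Decidable P → ∃ (IsFirst P)
first P? with Finₚ.any? P?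
... | no h        = nothing , λ x → h (_ , x)
... | yes (p , x) = let q , f = smallest P? p x in just q , f

IsFirst-functional : ∀ {n} {P Q : Fin n → Set} {x y} → (∀ {k} → P k → Q k) → (∀ {k} → Q k → P k) →
                     IsFirst P x → IsFirst Q y → x ≡ y
IsFirst-functional {x = nothing} {nothing} to from f g = refl
IsFirst-functional {x = nothing} {just y} to from f g = contradiction (from (proj₁ g)) f
IsFirst-functional {x = just x} {nothing} to from f g = contradiction (to (proj₁ f)) g
IsFirst-functional {x = just x} {just y} to from (p , f) (q , g) with Finₚ.<-cmp x y
... | tri< l _ _ = contradiction (to p) (g l)
... | tri≈ _ e _ = cong just e
... | tri> _ _ l = contradiction (from q) (f l)

-- The correspondence between trees and inversion functions

module Inversions {n : ℕ} (s : Fin n → ℕ) where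
  open Validity s
  open Paths s

  record IsInversion (f : Fin n → Fin n → ℕ) : Set where
    field
      bound : ∀ {i k} → i Fin.< k → f i k ≤ s i
      up    : ∀ {i j k} → i Fin.< j → j Fin.< k → 0 < f j k → f i j ≤ f i k
      down  : ∀ {i j k} → i Fin.< j → j Fin.< k → f j k < s j → f i k ≤ f i j

  _≈_ : (f g : Fin n → Fin n → ℕ) → Set
  f ≈ g = ∀ {i k} → i Fin.< k → f i k ≡ g i k

  -- Ancestry read off the function alone: nodes that part at `h` have different entries in row `h`,
  -- and `h` precedes both.
  Ancestor : (Fin n → Fin n → ℕ) → Fin n → Fin n → Set
  Ancestor f i k = i Fin.< k × (∀ {h} → h Fin.< i → f h i ≡ f h k)

  Descendant : (Fin n → Fin n → ℕ) → Fin n → ℕ → Fin n → Set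
  Descendant f i v k = Ancestor f i k × f i k ≡ v

  ancestor? : ∀ f k → Decidable (λ i → Ancestor f i k)
  ancestor? f k i with i Fin.<? k | Finₚ.all? (λ h → (h Fin.<? i) →-dec (f h i ℕ.≟ f h k))
  ... | yes l | yes a = yes (l , λ {h} → a h)
  ... | no ¬l | _     = no λ (l , _) → ¬l l
  ... | _     | no ¬a = no λ (_ , a) → ¬a λ h → a {h}

  descendant? : ∀ f i v → Decidable (Descendant f i v)
  descendant? f i v k = ancestor? f k i ×-dec (f i k ℕ.≟ v)

  Ancestor-cong : ∀ {f g} → f ≈ g → ∀ {i k} → Ancestor f i k → Ancestor g i k
  Ancestor-cong e (l , a) = l , λ h<i → trans (sym (e h<i)) (trans (a h<i) (e (ℕₚ.<-trans h<i l)))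

  Descendant-cong : ∀ {f g} → f ≈ g → ∀ {i v k} → Descendant f i v k → Descendant g i v k
  Descendant-cong e (a , q) = Ancestor-cong e a , trans (sym (e (proj₁ a))) q

  -- The child of `i` at the edge with `v` edges to its right is the least descendant through it.
  record Represents (t : Raw n) (f : Fin n → Fin n → ℕ) : Set where
    field
      len   : ∀ k → length (lookup t k) ≡ suc (s k)
      child : ∀ {k c y} → At (lookup t k) c y → IsFirst (Descendant f k (s k ∸ c)) y

  module _ {t : Raw n} (w : WellFormed t) where
    open WellFormed w

    pos-Sub-same : ∀ {h j c k} → h Fin.< j → Sub w j c k → pos s t h j ≡ pos s t h k
    pos-Sub-same {h} {j} h<j b with position w h j
    ... | same refl = contradiction h<j (ℕₚ.<-irrefl refl)
    ... | below a   = trans (pos-Sub w a) (sym (pos-Sub w (Sub-trans w a b)))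
    ... | above a   = contradiction (Sub⇒< w a) (ℕₚ.<⇒≯ h<j)
    ... | apart {_} {c} {d} x y ne with ℕₚ.<-cmp c d
    ...   | tri< l _ _ = trans (pos-right w h<j x y l)
                           (sym (pos-right w (ℕₚ.<-trans h<j (Sub⇒< w b)) x (Sub-trans w y b) l))
    ...   | tri≈ _ e _ = contradiction e ne
    ...   | tri> _ _ l = trans (pos-left w h<j x y l)
                           (sym (pos-left w (ℕₚ.<-trans h<j (Sub⇒< w b)) x (Sub-trans w y b) l))

    Ancestor⇒Sub : ∀ {i k} → Ancestor (pos s t) i k → ∃ λ c → Sub w i c k
    Ancestor⇒Sub {i} {k} (i<k , a) with position w i k
    ... | same refl = contradiction i<k (ℕₚ.<-irrefl refl)
    ... | below b   = _ , b
    ... | above b   = contradiction (Sub⇒< w b) (ℕₚ.<⇒≯ i<k)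
    ... | apart x y ne = contradiction (ℕₚ.∸-cancelˡ-≡ (Sub-bound w x) (Sub-bound w y)
      (trans (sym (pos-Sub w x)) (trans (a (Sub⇒< w x)) (pos-Sub w y)))) ne

    pos-bound : ∀ i k → pos s t i k ≤ s i
    pos-bound i k = ℕₚ.m⊓n≤m (s i) _

    -- If `i` is above `h` or apart from it, both entries agree. If `i` hangs below `h` at edge `d`,
    -- then `d < a` makes the left entry 0, while `d ≥ a > b` makes the right entry full.
    pos-mono : ∀ {h a b i j k} → i Fin.< j → i Fin.< k → Sub w h a j → Sub w h b k → b < a →
               pos s t i j ≤ pos s t i k
    pos-mono {h} {a} {b} {i} {j} {k} i<j i<k x y b<a with position w i h
    ... | same refl = ℕₚ.≤-trans (ℕₚ.≤-reflexive (pos-Sub w x))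
                        (ℕₚ.≤-trans (ℕₚ.∸-monoʳ-≤ (s i) (ℕₚ.<⇒≤ b<a)) (ℕₚ.≤-reflexive (sym (pos-Sub w y))))
    ... | below z = ℕₚ.≤-reflexive (trans (pos-Sub w (Sub-trans w z x)) (sym (pos-Sub w (Sub-trans w z y))))
    ... | apart {_} {c} {d} z z′ ne = ℕₚ.≤-reflexive (lem (ℕₚ.<-cmp c d))
      where
      lem : _ → pos s t i j ≡ pos s t i k
      lem (tri< l _ _) = trans (pos-right w i<j z (Sub-trans w z′ x) l)
                           (sym (pos-right w i<k z (Sub-trans w z′ y) l))
      lem (tri≈ _ e _) = contradiction e ne
      lem (tri> _ _ l) = trans (pos-left w i<j z (Sub-trans w z′ x) l)
                           (sym (pos-left w i<k z (Sub-trans w z′ y) l))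
    ... | above {d} z with ℕₚ.<-cmp d a
    ...   | tri< l _ _    = ℕₚ.≤-trans (ℕₚ.≤-reflexive (pos-right w i<j z x l)) z≤n
    ...   | tri≈ _ refl _ = ℕₚ.≤-trans (pos-bound i j) (ℕₚ.≤-reflexive (sym (pos-left w i<k z y b<a)))
    ...   | tri> _ _ l    = ℕₚ.≤-trans (pos-bound i j)
                              (ℕₚ.≤-reflexive (sym (pos-left w i<k z y (ℕₚ.<-trans b<a l))))

    -- A positive entry at (j , k) excludes `k` to the right of `j`, and a deficient one excludes
    -- `k` to the left. If `k` is below `j`, the two entries of row `i` are equal; otherwise
    -- `pos-mono` compares them.
    pos-isInversion : IsInversion (pos s t)
    pos-isInversion = record { bound = λ {i} {k} _ → pos-bound i k ; up = up ; down = down }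
      where
      up : ∀ {i j k} → i Fin.< j → j Fin.< k → 0 < pos s t j k → pos s t i j ≤ pos s t i k
      up {i} {j} {k} i<j j<k l with position w j k
      ... | same refl = contradiction j<k (ℕₚ.<-irrefl refl)
      ... | below b   = ℕₚ.≤-reflexive (pos-Sub-same i<j b)
      ... | above b   = contradiction (Sub⇒< w b) (ℕₚ.<⇒≯ j<k)
      ... | apart {_} {c} {d} x y ne with ℕₚ.<-cmp c d
      ...   | tri< c<d _ _ = contradiction l (subst (λ z → ¬ 0 < z) (sym (pos-right w j<k x y c<d)) λ ())
      ...   | tri≈ _ e _   = contradiction e ne
      ...   | tri> _ _ d<c = pos-mono i<j (ℕₚ.<-trans i<j j<k) x y d<c
      down : ∀ {i j k} → i Fin.< j → j Fin.< k → pos s t j k < s j → pos s t i k ≤ pos s t i j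
      down {i} {j} {k} i<j j<k l with position w j k
      ... | same refl = contradiction j<k (ℕₚ.<-irrefl refl)
      ... | below b   = ℕₚ.≤-reflexive (sym (pos-Sub-same i<j b))
      ... | above b   = contradiction (Sub⇒< w b) (ℕₚ.<⇒≯ j<k)
      ... | apart {_} {c} {d} x y ne with ℕₚ.<-cmp c d
      ...   | tri< c<d _ _ = pos-mono (ℕₚ.<-trans i<j j<k) i<j y x c<d
      ...   | tri≈ _ e _   = contradiction e ne
      ...   | tri> _ _ d<c = contradiction l (ℕₚ.<-irrefl (pos-left w j<k x y d<c))

    pos-represents : Represents t (pos s t)
    pos-represents = record { len = len ; child = child }
      where
      child : ∀ {k c y} → At (lookup t k) c y → IsFirst (Descendant (pos s t) k (s k ∸ c)) y
      child {k} {c} {nothing} a (x , e) with Ancestor⇒Sub x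
      ... | d , b with ℕₚ.∸-cancelˡ-≡ (Sub-bound w b) (ℕₚ.≤-pred (subst (c <_) (len k) (At-bound a)))
                         (trans (sym (pos-Sub w b)) e)
      ...   | refl with Sub-first w b
      ...     | _ , a′ , _ = contradiction (At-functional a a′) λ ()
      child {k} {c} {just m} a =
        ((lt a , λ h<k → pos-Sub-same h<k (base a)) , pos-Sub w (base a)) , minimal
        where
        minimal : ∀ {j} → j Fin.< m → ¬ Descendant (pos s t) k (s k ∸ c) j
        minimal j<m (x , e) with Ancestor⇒Sub x
        ... | d , b with ℕₚ.∸-cancelˡ-≡ (Sub-bound w b) (Child-bound w a) (trans (sym (pos-Sub w b)) e)
        ...   | refl with Sub-first w b
        ...     | _ , a′ , r with At-functional a a′ | r
        ...       | refl | inj₁ refl    = ℕₚ.<-irrefl refl j<m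
        ...       | refl | inj₂ (_ , b′) = ℕₚ.<⇒≯ j<m (Sub⇒< w b′)

  module _ {f : Fin n → Fin n → ℕ} (I : IsInversion f) where
    open IsInversion I

    inversion-full : ∀ {g h k} → g Fin.< h → h Fin.< k → f g h < f g k → f h k ≡ s h
    inversion-full {g} {h} {k} g<h h<k l with f h k ℕ.<? s h
    ... | yes x = contradiction (down g<h h<k x) (ℕₚ.<⇒≱ l)
    ... | no ¬x = ℕₚ.≤-antisym (bound h<k) (ℕₚ.≮⇒≥ ¬x)

    inversion-zero : ∀ {g h k} → g Fin.< h → h Fin.< k → f g k < f g h → f h k ≡ 0
    inversion-zero {g} {h} {k} g<h h<k l with 0 ℕ.<? f h k
    ... | yes x = contradiction (up g<h h<k x) (ℕₚ.<⇒≱ l)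
    ... | no ¬x = ℕₚ.n≤0⇒n≡0 (ℕₚ.≮⇒≥ ¬x)

    -- A difference in row `g` between columns `h` and `a` forces (h , a) to an extreme value, full
    -- or zero according to its sign. Column `b` shows the same difference, hence the same extreme
    -- value.
    separated : ∀ {g h a b} → g Fin.< h → h Fin.< a → h Fin.< b →
                f g h ≢ f g a → f g a ≡ f g b → f h a ≡ f h b
    separated {g} {h} {a} {b} g<h h<a h<b ne e with ℕₚ.<-cmp (f g h) (f g a)
    ... | tri< l _ _  = trans (inversion-full g<h h<a l) (sym (inversion-full g<h h<b (subst (f g h <_) e l)))
    ... | tri≈ _ e′ _ = contradiction e′ ne
    ... | tri> _ _ l  = trans (inversion-zero g<h h<a l) (sym (inversion-zero g<h h<b (subst (_< f g h) e l)))

    module _ {t : Raw n} (R : Represents t f) where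
      open Represents R

      child-Descendant : ∀ {p c m} → Child t p c m → Descendant f p (s p ∸ c) m
      child-Descendant a = proj₁ (child a)

      private
        nested : ∀ {p q m} → p Fin.< q → Ancestor f p m → Ancestor f q m → Descendant f p (f p m) q
        nested p<q (p<m , x) (q<m , y) =
          (p<q , λ h<p → trans (x h<p) (sym (y (ℕₚ.<-trans h<p p<q)))) , y p<q

        -- With two parents `p < q` of `m`, the node `q` would be a descendant of `p` through the
        -- edge towards `m`, smaller than the first one.
        child-unique : ∀ {p q c d m} → Child t p c m → Child t q d m → ¬ p Fin.< q
        child-unique a b p<q with child a | child b
        ... | (x , e) , h | (y , _) , _ =
          h (proj₁ y) (subst (λ v → Descendant f _ v _) e (nested p<q x y))

        index-unique : ∀ {p c d m} → Child t p c m → Child t p d m → c ≡ d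
        index-unique {p} a b = ℕₚ.∸-cancelˡ-≡ (idx a) (idx b)
          (trans (sym (proj₂ (child-Descendant a))) (proj₂ (child-Descendant b)))
          where
          idx : ∀ {c m} → Child t p c m → c ≤ s p
          idx a = ℕₚ.≤-pred (subst (_ <_) (len p) (At-bound a))

        -- The parent is the largest ancestor `p`. The first descendant `m′` of `p` on the edge
        -- towards `m` cannot come before `m`, for it would be a larger ancestor. The search starts
        -- from node 0, an ancestor of every other node since no rows precede it.
        parent-exists : ∀ m → 0 < toℕ m → ∃₂ λ p c → Child t p c m
        parent-exists m 0<m with largest (ancestor? f m) (bottom m 0<m) (bottom-Ancestor m 0<m)
          where
          bottom : ∀ {n} (m : Fin n) → 0 < toℕ m → Fin n
          bottom (Fin.suc _) _ = Fin.zero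
          bottom-Ancestor : ∀ m (l : 0 < toℕ m) → Ancestor f (bottom m l) m
          bottom-Ancestor (Fin.suc _) l = l , λ ()
        ... | p , (p<m , x) , max with At-total (lookup t p)
                                         (subst (s p ∸ f p m <_) (sym (len p)) (s≤s (ℕₚ.m∸n≤m (s p) (f p m))))
        ...   | y , a with y | a | child a
        ...     | nothing | _ | ch =
                  ⊥-elim (ch ((p<m , x) , sym (ℕₚ.m∸[m∸n]≡n (bound p<m))))
        ...     | just m′ | a | (z , e) , h with Finₚ.<-cmp m m′
        ...       | tri< l _ _ = ⊥-elim (h l ((p<m , x) , sym (ℕₚ.m∸[m∸n]≡n (bound p<m))))
        ...       | tri≈ _ refl _ = p , _ , a
        ...       | tri> _ _ m′<m = ⊥-elim (max (proj₁ z) (m′<m , m′-above))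
          where
          e′ : f p m′ ≡ f p m
          e′ = trans e (ℕₚ.m∸[m∸n]≡n (bound p<m))
          m′-above : ∀ {g} → g Fin.< m′ → f g m′ ≡ f g m
          m′-above {g} g<m′ with Finₚ.<-cmp g p
          ... | tri< g<p _ _  = trans (sym (proj₂ z g<p)) (x g<p)
          ... | tri≈ _ refl _ = e′
          -- For a row `g` strictly between `p` and `m′`, either row `p` or some earlier row tells
          -- `g` from `m′`, and then `separated` applies. Otherwise `g` would be a descendant of `p`
          -- on this edge before the first one.
          ... | tri> _ _ p<g with f p g ℕ.≟ f p m′
          ...   | no ne = separated p<g g<m′ (ℕₚ.<-trans g<m′ m′<m) ne e′
          ...   | yes q with Finₚ.any? (λ o → (o Fin.<? p) ×-dec ¬? (f o p ℕ.≟ f o g))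
          ...     | yes (o , o<p , ne) = separated (ℕₚ.<-trans o<p p<g) g<m′ (ℕₚ.<-trans g<m′ m′<m)
                      (λ q → ne (trans (proj₂ z o<p) (sym q))) (trans (sym (proj₂ z o<p)) (x o<p))
          ...     | no none = ⊥-elim (h g<m′
                      ((p<g , λ {o} o<p → decidable-stable (f o p ℕ.≟ f o g)
                          λ ne → none (o , o<p , ne)) , trans q e))

      represents⇒wellFormed : WellFormed t
      represents⇒wellFormed = record
        { len  = len
        ; lt   = proj₁ ∘ proj₁ ∘ child-Descendant
        ; par  = parent-exists
        ; uniq = uniq
        }
        where
        uniq : ∀ {p q c d m} → Child t p c m → Child t q d m → p ≡ q × c ≡ d
        uniq {p} {q} a b with Finₚ.<-cmp p q
        ... | tri< l _ _    = contradiction l (child-unique a b)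
        ... | tri≈ _ refl _ = refl , index-unique a b
        ... | tri> _ _ l    = contradiction l (child-unique b a)

      private
        w = represents⇒wellFormed

      Sub-Descendant : ∀ {i c k} → Sub w i c k → Descendant f i (s i ∸ c) k
      Sub-Descendant (base a)   = child-Descendant a
      Sub-Descendant (step b a) with Sub-Descendant b | child-Descendant a
      ... | (i<p , x) , e | (p<k , y) , _ =
        (ℕₚ.<-trans i<p p<k , λ h<i → trans (x h<i) (y (ℕₚ.<-trans h<i i<p))) , trans (sym (y i<p)) e

      -- The substance is in the case of nodes that part at `h`: their different entries in row `h`
      -- force `f i k` to be zero or full, which is the value that `pos` takes on that side.
      represents⇒pos : pos s t ≈ f
      represents⇒pos {i} {k} i<k with position w i k
      ... | same refl = contradiction i<k (ℕₚ.<-irrefl refl)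
      ... | below b   = trans (pos-Sub w b) (sym (proj₂ (Sub-Descendant b)))
      ... | above b   = contradiction (Sub⇒< w b) (ℕₚ.<⇒≯ i<k)
      ... | apart {h} {c} {d} x y ne with Sub-Descendant x | Sub-Descendant y | ℕₚ.<-cmp c d
      ...   | _ , e | _ , e′ | tri< l _ _ = trans (pos-right w i<k x y l) (sym (inversion-zero (Sub⇒< w x) i<k
                (subst₂ _<_ (sym e′) (sym e) (ℕₚ.∸-monoʳ-< l (Sub-bound w y)))))
      ...   | _ , e | _ , e′ | tri≈ _ q _ = contradiction q ne
      ...   | _ , e | _ , e′ | tri> _ _ l = trans (pos-left w i<k x y l) (sym (inversion-full (Sub⇒< w x) i<k
                (subst₂ _<_ (sym e) (sym e′) (ℕₚ.∸-monoʳ-< l (Sub-bound w x)))))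

  represents-unique : ∀ {t t′ f g} → f ≈ g → Represents t f → Represents t′ g → t ≡ t′
  represents-unique {t} {t′} {f} {g} e R R′ = begin
    t                     ≡⟨ Vecₚ.tabulate∘lookup t ⟨
    tabulate (lookup t)   ≡⟨ Vecₚ.tabulate-cong rows ⟩
    tabulate (lookup t′)  ≡⟨ Vecₚ.tabulate∘lookup t′ ⟩
    t′                    ∎
    where
    open ≡-Reasoning
    open Represents
    rows : ∀ k → lookup t k ≡ lookup t′ k
    rows k = At-ext (trans (len R k) (sym (len R′ k))) λ a b →
      IsFirst-functional (Descendant-cong {f} {g} e)
        (Descendant-cong {g} {f} (λ l → sym (e l))) (child R a) (child R′ b)

  -- Children are listed from left to right, whereas entries count edges to the right: edge `c` of
  -- `k` has the value `s k ∸ c`.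
  countdown : {X : Set} → (ℕ → X) → ℕ → List X
  countdown g zero    = g 0 ∷ []
  countdown g (suc m) = g (suc m) ∷ countdown g m

  length-countdown : {X : Set} (g : ℕ → X) → ∀ m → length (countdown g m) ≡ suc m
  length-countdown g zero    = refl
  length-countdown g (suc m) = cong suc (length-countdown g m)

  At-countdown : {X : Set} (g : ℕ → X) → ∀ m {c y} → At (countdown g m) c y → y ≡ g (m ∸ c)
  At-countdown g zero    here      = refl
  At-countdown g (suc m) here      = refl
  At-countdown g (suc m) (there a) = At-countdown g m a

  build : (Fin n → Fin n → ℕ) → Raw n
  build f = tabulate λ k → countdown (λ v → proj₁ (first (descendant? f k v))) (s k)

  build-represents : ∀ f → Represents (build f) f
  build-represents f = record { len = len ; child = child }
    where
    row : ∀ k → lookup (build f) k ≡ countdown (λ v → proj₁ (first (descendant? f k v))) (s k)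
    row k = Vecₚ.lookup∘tabulate _ k
    len : ∀ k → length (lookup (build f) k) ≡ suc (s k)
    len k = trans (cong length (row k)) (length-countdown _ (s k))
    child : ∀ {k c y} → At (lookup (build f) k) c y → IsFirst (Descendant f k (s k ∸ c)) y
    child {k} {c} {y} a = subst (IsFirst _) (sym (At-countdown _ (s k) (subst (λ r → At r c y) (row k) a)))
      (proj₂ (first (descendant? f k (s k ∸ c))))

-- Child lists of combs

module _ {X : Set} where

  At-++ : ∀ (xs : List X) {ys c y} → At (xs ++ ys) c y →
          At xs c y ⊎ ∃ λ d → c ≡ length xs + d × At ys d y
  At-++ []       a = inj₂ (_ , refl , a)
  At-++ (x ∷ xs) here = inj₁ here
  At-++ (x ∷ xs) (there a) with At-++ xs a
  ... | inj₁ b           = inj₁ (there b)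
  ... | inj₂ (d , e , b) = inj₂ (d , cong suc e , b)

  At-replicate : ∀ k {x : X} {c y} → At (replicate k x) c y → c < k × y ≡ x
  At-replicate (suc k) here      = s≤s z≤n , refl
  At-replicate (suc k) (there a) = let l , e = At-replicate k a in s≤s l , e

  At-replicate-∷ : ∀ k {x z : X} {ys c y} → At (replicate k x ++ z ∷ ys) c y →
                   (c < k × y ≡ x) ⊎ (c ≡ k × y ≡ z) ⊎ ∃ λ d → c ≡ suc (k + d) × At ys d y
  At-replicate-∷ k {x} a with At-++ (replicate k x) a
  ... | inj₁ b                 = inj₁ (At-replicate k b)
  ... | inj₂ (d , e , b) rewrite length-replicate k {x = x} with b
  ...   | here    = inj₂ (inj₁ (trans e (ℕₚ.+-identityʳ k) , refl))
  ...   | there b = inj₂ (inj₂ (_ , trans e (ℕₚ.+-suc k _) , b))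

IsFirst-enlarge : ∀ {n} {P Q : Fin n → Set} {x} → (∀ {k} → P k → Q k) →
                  (∀ {k} → Q k → ∃ λ k′ → k′ Fin.≤ k × P k′) → IsFirst P x → IsFirst Q x
IsFirst-enlarge {x = nothing} to from f q = let _ , _ , p = from q in f p
IsFirst-enlarge {x = just x} to from (p , f) =
  to p , λ k<x q → let _ , l , p′ = from q in f (ℕₚ.≤-<-trans l k<x) p′

-- Stated for an arbitrary `f`, since the tail of `allFin` is a tabulation of successors.
head-filter-tabulate : ∀ {n} {P : Fin n → Set} (P? : Decidable P) {k} (f : Fin k → Fin n) →
  (head (filter P? (List.tabulate f)) ≡ nothing × (∀ i → ¬ P (f i))) ⊎
  ∃ λ i → head (filter P? (List.tabulate f)) ≡ just (f i) × P (f i) × (∀ {j} → j Fin.< i → ¬ P (f j))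
head-filter-tabulate P? {zero}  f = inj₁ (refl , λ ())
head-filter-tabulate P? {suc k} f with P? (f Fin.zero)
... | yes p = inj₂ (Fin.zero , refl , p , λ ())
... | no ¬p with head-filter-tabulate P? (f ∘ Fin.suc)
...   | inj₁ (e , none)        = inj₁ (e , λ { Fin.zero → ¬p ; (Fin.suc i) → none i })
...   | inj₂ (i , e , p , min) = inj₂ (Fin.suc i , e , p , λ { {Fin.zero} _ → ¬p ; {Fin.suc j} (s≤s l) → min l })

head-filter-allFin : ∀ {n} {P : Fin n → Set} (P? : Decidable P) → IsFirst P (head (filter P? (allFin n)))
head-filter-allFin P? with head-filter-tabulate P? id
... | inj₁ (e , none)        rewrite e = none _
... | inj₂ (i , e , p , min) rewrite e = p , min

-- Inversion functions with three kinds of columns, and those of T∨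

module Profiles {n : ℕ} (s : Fin n → ℕ) where
  open Validity s
  open Inversions s

  opaque
    -- The explicit functions of the proof (T∨, its lower cover, the witnesses w, u, v) have this
    -- shape or are complements of such functions: a column is zero, `hi` before the threshold `t`,
    -- or `lo` from `t` on. The inversion axioms are thus checked once.
    profile : Subset n → Fin n → (hi lo : Fin n → ℕ) → Fin n → Fin n → ℕ
    profile S t hi lo a c with c ∈? S | c Fin.<? t
    ... | no _  | _     = 0
    ... | yes _ | yes _ = hi a
    ... | yes _ | no _  = lo a

  module _ {S : Subset n} {t : Fin n} {hi lo : Fin n → ℕ} where

    opaque
      unfolding profile

      profile-∉ : ∀ {a c} → c ∉ S → profile S t hi lo a c ≡ 0
      profile-∉ {c = c} c∉S with c ∈? S
      ... | yes c∈S = contradiction c∈S c∉S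
      ... | no _    = refl

      profile-hi : ∀ {a c} → c ∈ S → c Fin.< t → profile S t hi lo a c ≡ hi a
      profile-hi {c = c} c∈S c<t with c ∈? S | c Fin.<? t
      ... | yes _ | yes _ = refl
      ... | yes _ | no ge = contradiction c<t ge
      ... | no c∉S | _    = contradiction c∈S c∉S

      profile-lo : ∀ {a c} → c ∈ S → t Fin.≤ c → profile S t hi lo a c ≡ lo a
      profile-lo {c = c} c∈S t≤c with c ∈? S | c Fin.<? t
      ... | yes _ | yes l = contradiction l (ℕₚ.≤⇒≯ t≤c)
      ... | yes _ | no _  = refl
      ... | no c∉S | _    = contradiction c∈S c∉S

  data Column (S : Subset n) (t c : Fin n) : Set where
    outside : c ∉ S → Column S t c
    low     : c ∈ S → c Fin.< t → Column S t c
    high    : c ∈ S → t Fin.≤ c → Column S t c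

  column : ∀ S t c → Column S t c
  column S t c with c ∈? S | c Fin.<? t
  ... | no c∉S  | _     = outside c∉S
  ... | yes c∈S | yes l = low c∈S l
  ... | yes c∈S | no ge = high c∈S (ℕₚ.≮⇒≥ ge)

  -- Columns of the same kind coincide, and a `lo` column never precedes a `hi` column. Among mixed
  -- pairs, `hi` before `lo` needs the first of the three implications for `up` and `lo a ≤ hi a`
  -- for `down`; zero before `hi` or `lo` needs the other two for `down`.
  profile-isInversion : ∀ S t {hi lo} → (∀ a → hi a ≤ s a) → (∀ a → lo a ≤ hi a) →
    (∀ {a b} → a Fin.< b → b ∈ S → b Fin.< t → 0 < lo b → hi a ≤ lo a) →
    (∀ {a b} → a Fin.< b → b ∉ S → hi b < s b → hi a ≡ 0) →
    (∀ {a b} → a Fin.< b → b ∉ S → lo b < s b → lo a ≡ 0) →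
    IsInversion (profile S t hi lo)
  profile-isInversion S t {hi} {lo} hi≤s lo≤hi C₁ C₂ C₃ = record { bound = bound ; up = up ; down = down }
    where
    f = profile S t hi lo
    bound : ∀ {a c} → a Fin.< c → f a c ≤ s a
    bound {a} {c} _ with column S t c
    ... | outside c∉ rewrite profile-∉ {S} {t} {hi} {lo} {a} c∉ = z≤n
    ... | low c∈ c<t rewrite profile-hi {S} {t} {hi} {lo} {a} c∈ c<t = hi≤s a
    ... | high c∈ t≤c rewrite profile-lo {S} {t} {hi} {lo} {a} c∈ t≤c = ℕₚ.≤-trans (lo≤hi a) (hi≤s a)
    up : ∀ {a b c} → a Fin.< b → b Fin.< c → 0 < f b c → f a b ≤ f a c
    up {a} {b} {c} a<b b<c l with column S t b | column S t c
    ... | outside b∉  | _ rewrite profile-∉ {S} {t} {hi} {lo} {a} b∉ = z≤n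
    ... | _           | outside c∉ rewrite profile-∉ {S} {t} {hi} {lo} {b} c∉ = contradiction l λ ()
    ... | low b∈ b<t  | low c∈ c<t
      rewrite profile-hi {S} {t} {hi} {lo} {a} b∈ b<t | profile-hi {S} {t} {hi} {lo} {a} c∈ c<t = ℕₚ.≤-refl
    ... | low b∈ b<t  | high c∈ t≤c
      rewrite profile-hi {S} {t} {hi} {lo} {a} b∈ b<t | profile-lo {S} {t} {hi} {lo} {a} c∈ t≤c
            | profile-lo {S} {t} {hi} {lo} {b} c∈ t≤c = C₁ a<b b∈ b<t l
    ... | high b∈ t≤b | low c∈ c<t = contradiction (ℕₚ.<-trans b<c c<t) (ℕₚ.≤⇒≯ t≤b)
    ... | high b∈ t≤b | high c∈ t≤c
      rewrite profile-lo {S} {t} {hi} {lo} {a} b∈ t≤b | profile-lo {S} {t} {hi} {lo} {a} c∈ t≤c = ℕₚ.≤-refl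
    down : ∀ {a b c} → a Fin.< b → b Fin.< c → f b c < s b → f a c ≤ f a b
    down {a} {b} {c} a<b b<c l with column S t b | column S t c
    ... | _           | outside c∉ rewrite profile-∉ {S} {t} {hi} {lo} {a} c∉ = z≤n
    ... | outside b∉  | low c∈ c<t
      rewrite profile-hi {S} {t} {hi} {lo} {b} c∈ c<t | profile-hi {S} {t} {hi} {lo} {a} c∈ c<t
            | C₂ a<b b∉ l = z≤n
    ... | outside b∉  | high c∈ t≤c
      rewrite profile-lo {S} {t} {hi} {lo} {b} c∈ t≤c | profile-lo {S} {t} {hi} {lo} {a} c∈ t≤c
            | C₃ a<b b∉ l = z≤n
    ... | low b∈ b<t  | low c∈ c<t
      rewrite profile-hi {S} {t} {hi} {lo} {a} b∈ b<t | profile-hi {S} {t} {hi} {lo} {a} c∈ c<t = ℕₚ.≤-refl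
    ... | low b∈ b<t  | high c∈ t≤c
      rewrite profile-hi {S} {t} {hi} {lo} {a} b∈ b<t | profile-lo {S} {t} {hi} {lo} {a} c∈ t≤c = lo≤hi a
    ... | high b∈ t≤b | low c∈ c<t = contradiction (ℕₚ.<-trans b<c c<t) (ℕₚ.≤⇒≯ t≤b)
    ... | high b∈ t≤b | high c∈ t≤c
      rewrite profile-lo {S} {t} {hi} {lo} {a} b∈ t≤b | profile-lo {S} {t} {hi} {lo} {a} c∈ t≤c = ℕₚ.≤-refl

  opaque
    -- The column of a node in the second comb of T∨ when `Z` is the set of that comb. A node after
    -- `i` outside `Z` has this comb on its left and is full; a node of `Z` is left through its
    -- rightmost edge and has 0.
    row : Fin n → ℕ → Subset n → Fin n → ℕ
    row i x Z a with Finₚ.<-cmp a i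
    ... | tri< _ _ _ = 0
    ... | tri≈ _ _ _ = x
    ... | tri> _ _ _ = if does (a ∈? Z) then 0 else s a

  module _ {i : Fin n} {x : ℕ} {Z : Subset n} where

    opaque
      unfolding row

      row-< : ∀ {a} → a Fin.< i → row i x Z a ≡ 0
      row-< {a} l with Finₚ.<-cmp a i
      ... | tri< _ _ _  = refl
      ... | tri≈ ¬l _ _ = contradiction l ¬l
      ... | tri> ¬l _ _ = contradiction l ¬l

      row-≡ : row i x Z i ≡ x
      row-≡ with Finₚ.<-cmp i i
      ... | tri< _ ne _ = contradiction refl ne
      ... | tri≈ _ _ _  = refl
      ... | tri> _ ne _ = contradiction refl ne

      row-∈ : ∀ {a} → i Fin.< a → a ∈ Z → row i x Z a ≡ 0
      row-∈ {a} l z with Finₚ.<-cmp a i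
      ... | tri< _ _ ¬l = contradiction l ¬l
      ... | tri≈ _ _ ¬l = contradiction l ¬l
      ... | tri> _ _ _ with a ∈? Z
      ...   | yes _ = refl
      ...   | no ¬z = contradiction z ¬z

      row-∉ : ∀ {a} → i Fin.< a → a ∉ Z → row i x Z a ≡ s a
      row-∉ {a} l ¬z with Finₚ.<-cmp a i
      ... | tri< _ _ ¬l = contradiction l ¬l
      ... | tri≈ _ _ ¬l = contradiction l ¬l
      ... | tri> _ _ _ with a ∈? Z
      ...   | yes z = contradiction z ¬z
      ...   | no _  = refl

      row-≤ : x ≤ s i → ∀ a → row i x Z a ≤ s a
      row-≤ x≤s a with Finₚ.<-cmp a i
      ... | tri< _ _ _ = z≤n
      ... | tri≈ _ refl _ = x≤s
      ... | tri> _ _ _ with a ∈? Z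
      ...   | yes _ = z≤n
      ...   | no _  = ℕₚ.≤-refl

      row-<s⇒≤ : ∀ {a} → a ∉ Z → row i x Z a < s a → a Fin.≤ i
      row-<s⇒≤ {a} ¬z l with Finₚ.<-cmp a i
      ... | tri< m _ _    = ℕₚ.<⇒≤ m
      ... | tri≈ _ refl _ = ℕₚ.≤-refl
      ... | tri> _ _ _ with a ∈? Z
      ...   | yes z = contradiction z ¬z
      ...   | no _  = contradiction l (ℕₚ.<-irrefl refl)

      row-∈′ : ∀ {a} → a ≢ i → a ∈ Z → row i x Z a ≡ 0
      row-∈′ {a} ne z with Finₚ.<-cmp a i
      ... | tri< l _ _ = refl
      ... | tri≈ _ e _ = contradiction e ne
      ... | tri> _ _ _ with a ∈? Z
      ...   | yes _ = refl
      ...   | no ¬z = contradiction z ¬z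

  opaque
    unfolding row

    row-mono : ∀ {i x y Z} → x ≤ y → ∀ a → row i x Z a ≤ row i y Z a
    row-mono {i} x≤y a with Finₚ.<-cmp a i
    ... | tri< _ _ _ = z≤n
    ... | tri≈ _ _ _ = x≤y
    ... | tri> _ _ _ = ℕₚ.≤-refl

  -- A row outside `S` that is not full cannot come after `i`, and rows before `i` vanish. A
  -- positive row of `S` before `t` can only be row `i`, and again the rows before it vanish.
  row-profile-isInversion : ∀ {i S t Z x y} → x ≤ s i → y ≤ x → Z ⊆ S →
    (∀ {b} → b ∈ S → b Fin.< t → b ∈ Z) → IsInversion (profile S t (row i x Z) (row i y Z))
  row-profile-isInversion {i} {S} {t} {Z} {x} {y} x≤s y≤x Z⊆S S<t⊆Z =
    profile-isInversion S t (row-≤ x≤s) (row-mono y≤x) C₁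
      (λ a<b b∉S l → row-< (ℕₚ.<-≤-trans a<b (row-<s⇒≤ (b∉S ∘ Z⊆S) l)))
      (λ a<b b∉S l → row-< (ℕₚ.<-≤-trans a<b (row-<s⇒≤ (b∉S ∘ Z⊆S) l)))
    where
    C₁ : ∀ {a b} → a Fin.< b → b ∈ S → b Fin.< t → 0 < row i y Z b → row i x Z a ≤ row i y Z a
    C₁ {a} {b} a<b b∈S b<t l with b Fin.≟ i
    ... | yes refl rewrite row-< {b} {x} {Z} a<b = z≤n
    ... | no b≢i   = contradiction l (ℕₚ.<-irrefl (sym (row-∈′ b≢i (S<t⊆Z b∈S b<t))))

  -- The inversions of T∨(i,j,A,B,r) for S = A ∪ {j} and x = r, and those of its lower cover for x = r ∸ 1.
  arcProfile : Fin n → Fin n → Subset n → ℕ → ℕ → Fin n → Fin n → ℕ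
  arcProfile i j S r x = profile S j (row i r S) (row i x S)

  module _ (α : Arc s) where
    open Arc α

    support : Subset n
    support = A ∪ ⁅ j ⁆

    support-bounds : ∀ {k} → k ∈ support → i Fin.< k × k Fin.≤ j
    support-bounds {k} k∈ with x∈p∪q⁻ A ⁅ j ⁆ k∈
    ... | inj₁ k∈A = let l , l′ , _ = Equivalence.to (cover k) (inj₁ k∈A) in l , ℕₚ.<⇒≤ l′
    ... | inj₂ k∈j with x∈⁅y⁆⇒x≡y j k∈j
    ...   | refl = i<j , ℕₚ.≤-refl

    i∉support : i ∉ support
    i∉support i∈ = ℕₚ.<-irrefl refl (proj₁ (support-bounds i∈))

    arcInversions : Fin n → Fin n → ℕ
    arcInversions = arcProfile i j support r r

    arcInversions-∈ : ∀ {a c} → c ∈ support → arcInversions a c ≡ row i r support a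
    arcInversions-∈ {a} {c} c∈ with column support j c
    ... | outside c∉ = contradiction c∈ c∉
    ... | low _ l    = profile-hi {hi = row i r support} c∈ l
    ... | high _ l   = profile-lo {hi = row i r support} c∈ l

    arcInversions-∉ : ∀ {a c} → c ∉ support → arcInversions a c ≡ 0
    arcInversions-∉ = profile-∉ {hi = row i r support}

    private
      f = arcInversions

      member? : ∀ k → k ∈ support ⊎ k ∉ support
      member? k = toSum (k ∈? support)

      row-i : ∀ {m} → m ∈ support → f i m ≡ r
      row-i m∈ = trans (arcInversions-∈ m∈) (row-≡ {i} {r} {support})

      row-below-i : ∀ {a m} → a Fin.< i → f a m ≡ 0
      row-below-i {a} {m} a<i with member? m
      ... | inj₁ m∈ = trans (arcInversions-∈ m∈) (row-< a<i)
      ... | inj₂ m∉  = arcInversions-∉ m∉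

      row-support : ∀ {k m} → k ∈ support → f k m ≡ 0
      row-support {k} {m} k∈ with member? m
      ... | inj₁ m∈ = trans (arcInversions-∈ m∈) (row-∈ (proj₁ (support-bounds k∈)) k∈)
      ... | inj₂ m∉  = arcInversions-∉ m∉

      r≢0 : r ≢ 0
      r≢0 e = contradiction (subst (1 ≤_) e 1≤r) λ ()

      -- Row `i` is `r` on the support and 0 off it, so an ancestor that comes after `i` lies on the
      -- same side as its descendant.
      descendant-iff : ∀ {k v m} → i Fin.< k → Descendant f k v m →
                       (k ∈ support → m ∈ support) × (m ∈ support → k ∈ support)
      descendant-iff {k} {v} {m} i<k ((_ , x) , _) with member? k | member? m
      ... | inj₁ k∈ | inj₁ m∈ = (λ _ → m∈) , λ _ → k∈
      ... | inj₂ k∉  | inj₂ m∉  = (λ k∈ → contradiction k∈ k∉) , λ m∈ → contradiction m∈ m∉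
      ... | inj₁ k∈ | inj₂ m∉  = contradiction (trans (sym (row-i k∈)) (trans (x i<k) (arcInversions-∉ m∉))) r≢0
      ... | inj₂ k∉  | inj₁ m∈ = contradiction (trans (sym (row-i m∈)) (trans (sym (x i<k)) (arcInversions-∉ k∉))) r≢0

      same-column : ∀ {h k m} → (k ∈ support → m ∈ support) → (m ∈ support → k ∈ support) → f h k ≡ f h m
      same-column {h} {k} {m} to from with member? k
      ... | inj₁ k∈ = trans (arcInversions-∈ k∈) (sym (arcInversions-∈ (to k∈)))
      ... | inj₂ k∉  = trans (arcInversions-∉ k∉) (sym (arcInversions-∉ (k∉ ∘ from)))

      J₀ = ∁ support

      nextIn-first : ∀ J k → IsFirst (λ m → k Fin.< m × m ∈ J) (nextIn s J k)
      nextIn-first J k = head-filter-allFin (λ m → (k Fin.<? m) ×-dec (m ∈? J))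

      mutual
        -- The child lists of `tveeRaw` are a local function there; unification with the tabulation
        -- recovers it.
        children : Fin n → List (Maybe (Fin n))
        children = _

        tveeRaw-tabulate : tveeRaw s α ≡ tabulate children
        tveeRaw-tabulate = refl

      tvee-inner : ∀ {k} → k ∈ support →
                   lookup (tveeRaw s α) k ≡ replicate (s k) nothing ++ [ nextIn s support k ]
      tvee-inner {k} k∈ = trans (Vecₚ.lookup∘tabulate children k) lem
        where
        lem : children k ≡ replicate (s k) nothing ++ [ nextIn s support k ]
        lem with k ∈? support
        ... | yes _ = refl
        ... | no k∉ = contradiction k∈ k∉

      tvee-outer : ∀ {k} → k ∉ support → k ≢ i →
                   lookup (tveeRaw s α) k ≡ replicate (s k) nothing ++ [ nextIn s J₀ k ]
      tvee-outer {k} k∉ k≢i = trans (Vecₚ.lookup∘tabulate children k) lem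
        where
        lem : children k ≡ replicate (s k) nothing ++ [ nextIn s J₀ k ]
        lem rewrite Paths.≢⇒toℕ-≡ᵇ-false s k≢i with k ∈? support
        ... | yes k∈ = contradiction k∈ k∉
        ... | no _   = refl

      tvee-i : lookup (tveeRaw s α) i ≡ replicate (s i ∸ r) nothing ++ [ nextIn s support i ]
                                        ++ replicate (r ∸ 1) nothing ++ [ nextIn s J₀ i ]
      tvee-i = trans (Vecₚ.lookup∘tabulate children i) lem
        where
        lem : children i ≡ replicate (s i ∸ r) nothing ++ [ nextIn s support i ]
                           ++ replicate (r ∸ 1) nothing ++ [ nextIn s J₀ i ]
        lem rewrite Paths.≡ᵇ-refl s (toℕ i) with i ∈? support
        ... | yes i∈ = contradiction i∈ i∉support
        ... | no _   = refl

      comb-len : ∀ k {x : Maybe (Fin n)} → length (replicate k nothing ++ [ x ]) ≡ suc k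
      comb-len k = trans (length-++ (replicate k nothing))
        (trans (cong (_+ 1) (length-replicate k)) (ℕₚ.+-comm k 1))

      tvee-len : ∀ k → length (lookup (tveeRaw s α) k) ≡ suc (s k)
      tvee-len k with member? k | k Fin.≟ i
      ... | inj₁ k∈ | _      = trans (cong length (tvee-inner k∈)) (comb-len (s k))
      ... | inj₂ k∉ | no k≢i = trans (cong length (tvee-outer k∉ k≢i)) (comb-len (s k))
      ... | inj₂ _  | yes refl = begin
        length (lookup (tveeRaw s α) i)  ≡⟨ cong length tvee-i ⟩
        _                                ≡⟨ length-++ (replicate (s i ∸ r) nothing) ⟩
        _                                ≡⟨ cong₂ _+_ (length-replicate (s i ∸ r)) (cong suc (comb-len (r ∸ 1))) ⟩
        s i ∸ r + suc (suc (r ∸ 1))      ≡⟨ cong (λ z → s i ∸ r + suc z) (ℕₚ.m+[n∸m]≡n 1≤r) ⟩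
        s i ∸ r + suc r                  ≡⟨ ℕₚ.+-suc (s i ∸ r) r ⟩
        suc (s i ∸ r + r)                ≡⟨ cong suc (ℕₚ.m∸n+n≡m r≤s) ⟩
        suc (s i)                        ∎
        where open ≡-Reasoning

      comb-child : ∀ {k x c y} → (∀ {v m} → v ≢ 0 → ¬ Descendant f k v m) →
                   IsFirst (Descendant f k 0) x → At (replicate (s k) nothing ++ [ x ]) c y →
                   IsFirst (Descendant f k (s k ∸ c)) y
      comb-child {k} {x} none fst a with At-replicate-∷ (s k) a
      ... | inj₁ (c<s , refl)         = λ d → none (λ e → ℕₚ.<⇒≱ c<s (ℕₚ.m∸n≡0⇒m≤n e)) d
      ... | inj₂ (inj₁ (refl , refl)) = subst (λ v → IsFirst (Descendant f k v) x) (sym (ℕₚ.n∸n≡0 (s k))) fst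
      ... | inj₂ (inj₂ (_ , _ , ()))

      descendant-of-i : ∀ {v m} → i Fin.< m → f i m ≡ v → Descendant f i v m
      descendant-of-i l e = (l , λ h<i → trans (row-below-i h<i) (sym (row-below-i h<i))) , e

      first-inner : ∀ {k} → k ∈ support → IsFirst (Descendant f k 0) (nextIn s support k)
      first-inner {k} k∈ = IsFirst-enlarge to from (nextIn-first support k)
        where
        to : ∀ {m} → k Fin.< m × m ∈ support → Descendant f k 0 m
        to (k<m , m∈) = (k<m , λ _ → same-column (λ _ → m∈) (λ _ → k∈)) , row-support k∈
        from : ∀ {m} → Descendant f k 0 m → ∃ λ m′ → m′ Fin.≤ m × k Fin.< m′ × m′ ∈ support
        from {m} d = m , ℕₚ.≤-refl , proj₁ (proj₁ d) ,
          proj₁ (descendant-iff (proj₁ (support-bounds k∈)) d) k∈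

      -- For `k` before `i`, the support consists of zero-descendants of `k` as well, but `i` itself
      -- precedes all of it and belongs to the outer comb.
      first-outer : ∀ {k} → k ∉ support → IsFirst (Descendant f k 0) (nextIn s J₀ k)
      first-outer {k} k∉ = IsFirst-enlarge to from (nextIn-first J₀ k)
        where
        to : ∀ {m} → k Fin.< m × m ∈ J₀ → Descendant f k 0 m
        to (k<m , m∈J₀) = (k<m , λ _ → same-column (λ k∈ → contradiction k∈ k∉) (λ m∈ → contradiction m∈ (x∈∁p⇒x∉p m∈J₀)))
                        , arcInversions-∉ (x∈∁p⇒x∉p m∈J₀)
        from : ∀ {m} → Descendant f k 0 m → ∃ λ m′ → m′ Fin.≤ m × k Fin.< m′ × m′ ∈ J₀
        from {m} d with member? m
        ... | inj₂ m∉ = m , ℕₚ.≤-refl , proj₁ (proj₁ d) , x∉p⇒x∈∁p m∉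
        ... | inj₁ m∈ with Finₚ.<-cmp k i
        ...   | tri< k<i _ _  = i , ℕₚ.<⇒≤ (proj₁ (support-bounds m∈)) , k<i , x∉p⇒x∈∁p i∉support
        ...   | tri≈ _ refl _ = contradiction (trans (sym (row-i m∈)) (proj₂ d)) r≢0
        ...   | tri> _ _ i<k  = contradiction (proj₂ (descendant-iff i<k d) m∈) k∉

      none-at : ∀ {k} → k ≢ i → ∀ {v m} → v ≢ 0 → ¬ Descendant f k v m
      none-at {k} k≢i {v} {m} v≢0 d with Finₚ.<-cmp k i
      ... | tri< k<i _ _ = v≢0 (trans (sym (proj₂ d)) (row-below-i k<i))
      ... | tri≈ _ e _   = k≢i e
      ... | tri> _ _ i<k with member? m
      ...   | inj₁ m∈ = v≢0 (trans (sym (proj₂ d)) (row-support (proj₂ (descendant-iff i<k d) m∈)))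
      ...   | inj₂ m∉ = v≢0 (trans (sym (proj₂ d)) (arcInversions-∉ m∉))

      none-at-i : ∀ {v m} → v ≢ 0 → v ≢ r → ¬ Descendant f i v m
      none-at-i {v} {m} v≢0 v≢r d with member? m
      ... | inj₁ m∈ = v≢r (trans (sym (proj₂ d)) (row-i m∈))
      ... | inj₂ m∉ = v≢0 (trans (sym (proj₂ d)) (arcInversions-∉ m∉))

      first-r : IsFirst (Descendant f i r) (nextIn s support i)
      first-r = IsFirst-enlarge (λ (l , m∈) → descendant-of-i l (row-i m∈)) from (nextIn-first support i)
        where
        from : ∀ {m} → Descendant f i r m → ∃ λ m′ → m′ Fin.≤ m × i Fin.< m′ × m′ ∈ support
        from {m} d with member? m
        ... | inj₁ m∈ = m , ℕₚ.≤-refl , proj₁ (proj₁ d) , m∈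
        ... | inj₂ m∉ = contradiction (trans (sym (proj₂ d)) (arcInversions-∉ m∉)) r≢0

      i-child : ∀ {c y} → At (lookup (tveeRaw s α) i) c y → IsFirst (Descendant f i (s i ∸ c)) y
      i-child a with At-replicate-∷ (s i ∸ r) (subst (λ xs → At xs _ _) tvee-i a)
      ... | inj₁ (l , refl) = λ d → none-at-i
        (λ e → ℕₚ.<⇒≱ l (ℕₚ.≤-trans (ℕₚ.m∸n≤m (s i) r) (ℕₚ.m∸n≡0⇒m≤n e)))
        (λ e → ℕₚ.<⇒≢ (ℕₚ.∸-monoʳ-< l (ℕₚ.m∸n≤m (s i) r)) (trans (ℕₚ.m∸[m∸n]≡n r≤s) (sym e))) d
      ... | inj₂ (inj₁ (refl , refl)) =
        subst (λ v → IsFirst (Descendant f i v) (nextIn s support i)) (sym (ℕₚ.m∸[m∸n]≡n r≤s)) first-r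
      -- Edge `suc (s i ∸ r + d)` has the value `r ∸ 1 ∸ d`. For `d < r ∸ 1` this is strictly
      -- between 0 and `r`, a leaf; at `d ≡ r ∸ 1` it is 0, the edge to the outer comb.
      ... | inj₂ (inj₂ (d , refl , b)) with At-replicate-∷ (r ∸ 1) b
      ...   | inj₁ (l , refl) = λ x → none-at-i
        (λ e → ℕₚ.<⇒≱ small (ℕₚ.m∸n≡0⇒m≤n e))
        (λ e → ℕₚ.<⇒≢ (ℕₚ.∸-monoʳ-< (s≤s (ℕₚ.m≤m+n (s i ∸ r) d)) (ℕₚ.<⇒≤ small))
                 (trans e (sym (ℕₚ.m∸[m∸n]≡n r≤s)))) x
        where
        small : suc (s i ∸ r + d) < s i
        small = subst (suc (s i ∸ r + d) <_) (ℕₚ.m∸n+n≡m r≤s)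
          (ℕₚ.≤-trans (s≤s (ℕₚ.≤-reflexive (sym (ℕₚ.+-suc (s i ∸ r) d))))
             (ℕₚ.+-monoʳ-< (s i ∸ r) (subst (suc d <_) (ℕₚ.m+[n∸m]≡n 1≤r) (s≤s l))))
      ...   | inj₂ (inj₁ (refl , refl)) =
        subst (λ v → IsFirst (Descendant f i v) (nextIn s J₀ i)) (sym last) (first-outer i∉support)
        where
        last : s i ∸ suc (s i ∸ r + (r ∸ 1)) ≡ 0
        last = trans (cong (s i ∸_) (trans (sym (ℕₚ.+-suc (s i ∸ r) (r ∸ 1)))
          (trans (cong (s i ∸ r +_) (ℕₚ.m+[n∸m]≡n 1≤r)) (ℕₚ.m∸n+n≡m r≤s)))) (ℕₚ.n∸n≡0 (s i))
      ...   | inj₂ (inj₂ (_ , _ , ()))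

    -- Comparing child lists suffices: `represents⇒pos` then gives `pos` of T∨ without following any
    -- path in it.
    tvee-represents : Represents (tveeRaw s α) arcInversions
    tvee-represents = record { len = tvee-len ; child = child }
      where
      child : ∀ {k c y} → At (lookup (tveeRaw s α) k) c y → IsFirst (Descendant f k (s k ∸ c)) y
      child {k} a with k Fin.≟ i
      ... | yes refl = i-child a
      ... | no k≢i with member? k
      ...   | inj₁ k∈ = comb-child (none-at k≢i) (first-inner k∈) (subst (λ xs → At xs _ _) (tvee-inner k∈) a)
      ...   | inj₂ k∉ = comb-child (none-at k≢i) (first-outer k∉) (subst (λ xs → At xs _ _) (tvee-outer k∉ k≢i) a)

-- Perspectivities and the congruences that collapse them

module Contractions {n : ℕ} (s : Fin n → ℕ) where
  open Validity s
  open Inversions s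
  open Profiles s

  _⊑_ : (f g : Fin n → Fin n → ℕ) → Set
  f ⊑ g = ∀ {a c} → a Fin.< c → f a c ≤ g a c

  STree-isInversion : ∀ (x : STree s) → IsInversion (pos s (proj₁ x))
  STree-isInversion (t , v) = pos-isInversion (valid⇒wellFormed t v)

  STree-ext : ∀ {x y : STree s} → pos s (proj₁ x) ≈ pos s (proj₁ y) → x ≡ y
  STree-ext {t , v} {t′ , v′} e
    with represents-unique {f = pos s t} {pos s t′} e
           (pos-represents (valid⇒wellFormed t v)) (pos-represents (valid⇒wellFormed t′ v′))
  ... | refl = cong (t ,_) (T-irrelevant v v′)

  opaque
    tree : ∀ {f} → IsInversion f → STree s
    tree {f} I = build f , wellFormed⇒valid (build f) (represents⇒wellFormed I (build-represents f))

    pos-tree : ∀ {f} (I : IsInversion f) → pos s (proj₁ (tree I)) ≈ f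
    pos-tree {f} I = represents⇒pos I (build-represents f)

  -- `IsCongruence` meets joins only through their universal property, so this is all that has to be
  -- known of `h`. The test elements are inversion functions because every tree yields one.
  record JoinOf (f g h : Fin n → Fin n → ℕ) : Set where
    field
      left  : f ⊑ h
      right : g ⊑ h
      least : ∀ {e} → IsInversion e → f ⊑ e → g ⊑ e → h ⊑ e

  record MeetOf (f g h : Fin n → Fin n → ℕ) : Set where
    field
      left     : h ⊑ f
      right    : h ⊑ g
      greatest : ∀ {e} → IsInversion e → e ⊑ f → e ⊑ g → e ⊑ h

  module _ (x y z : STree s) {f g h} (x≈f : pos s (proj₁ x) ≈ f) (y≈g : pos s (proj₁ y) ≈ g)
           (z≈h : pos s (proj₁ z) ≈ h) where

    isJoin : JoinOf f g h → IsJoin (_≤w_ s) x y z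
    isJoin J = (λ i k l → subst₂ _≤_ (sym (x≈f l)) (sym (z≈h l)) (left l))
             , (λ i k l → subst₂ _≤_ (sym (y≈g l)) (sym (z≈h l)) (right l))
             , λ w x≤w y≤w i k l → subst (_≤ _) (sym (z≈h l)) (least (STree-isInversion w)
                 (λ l → subst (_≤ _) (x≈f l) (x≤w _ _ l)) (λ l → subst (_≤ _) (y≈g l) (y≤w _ _ l)) l)
      where open JoinOf J

    isMeet : MeetOf f g h → IsMeet (_≤w_ s) x y z
    isMeet M = (λ i k l → subst₂ _≤_ (sym (z≈h l)) (sym (x≈f l)) (left l))
             , (λ i k l → subst₂ _≤_ (sym (z≈h l)) (sym (y≈g l)) (right l))
             , λ w w≤x w≤y i k l → subst (_ ≤_) (sym (z≈h l)) (greatest (STree-isInversion w)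
                 (λ l → subst (_ ≤_) (x≈f l) (w≤x _ _ l)) (λ l → subst (_ ≤_) (y≈g l) (w≤y _ _ l)) l)
      where open MeetOf M

  -- Quantifying over all trees with these functions lets a pair be named by its functions, before
  -- any tree is chosen.
  Collapses : (STree s → STree s → Set) → (f g : Fin n → Fin n → ℕ) → Set
  Collapses R f g = ∀ {x y} → pos s (proj₁ x) ≈ f → pos s (proj₁ y) ≈ g → R x y

  -- Joining with w moves the collapsed pair (f , f⁻) to (u , w), meeting with g moves it to (g , v),
  -- and joining with g⁻ moves it to (g , g⁻).
  record Perspectivity (f f⁻ g g⁻ : Fin n → Fin n → ℕ) : Set where
    field
      {w u v} : Fin n → Fin n → ℕ
      f-inv   : IsInversion f
      f⁻-inv  : IsInversion f⁻
      w-inv   : IsInversion w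
      u-inv   : IsInversion u
      v-inv   : IsInversion v
      f⁻⊑w    : f⁻ ⊑ w
      f∨w     : JoinOf f w u
      g⊑u     : g ⊑ u
      w∧g     : MeetOf w g v
      v⊑g⁻    : v ⊑ g⁻
      g⁻⊑g    : g⁻ ⊑ g

  collapses-along : ∀ {R f f⁻ g g⁻} → IsCongruence (_≤w_ s) R → Perspectivity f f⁻ g g⁻ →
                    Collapses R f f⁻ → Collapses R g g⁻
  collapses-along {R} {f} {f⁻} {g} {g⁻} C P c {x} {y} x≈g y≈g⁻ =
    join-compat x V y y x y Rgv (Eq.refl)
      (isJoin x y x {f = g} {g⁻} {g} x≈g y≈g⁻ x≈g record { left = λ _ → ℕₚ.≤-refl ; right = g⁻⊑g ; least = λ _ p _ → p })
      (isJoin V y y {f = v} {g⁻} {g⁻} V≈ y≈g⁻ y≈g⁻ record { left = v⊑g⁻ ; right = λ _ → ℕₚ.≤-refl ; least = λ _ _ p → p })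
    where
    open Perspectivity P
    open IsCongruence C
    module Eq = IsEquivalence isEquivalence
    F = tree f-inv
    F⁻ = tree f⁻-inv
    W = tree w-inv
    U = tree u-inv
    V = tree v-inv
    V≈ = pos-tree v-inv
    W≈ = pos-tree w-inv
    Ruw : R U W
    Ruw = join-compat F F⁻ W W U W (c (pos-tree f-inv) (pos-tree f⁻-inv)) Eq.refl
      (isJoin F W U {f = f} {w} {u} (pos-tree f-inv) W≈ (pos-tree u-inv) f∨w)
      (isJoin F⁻ W W {f = f⁻} {w} {w} (pos-tree f⁻-inv) W≈ W≈
        record { left = f⁻⊑w ; right = λ _ → ℕₚ.≤-refl ; least = λ _ _ p → p })
    Rgv : R x V
    Rgv = meet-compat U W x x x V Ruw Eq.refl
      (isMeet U x x {f = u} {g} {g} (pos-tree u-inv) x≈g x≈g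
        record { left = g⊑u ; right = λ _ → ℕₚ.≤-refl ; greatest = λ _ _ p → p })
      (isMeet W x V {f = w} {g} {v} W≈ x≈g V≈ w∧g)

  -- Comparing profiles, and extending an arc to the right

  profile-mono : ∀ {S S′ t hi lo hi′ lo′ a c} → (c ∈ S → c ∈ S′) → (c ∈ S → hi a ≤ hi′ a) →
                 (c ∈ S → lo a ≤ lo′ a) → profile S t hi lo a c ≤ profile S′ t hi′ lo′ a c
  profile-mono {S} {S′} {t} {hi} {lo} {hi′} {lo′} {a} {c} S⊆ h l with column S t c
  ... | outside c∉  rewrite profile-∉ {S} {t} {hi} {lo} {a} c∉ = z≤n
  ... | low c∈ c<t  rewrite profile-hi {S} {t} {hi} {lo} {a} c∈ c<t
                          | profile-hi {S′} {t} {hi′} {lo′} {a} (S⊆ c∈) c<t = h c∈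
  ... | high c∈ t≤c rewrite profile-lo {S} {t} {hi} {lo} {a} c∈ t≤c
                          | profile-lo {S′} {t} {hi′} {lo′} {a} (S⊆ c∈) t≤c = l c∈

  profile-postpone : ∀ {S t t′ hi lo a c} → t Fin.≤ t′ → lo a ≤ hi a →
                     profile S t hi lo a c ≤ profile S t′ hi lo a c
  profile-postpone {S} {t} {t′} {hi} {lo} {a} {c} t≤t′ l with column S t c | column S t′ c
  ... | outside c∉  | _ rewrite profile-∉ {S} {t} {hi} {lo} {a} c∉ = z≤n
  ... | low c∈ _    | outside c∉ = contradiction c∈ c∉
  ... | high c∈ _   | outside c∉ = contradiction c∈ c∉
  ... | low c∈ c<t  | high _ t′≤c = contradiction c<t (ℕₚ.≤⇒≯ (ℕₚ.≤-trans t≤t′ t′≤c))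
  ... | low c∈ c<t  | low _ c<t′ rewrite profile-hi {S} {t} {hi} {lo} {a} c∈ c<t
                                       | profile-hi {S} {t′} {hi} {lo} {a} c∈ c<t′ = ℕₚ.≤-refl
  ... | high c∈ t≤c | low _ c<t′ rewrite profile-lo {S} {t} {hi} {lo} {a} c∈ t≤c
                                       | profile-hi {S} {t′} {hi} {lo} {a} c∈ c<t′ = l
  ... | high c∈ t≤c | high _ t′≤c rewrite profile-lo {S} {t} {hi} {lo} {a} c∈ t≤c
                                       | profile-lo {S} {t′} {hi} {lo} {a} c∈ t′≤c = ℕₚ.≤-refl

  profile-flat : ∀ {S t h a c} → c ∈ S → profile S t h h a c ≡ h a
  profile-flat {S} {t} {h} {a} {c} c∈ with column S t c
  ... | outside c∉ = contradiction c∈ c∉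
  ... | low _ l    = profile-hi {hi = h} c∈ l
  ... | high _ l   = profile-lo {hi = h} c∈ l

  profile-retime : ∀ {S t t′ h a c} → profile S t h h a c ≡ profile S t′ h h a c
  profile-retime {S} {t} {t′} {h} {a} {c} with column S t c
  ... | outside c∉ = trans (profile-∉ {hi = h} c∉) (sym (profile-∉ {hi = h} c∉))
  ... | low c∈ l   = trans (profile-hi {hi = h} c∈ l) (sym (profile-flat {h = h} c∈))
  ... | high c∈ l  = trans (profile-lo {hi = h} c∈ l) (sym (profile-flat {h = h} c∈))

  row-⊆ : ∀ {i x Z Z′ a} → (i Fin.< a → a ∈ Z′ → a ∈ Z) → row i x Z a ≤ row i x Z′ a
  row-⊆ {i} {x} {Z} {Z′} {a} sub with Finₚ.<-cmp a i
  ... | tri< l _ _ rewrite row-< {i} {x} {Z} l = z≤n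
  ... | tri≈ _ refl _ rewrite row-≡ {i} {x} {Z} | row-≡ {i} {x} {Z′} = ℕₚ.≤-refl
  ... | tri> _ _ l with a ∈? Z
  ...   | yes a∈ rewrite row-∈ {i} {x} l a∈ = z≤n
  ...   | no a∉  rewrite row-∉ {i} {x} l a∉ | row-∉ {i} {x} l (a∉ ∘ sub l) = ℕₚ.≤-refl

  row-≢ : ∀ {i x y Z a} → a ≢ i → row i x Z a ≡ row i y Z a
  row-≢ {i} {x} {y} {Z} {a} ne with Finₚ.<-cmp a i
  ... | tri< l _ _ = trans (row-< l) (sym (row-< l))
  ... | tri≈ _ e _ = contradiction e ne
  ... | tri> _ _ l with a ∈? Z
  ...   | yes a∈ = trans (row-∈ l a∈) (sym (row-∈ l a∈))
  ...   | no a∉  = trans (row-∉ l a∉) (sym (row-∉ l a∉))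

  row-beyond : ∀ {i i′ x y Z a} → i Fin.< a → i′ Fin.< a → row i x Z a ≡ row i′ y Z a
  row-beyond {Z = Z} {a} l l′ with a ∈? Z
  ... | yes a∈ = trans (row-∈ l a∈) (sym (row-∈ l′ a∈))
  ... | no a∉  = trans (row-∉ l a∉) (sym (row-∉ l′ a∉))

  -- Here S = A ∪ {j} and S′ = A′ ∪ {j′}.  The extended arc (i , j′) may keep all of A′, even the
  -- elements up to i: rows before i vanish, so those columns are zero.
  module _ {i j j′ : Fin n} {S S′ : Subset n} {r : ℕ} (i<j : i Fin.< j) (j≤j′ : j Fin.≤ j′)
    (1≤r : 1 ≤ r) (r≤s : r ≤ s i) (j∈S : j ∈ S) (S≤j : ∀ {k} → k ∈ S → k Fin.≤ j) (S⊆ : S ⊆ S′ ∪ ⁅ j ⁆)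
    (S′≤j′ : ∀ {k} → k ∈ S′ → k Fin.≤ j′) (S′<j : ∀ {k} → i Fin.< k → k Fin.< j → k ∈ S′ → k ∈ S)
    (sj : j Fin.< j′ → s j ≢ 0) where

    private
      S⁺ = S′ ∪ ⁅ j ⁆
      -- Without `j` in `Z`, row `j` is full in the columns of `S⁺` after `j`. There `s j` is
      -- nonzero, so `up` passes the entry `r` at (i , j) on to all those columns; this is how
      -- `least` obtains `u`.
      Z  = S⁺ ∩ ∁ ⁅ j ⁆
      hi = row i r Z
      lo = row i (r ∸ 1) Z
      f  = arcProfile i j S r r
      f⁻ = arcProfile i j S r (r ∸ 1)
      g  = arcProfile i j′ S′ r r
      g⁻ = arcProfile i j′ S′ r (r ∸ 1)
      -- `w` falls short of `u` only in row `i` from column `j` on, by one. Of these entries `f`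
      -- supplies the one at `j`.
      w  = profile S⁺ j hi lo
      u  = profile S⁺ j hi hi
      -- The meet lowers row `i` in every column of `S′` from `j` on, but `g⁻` lowers it at `j′`
      -- only. So `v` may lie strictly below `g⁻`, and the join with `g⁻` repairs this.
      v  = profile S′ j (row i r S′) (row i (r ∸ 1) S′)

      r∸1≤r : r ∸ 1 ≤ r
      r∸1≤r = ℕₚ.m∸n≤m r 1

      S′⊆S⁺ : S′ ⊆ S⁺
      S′⊆S⁺ = p⊆p∪q ⁅ j ⁆

      S⁺-cases : ∀ {k} → k ∈ S⁺ → k ∈ S′ ⊎ k ≡ j
      S⁺-cases k∈ with x∈p∪q⁻ S′ ⁅ j ⁆ k∈
      ... | inj₁ k∈S′ = inj₁ k∈S′
      ... | inj₂ k∈j  = inj₂ (x∈⁅y⁆⇒x≡y j k∈j)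

      Z⊆S⁺ : Z ⊆ S⁺
      Z⊆S⁺ k∈ = proj₁ (x∈p∩q⁻ S⁺ (∁ ⁅ j ⁆) k∈)

      j∉Z : j ∉ Z
      j∉Z j∈ = x∈p⇒x∉∁p (x∈⁅x⁆ j) (proj₂ (x∈p∩q⁻ S⁺ (∁ ⁅ j ⁆) j∈))

      Z⊆S′ : Z ⊆ S′
      Z⊆S′ k∈ with S⁺-cases (Z⊆S⁺ k∈)
      ... | inj₁ k∈S′ = k∈S′
      ... | inj₂ refl = contradiction k∈ j∉Z

      S⁺<j⊆Z : ∀ {k} → k ∈ S⁺ → k Fin.< j → k ∈ Z
      S⁺<j⊆Z k∈ k<j = x∈p∩q⁺ (k∈ , x∉p⇒x∈∁p λ k∈j → ℕₚ.<-irrefl (cong toℕ (x∈⁅y⁆⇒x≡y j k∈j)) k<j)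

      S-row : ∀ {a c x} → a Fin.< c → c ∈ S → row i x S a ≤ row i x Z a
      S-row a<c c∈ = row-⊆ λ i<a a∈Z → S′<j i<a (ℕₚ.<-≤-trans a<c (S≤j c∈)) (Z⊆S′ a∈Z)

      S′-row : ∀ {a x} → row i x S′ a ≤ row i x Z a
      S′-row = row-⊆ λ _ → Z⊆S′

      w-inv : IsInversion w
      w-inv = row-profile-isInversion r≤s r∸1≤r Z⊆S⁺ S⁺<j⊆Z

      least : ∀ {e} → IsInversion e → f ⊑ e → w ⊑ e → u ⊑ e
      least {e} I f⊑e w⊑e {a} {c} a<c with column S⁺ j c
      ... | outside c∉ rewrite profile-∉ {S⁺} {j} {hi} {hi} {a} c∉ = z≤n
      ... | low c∈ c<j = ℕₚ.≤-trans (ℕₚ.≤-reflexive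
              (trans (profile-hi {hi = hi} c∈ c<j) (sym (profile-hi {hi = hi} {lo} c∈ c<j)))) (w⊑e a<c)
      ... | high c∈ j≤c with a Fin.≟ i
      ...   | no a≢i = ℕₚ.≤-trans (ℕₚ.≤-reflexive
              (trans (profile-lo {hi = hi} c∈ j≤c) (trans (row-≢ a≢i) (sym (profile-lo {hi = hi} {lo} c∈ j≤c)))))
              (w⊑e a<c)
      ...   | yes refl = ℕₚ.≤-trans (ℕₚ.≤-reflexive (trans (profile-lo {hi = hi} c∈ j≤c) (row-≡ {i} {r} {Z}))) r≤e
        where
        r≤e-j : r ≤ e i j
        r≤e-j = ℕₚ.≤-trans (ℕₚ.≤-reflexive (sym (trans (profile-flat {h = row i r S} j∈S) (row-≡ {i} {r} {S}))))
                  (f⊑e i<j)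
        r≤e : r ≤ e i c
        r≤e with c Fin.≟ j
        ... | yes refl = r≤e-j
        ... | no c≢j   = ℕₚ.≤-trans r≤e-j (IsInversion.up I i<j j<c
                (ℕₚ.<-≤-trans (ℕₚ.n≢0⇒n>0 (sj (ℕₚ.<-≤-trans j<c c≤j′)))
                  (ℕₚ.≤-trans (ℕₚ.≤-reflexive (sym (trans (profile-lo {hi = hi} c∈ j≤c) (row-∉ i<j j∉Z))))
                    (w⊑e j<c))))
          where
          j<c : j Fin.< c
          j<c = Finₚ.≤∧≢⇒< j≤c (c≢j ∘ sym)
          c≤j′ : c Fin.≤ j′
          c≤j′ with S⁺-cases c∈
          ... | inj₁ c∈S′ = S′≤j′ c∈S′
          ... | inj₂ refl = j≤j′

      greatest : ∀ {e} → IsInversion e → e ⊑ w → e ⊑ g → e ⊑ v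
      greatest {e} I e⊑w e⊑g {a} {c} a<c with column S′ j c
      ... | outside c∉ = ℕₚ.≤-trans (e⊑g a<c)
              (ℕₚ.≤-reflexive (trans (profile-∉ {hi = row i r S′} c∉) (sym (profile-∉ {hi = row i r S′} c∉))))
      ... | low c∈ c<j = ℕₚ.≤-trans (e⊑g a<c)
              (ℕₚ.≤-reflexive (trans (profile-flat {h = row i r S′} c∈) (sym (profile-hi {hi = row i r S′} c∈ c<j))))
      ... | high c∈ j≤c with a Fin.≟ i
      ...   | no a≢i = ℕₚ.≤-trans (e⊑g a<c) (ℕₚ.≤-reflexive (trans (profile-flat {h = row i r S′} c∈)
              (trans (row-≢ a≢i) (sym (profile-lo {hi = row i r S′} c∈ j≤c)))))
      ...   | yes refl = ℕₚ.≤-trans (e⊑w a<c) (ℕₚ.≤-reflexive (trans (profile-lo {hi = hi} (S′⊆S⁺ c∈) j≤c)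
              (trans (row-≡ {i} {r ∸ 1} {Z}) (sym (trans (profile-lo {hi = row i r S′} c∈ j≤c)
                (row-≡ {i} {r ∸ 1} {S′}))))))

    extend-right : Perspectivity f f⁻ g g⁻
    extend-right = record
      { w      = w
      ; u      = u
      ; v      = v
      ; f-inv  = row-profile-isInversion r≤s ℕₚ.≤-refl id λ k∈ _ → k∈
      ; f⁻-inv = row-profile-isInversion r≤s r∸1≤r id λ k∈ _ → k∈
      ; w-inv  = w-inv
      ; u-inv  = row-profile-isInversion r≤s ℕₚ.≤-refl Z⊆S⁺ S⁺<j⊆Z
      ; v-inv  = row-profile-isInversion r≤s r∸1≤r id λ k∈ _ → k∈
      ; f⁻⊑w   = λ a<c → profile-mono S⊆ (S-row a<c) (S-row a<c)
      ; f∨w    = record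
        { left  = λ a<c → profile-mono S⊆ (S-row a<c) (S-row a<c)
        ; right = λ {a} _ → profile-mono id (λ _ → ℕₚ.≤-refl) (λ _ → row-mono r∸1≤r a)
        ; least = least
        }
      ; g⊑u    = λ {a} {c} _ → subst (_≤ u a c) (profile-retime {S′} {j} {j′})
                   (profile-mono S′⊆S⁺ (λ _ → S′-row) (λ _ → S′-row))
      ; w∧g    = record
        { left     = λ _ → profile-mono S′⊆S⁺ (λ _ → S′-row) (λ _ → S′-row)
        ; right    = λ {a} {c} _ → subst (v a c ≤_) (profile-retime {S′} {j} {j′})
                       (profile-mono id (λ _ → ℕₚ.≤-refl) (λ _ → row-mono r∸1≤r a))
        ; greatest = greatest
        }
      ; v⊑g⁻   = λ {a} _ → profile-postpone j≤j′ (row-mono r∸1≤r a)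
      ; g⁻⊑g   = λ {a} _ → profile-mono id (λ _ → ℕₚ.≤-refl) (λ _ → row-mono r∸1≤r a)
      }

  -- Extending an arc to the left

  override : Fin n → ℕ → (Fin n → ℕ) → Fin n → ℕ
  override i x h a with a Fin.≟ i
  ... | yes _ = x
  ... | no _  = h a

  override-≡ : ∀ {i x h} → override i x h i ≡ x
  override-≡ {i} with i Fin.≟ i
  ... | yes _ = refl
  ... | no ne = contradiction refl ne

  override-≢ : ∀ {i x h a} → a ≢ i → override i x h a ≡ h a
  override-≢ {i} {a = a} ne with a Fin.≟ i
  ... | yes e = contradiction e ne
  ... | no _  = refl

  module _ {i′ i j : Fin n} {S : Subset n} {q : ℕ} (i′<i : i′ Fin.< i) (i<j : i Fin.< j) (q≤s : q ≤ s i′)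
    (1≤s : 1 ≤ s i) (i′∉S : i′ ∉ S) (j∈S : j ∈ S) (S≤j : ∀ {k} → k ∈ S → k Fin.≤ j) where

    private
      base = row i′ q S
      low′ = row i′ (q ∸ 1) S
      g    = arcProfile i′ j S q q
      g⁻   = arcProfile i′ j S q (q ∸ 1)

      q∸1≤q : q ∸ 1 ≤ q
      q∸1≤q = ℕₚ.m∸n≤m q 1

      ≥j⇒≡ : ∀ {c} → c ∈ S → j Fin.≤ c → c ≡ j
      ≥j⇒≡ c∈ j≤c = Finₚ.≤-antisym (S≤j c∈) j≤c

      base-0 : ∀ {b} → b ∈ S → base b ≡ 0
      base-0 b∈ = row-∈′ (λ { refl → i′∉S b∈ }) b∈

      base-C₂ : ∀ {a b} → a Fin.< b → b ∉ S → base b < s b → base a ≡ 0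
      base-C₂ a<b b∉ l = row-< (ℕₚ.<-≤-trans a<b (row-<s⇒≤ b∉ l))

      g-inv : IsInversion g
      g-inv = row-profile-isInversion q≤s ℕₚ.≤-refl id λ k∈ _ → k∈

      g⁻-inv : IsInversion g⁻
      g⁻-inv = row-profile-isInversion q≤s q∸1≤q id λ k∈ _ → k∈

      g⁻⊑g : g⁻ ⊑ g
      g⁻⊑g {a} _ = profile-mono id (λ _ → ℕₚ.≤-refl) (λ _ → row-mono q∸1≤q a)

    module _ (i∈S : i ∈ S) where

      private
        -- Row `i` of `base` is zero because `i ∈ S`. It is raised to 1 since `f⁻` still has 1 there
        -- in the columns before `j`; at column `j` both `w` and `f⁻` have 0.
        H  = override i 1 base
        f  = arcProfile i j S 1 1
        f⁻ = arcProfile i j S 1 0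
        w  = profile S j H low′
        u  = profile S j H H

        base≤H : ∀ a → base a ≤ H a
        base≤H a with a Fin.≟ i
        ... | yes refl = ℕₚ.≤-trans (ℕₚ.≤-reflexive (base-0 i∈S)) z≤n
        ... | no _     = ℕₚ.≤-refl

        low≤H : ∀ a → low′ a ≤ H a
        low≤H a = ℕₚ.≤-trans (row-mono q∸1≤q a) (base≤H a)

        H≤s : ∀ a → H a ≤ s a
        H≤s a with a Fin.≟ i
        ... | yes refl = 1≤s
        ... | no _     = row-≤ q≤s a

        H-C₂ : ∀ {a b} → a Fin.< b → b ∉ S → H b < s b → H a ≡ 0
        H-C₂ {a} {b} a<b b∉ l = trans (override-≢ a≢i) (row-< a<i′)
          where
          a<i′ : a Fin.< i′
          a<i′ = ℕₚ.<-≤-trans a<b (row-<s⇒≤ b∉ (subst (_< s b) (override-≢ {i} {1} {base} λ { refl → b∉ i∈S }) l))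
          a≢i : a ≢ i
          a≢i refl = ℕₚ.<⇒≯ a<i′ i′<i

        low-C₃ : ∀ {a b} → a Fin.< b → b ∉ S → low′ b < s b → low′ a ≡ 0
        low-C₃ a<b b∉ l = row-< (ℕₚ.<-≤-trans a<b (row-<s⇒≤ b∉ l))

        w-inv : IsInversion w
        w-inv = profile-isInversion S j H≤s low≤H
          (λ _ b∈ _ l → contradiction l (ℕₚ.<-irrefl (sym (row-∈′ (λ { refl → i′∉S b∈ }) b∈))))
          H-C₂ low-C₃

        u-inv : IsInversion u
        u-inv = profile-isInversion S j H≤s (λ _ → ℕₚ.≤-refl) (λ _ _ _ _ → ℕₚ.≤-refl) H-C₂ H-C₂

        one-row : ∀ a → row i 1 S a ≤ H a
        one-row a with Finₚ.<-cmp a i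
        ... | tri< l _ _ rewrite row-< {i} {1} {S} l = z≤n
        ... | tri≈ _ refl _ rewrite row-≡ {i} {1} {S} | override-≡ {i} {1} {base} = ℕₚ.≤-refl
        ... | tri> _ ne l rewrite override-≢ {i} {1} {base} ne =
              ℕₚ.≤-reflexive (row-beyond l (ℕₚ.<-trans i′<i l))

        zero-row : ∀ a → row i 0 S a ≤ low′ a
        zero-row a with Finₚ.<-cmp a i
        ... | tri< l _ _ rewrite row-< {i} {0} {S} l = z≤n
        ... | tri≈ _ refl _ rewrite row-≡ {i} {0} {S} = z≤n
        ... | tri> _ _ l = ℕₚ.≤-reflexive (row-beyond l (ℕₚ.<-trans i′<i l))

        -- `f` contributes a positive entry at (i , j). Hence `up` lifts the entry at (i′ , j) to at
        -- least the one at (i′ , i), which is `q` in `w` because `i` is a column of `S`.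
        least : ∀ {e} → IsInversion e → f ⊑ e → w ⊑ e → u ⊑ e
        least {e} I f⊑e w⊑e {a} {c} a<c with column S j c
        ... | outside c∉ rewrite profile-∉ {S} {j} {H} {H} {a} c∉ = z≤n
        ... | low c∈ c<j = ℕₚ.≤-trans (ℕₚ.≤-reflexive
                (trans (profile-hi {hi = H} c∈ c<j) (sym (profile-hi {hi = H} {low′} c∈ c<j)))) (w⊑e a<c)
        ... | high c∈ j≤c with ≥j⇒≡ c∈ j≤c
        ...   | refl = ℕₚ.≤-trans (ℕₚ.≤-reflexive (profile-lo {hi = H} c∈ j≤c)) (H≤e (a Fin.≟ i) (a Fin.≟ i′))
          where
          1≤e : 1 ≤ e i j
          1≤e = ℕₚ.≤-trans (ℕₚ.≤-reflexive (sym (trans (profile-flat {h = row i 1 S} j∈S) (row-≡ {i} {1} {S}))))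
                  (f⊑e i<j)
          H≤e : Dec (a ≡ i) → Dec (a ≡ i′) → H a ≤ e a j
          H≤e (yes refl) _ = ℕₚ.≤-trans (ℕₚ.≤-reflexive (override-≡ {i} {1} {base})) 1≤e
          H≤e (no a≢i) (no a≢i′) = ℕₚ.≤-trans (ℕₚ.≤-reflexive (trans (override-≢ a≢i)
            (trans (row-≢ a≢i′) (sym (profile-lo {hi = H} {low′} c∈ j≤c))))) (w⊑e a<c)
          H≤e (no a≢i) (yes refl) = begin
            H a        ≡⟨ profile-hi {hi = H} {low′} i∈S i<j ⟨
            w a i      ≤⟨ w⊑e i′<i ⟩
            e a i      ≤⟨ IsInversion.up I i′<i i<j 1≤e ⟩
            e a j      ∎
            where open ℕₚ.≤-Reasoning

        greatest : ∀ {e} → IsInversion e → e ⊑ w → e ⊑ g → e ⊑ g⁻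
        greatest {e} I e⊑w e⊑g {a} {c} a<c with column S j c
        ... | outside c∉ = ℕₚ.≤-trans (e⊑g a<c)
                (ℕₚ.≤-reflexive (trans (profile-∉ {hi = base} c∉) (sym (profile-∉ {hi = base} c∉))))
        ... | low c∈ c<j = ℕₚ.≤-trans (e⊑g a<c)
                (ℕₚ.≤-reflexive (trans (profile-flat {h = base} c∈) (sym (profile-hi {hi = base} c∈ c<j))))
        ... | high c∈ j≤c = ℕₚ.≤-trans (e⊑w a<c)
                (ℕₚ.≤-reflexive (trans (profile-lo {hi = H} c∈ j≤c) (sym (profile-lo {hi = base} c∈ j≤c))))

      extend-left-above : Perspectivity f f⁻ g g⁻
      extend-left-above = record
        { w      = w
        ; u      = u
        ; v      = g⁻
        ; f-inv  = row-profile-isInversion 1≤s ℕₚ.≤-refl id λ k∈ _ → k∈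
        ; f⁻-inv = row-profile-isInversion 1≤s z≤n id λ k∈ _ → k∈
        ; w-inv  = w-inv
        ; u-inv  = u-inv
        ; v-inv  = g⁻-inv
        ; f⁻⊑w   = λ {a} _ → profile-mono id (λ _ → one-row a) (λ _ → zero-row a)
        ; f∨w    = record
          { left  = λ {a} _ → profile-mono id (λ _ → one-row a) (λ _ → one-row a)
          ; right = λ {a} _ → profile-mono id (λ _ → ℕₚ.≤-refl) (λ _ → low≤H a)
          ; least = least
          }
        ; g⊑u    = λ {a} _ → profile-mono id (λ _ → base≤H a) (λ _ → base≤H a)
        ; w∧g    = record
          { left     = λ {a} _ → profile-mono id (λ _ → base≤H a) (λ _ → ℕₚ.≤-refl)
          ; right    = g⁻⊑g
          ; greatest = greatest
          }
        ; v⊑g⁻   = λ _ → ℕₚ.≤-refl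
        ; g⁻⊑g   = g⁻⊑g
        }

    module _ (i∉S : i ∉ S) where

      private
        -- In `w` the entry at (i , j) is `s i ∸ 1`, so `down` requires the entry at (i′ , i) to be
        -- at least the one at (i′ , j), which is `q`. Therefore `i` must be added as a nonzero
        -- column.
        S⁺ = S ∪ ⁅ i ⁆
        x  = s i ∸ 1
        L  = override i x base
        M  = row i x S
        f  = arcProfile i j S (s i) (s i)
        f⁻ = arcProfile i j S (s i) x
        w  = profile S⁺ j base L
        u  = profile S⁺ j base base
        v  = profile S j base M

        x≤s : x ≤ s i
        x≤s = ℕₚ.m∸n≤m (s i) 1

        S⊆S⁺ : S ⊆ S⁺
        S⊆S⁺ = p⊆p∪q ⁅ i ⁆

        S⁺-cases : ∀ {k} → k ∈ S⁺ → k ∈ S ⊎ k ≡ i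
        S⁺-cases k∈ with x∈p∪q⁻ S ⁅ i ⁆ k∈
        ... | inj₁ k∈S = inj₁ k∈S
        ... | inj₂ k∈i = inj₂ (x∈⁅y⁆⇒x≡y i k∈i)

        base-i : base i ≡ s i
        base-i = row-∉ i′<i i∉S

        L≤base : ∀ a → L a ≤ base a
        L≤base a with a Fin.≟ i
        ... | yes refl = ℕₚ.≤-trans x≤s (ℕₚ.≤-reflexive (sym base-i))
        ... | no _     = ℕₚ.≤-refl

        L-≢ : ∀ {a} → a ≢ i → L a ≡ base a
        L-≢ = override-≢

        M≤L : ∀ a → M a ≤ L a
        M≤L a with Finₚ.<-cmp a i
        ... | tri< l _ _ rewrite row-< {i} {x} {S} l = z≤n
        ... | tri≈ _ refl _ rewrite row-≡ {i} {x} {S} | override-≡ {i} {x} {base} = ℕₚ.≤-refl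
        ... | tri> _ ne l rewrite override-≢ {i} {x} {base} ne =
              ℕₚ.≤-reflexive (row-beyond l (ℕₚ.<-trans i′<i l))

        M≤low : ∀ a → M a ≤ low′ a
        M≤low a with Finₚ.<-cmp a i
        ... | tri< l _ _ rewrite row-< {i} {x} {S} l = z≤n
        ... | tri≈ _ refl _ rewrite row-≡ {i} {x} {S} | row-∉ {i′} {q ∸ 1} i′<i i∉S = x≤s
        ... | tri> _ ne l = ℕₚ.≤-reflexive (row-beyond l (ℕₚ.<-trans i′<i l))

        full-row : ∀ a → row i (s i) S a ≤ base a
        full-row a with Finₚ.<-cmp a i
        ... | tri< l _ _ rewrite row-< {i} {s i} {S} l = z≤n
        ... | tri≈ _ refl _ rewrite row-≡ {i} {s i} {S} = ℕₚ.≤-reflexive (sym base-i)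
        ... | tri> _ ne l = ℕₚ.≤-reflexive (row-beyond l (ℕₚ.<-trans i′<i l))

        ∉S⁺⇒≢ : ∀ {b} → b ∉ S⁺ → b ≢ i
        ∉S⁺⇒≢ b∉ refl = b∉ (q⊆p∪q S ⁅ i ⁆ (x∈⁅x⁆ i))

        C₂ : ∀ {a b} → a Fin.< b → b ∉ S⁺ → base b < s b → base a ≡ 0
        C₂ a<b b∉ = base-C₂ a<b (b∉ ∘ S⊆S⁺)

        w-inv : IsInversion w
        w-inv = profile-isInversion S⁺ j (row-≤ q≤s) L≤base C₁ C₂ C₃
          where
          C₁ : ∀ {a b} → a Fin.< b → b ∈ S⁺ → b Fin.< j → 0 < L b → base a ≤ L a
          C₁ {a} {b} a<b b∈ _ l with b Fin.≟ i
          ... | yes refl = ℕₚ.≤-reflexive (sym (L-≢ λ { refl → ℕₚ.<-irrefl refl a<b }))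
          ... | no b≢i with S⁺-cases b∈
          ...   | inj₁ b∈S = contradiction l (ℕₚ.<-irrefl (sym (base-0 b∈S)))
          ...   | inj₂ e   = contradiction e b≢i
          C₃ : ∀ {a b} → a Fin.< b → b ∉ S⁺ → L b < s b → L a ≡ 0
          C₃ {a} {b} a<b b∉ l = ℕₚ.n≤0⇒n≡0 (ℕₚ.≤-trans (L≤base a)
            (ℕₚ.≤-reflexive (C₂ a<b b∉ (subst (_< s b) (L-≢ (∉S⁺⇒≢ b∉)) l))))

        v-inv : IsInversion v
        v-inv = profile-isInversion S j (row-≤ q≤s) (λ a → ℕₚ.≤-trans (M≤L a) (L≤base a))
          (λ _ b∈ _ l → contradiction l (ℕₚ.<-irrefl (sym (row-∈′ (λ { refl → i∉S b∈ }) b∈))))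
          base-C₂ (λ a<b b∉ l → row-< (ℕₚ.<-≤-trans a<b (row-<s⇒≤ b∉ l)))

        least : ∀ {e} → IsInversion e → f ⊑ e → w ⊑ e → u ⊑ e
        least {e} I f⊑e w⊑e {a} {c} a<c with column S⁺ j c
        ... | outside c∉ rewrite profile-∉ {S⁺} {j} {base} {base} {a} c∉ = z≤n
        ... | low c∈ c<j = ℕₚ.≤-trans (ℕₚ.≤-reflexive
                (trans (profile-hi {hi = base} c∈ c<j) (sym (profile-hi {hi = base} {L} c∈ c<j)))) (w⊑e a<c)
        ... | high c∈ j≤c with a Fin.≟ i
        ...   | no a≢i = ℕₚ.≤-trans (ℕₚ.≤-reflexive (trans (profile-lo {hi = base} c∈ j≤c)
                (trans (sym (L-≢ a≢i)) (sym (profile-lo {hi = base} {L} c∈ j≤c))))) (w⊑e a<c)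
        ...   | yes refl with S⁺-cases c∈
        ...     | inj₂ refl = contradiction a<c (ℕₚ.<-irrefl refl)
        ...     | inj₁ c∈S  = ℕₚ.≤-trans (ℕₚ.≤-reflexive (trans (profile-lo {hi = base} c∈ j≤c)
                  (trans base-i (sym (trans (profile-flat {h = row i (s i) S} c∈S) (row-≡ {i} {s i} {S}))))))
                  (f⊑e a<c)

        -- Below `w` the entry at (i , c) is less than `s i`, so for `a` before `i` the axiom `down`
        -- bounds (a , c) by (a , i). Below `g` the latter is 0, since `i` is not a column of `g`.
        -- This removes row `i′` from column `j`.
        greatest : ∀ {e} → IsInversion e → e ⊑ w → e ⊑ g → e ⊑ v
        greatest {e} I e⊑w e⊑g {a} {c} a<c with column S j c
        ... | outside c∉ = ℕₚ.≤-trans (e⊑g a<c)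
                (ℕₚ.≤-reflexive (trans (profile-∉ {hi = base} c∉) (sym (profile-∉ {hi = base} c∉))))
        ... | low c∈ c<j = ℕₚ.≤-trans (e⊑g a<c)
                (ℕₚ.≤-reflexive (trans (profile-flat {h = base} c∈) (sym (profile-hi {hi = base} c∈ c<j))))
        ... | high c∈ j≤c = ℕₚ.≤-trans (e≤M (Finₚ.<-cmp a i)) (ℕₚ.≤-reflexive (sym (profile-lo {hi = base} c∈ j≤c)))
          where
          e-i : e i c ≤ x
          e-i = ℕₚ.≤-trans (e⊑w (ℕₚ.<-≤-trans i<j j≤c))
                  (ℕₚ.≤-reflexive (trans (profile-lo {hi = base} {L} (S⊆S⁺ c∈) j≤c) (override-≡ {i} {x} {base})))
          e≤M : _ → e a c ≤ M a
          e≤M (tri< a<i _ _) = begin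
            e a c  ≤⟨ IsInversion.down I a<i (ℕₚ.<-≤-trans i<j j≤c) (ℕₚ.≤-<-trans e-i (ℕₚ.∸-monoʳ-< (s≤s z≤n) 1≤s)) ⟩
            e a i  ≤⟨ e⊑g a<i ⟩
            g a i  ≡⟨ profile-∉ {hi = base} i∉S ⟩
            0      ≤⟨ z≤n ⟩
            M a    ∎
            where open ℕₚ.≤-Reasoning
          e≤M (tri≈ _ refl _) = ℕₚ.≤-trans e-i (ℕₚ.≤-reflexive (sym (row-≡ {i} {x} {S})))
          e≤M (tri> _ _ l)    = ℕₚ.≤-trans (e⊑g a<c) (ℕₚ.≤-reflexive (trans (profile-flat {h = base} c∈)
                                  (row-beyond (ℕₚ.<-trans i′<i l) l)))

      extend-left-below : Perspectivity f f⁻ g g⁻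
      extend-left-below = record
        { w      = w
        ; u      = u
        ; v      = v
        ; f-inv  = row-profile-isInversion ℕₚ.≤-refl ℕₚ.≤-refl id λ k∈ _ → k∈
        ; f⁻-inv = row-profile-isInversion ℕₚ.≤-refl x≤s id λ k∈ _ → k∈
        ; w-inv  = w-inv
        ; u-inv  = profile-isInversion S⁺ j (row-≤ q≤s) (λ _ → ℕₚ.≤-refl) (λ _ _ _ _ → ℕₚ.≤-refl) C₂ C₂
        ; v-inv  = v-inv
        ; f⁻⊑w   = λ {a} _ → profile-mono S⊆S⁺ (λ _ → full-row a) (λ _ → M≤L a)
        ; f∨w    = record
          { left  = λ {a} _ → profile-mono S⊆S⁺ (λ _ → full-row a) (λ _ → full-row a)
          ; right = λ {a} _ → profile-mono id (λ _ → ℕₚ.≤-refl) (λ _ → L≤base a)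
          ; least = least
          }
        ; g⊑u    = λ _ → profile-mono S⊆S⁺ (λ _ → ℕₚ.≤-refl) (λ _ → ℕₚ.≤-refl)
        ; w∧g    = record
          { left     = λ {a} _ → profile-mono S⊆S⁺ (λ _ → ℕₚ.≤-refl) (λ _ → M≤L a)
          ; right    = λ {a} _ → profile-mono id (λ _ → ℕₚ.≤-refl) (λ _ → ℕₚ.≤-trans (M≤L a) (L≤base a))
          ; greatest = greatest
          }
        ; v⊑g⁻   = λ {a} _ → profile-mono id (λ _ → ℕₚ.≤-refl) (λ _ → M≤low a)
        ; g⁻⊑g   = g⁻⊑g
        }

-- The lower cover of T∨

module ArcCovers {n : ℕ} {s : Fin n → ℕ} (α : Arc s) where
  open Validity s
  open Inversions s
  open Profiles s
  open Contractions s
  open Arc α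

  private
    S = support α
    f = arcInversions α

  arcInversions⁻ : Fin n → Fin n → ℕ
  arcInversions⁻ = arcProfile i j S r (r ∸ 1)

  private
    f⁻ = arcInversions⁻

  arcInversions-isInversion : IsInversion f
  arcInversions-isInversion = row-profile-isInversion r≤s ℕₚ.≤-refl id λ k∈ _ → k∈

  arcInversions⁻-isInversion : IsInversion f⁻
  arcInversions⁻-isInversion = row-profile-isInversion r≤s (ℕₚ.m∸n≤m r 1) id λ k∈ _ → k∈

  j∈support : j ∈ S
  j∈support = q⊆p∪q A ⁅ j ⁆ (x∈⁅x⁆ j)

  A⊆support : A ⊆ S
  A⊆support = p⊆p∪q ⁅ j ⁆

  support⇒A : ∀ {c} → c ∈ S → c ≢ j → c ∈ A
  support⇒A c∈ c≢j with x∈p∪q⁻ A ⁅ j ⁆ c∈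
  ... | inj₁ c∈A = c∈A
  ... | inj₂ c∈j = contradiction (x∈⁅y⁆⇒x≡y j c∈j) c≢j

  B⇒∉support : ∀ {c} → c ∈ B → c ∉ S
  B⇒∉support {c} c∈B c∈S = disj c (support⇒A c∈S c≢j) c∈B
    where
    c≢j : c ≢ j
    c≢j refl = ℕₚ.<-irrefl refl (proj₁ (proj₂ (Equivalence.to (cover c) (inj₂ c∈B))))

  f-ij : f i j ≡ r
  f-ij = trans (arcInversions-∈ α j∈support) (row-≡ {i} {r} {S})

  f⁻-ij : f⁻ i j ≡ r ∸ 1
  f⁻-ij = trans (profile-lo {hi = row i r S} j∈support ℕₚ.≤-refl) (row-≡ {i} {r ∸ 1} {S})

  r∸1<r : r ∸ 1 < r
  r∸1<r = ℕₚ.∸-monoʳ-< (s≤s z≤n) 1≤r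

  f⁻⊑f : f⁻ ⊑ f
  f⁻⊑f {a} _ = profile-mono id (λ _ → ℕₚ.≤-refl) (λ _ → row-mono (ℕₚ.m∸n≤m r 1) a)

  f⁻-elsewhere : ∀ {a c} → a ≢ i ⊎ c ≢ j → f⁻ a c ≡ f a c
  f⁻-elsewhere {a} {c} ne with column S j c
  ... | outside c∉ = trans (profile-∉ {hi = row i r S} c∉) (sym (arcInversions-∉ α c∉))
  ... | low c∈ c<j = trans (profile-hi {hi = row i r S} c∈ c<j) (sym (arcInversions-∈ α c∈))
  ... | high c∈ j≤c with a Fin.≟ i | ne
  ...   | no a≢i   | _        = trans (profile-lo {hi = row i r S} c∈ j≤c)
                                  (trans (row-≢ a≢i) (sym (arcInversions-∈ α c∈)))
  ...   | yes refl | inj₁ a≢i = contradiction refl a≢i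
  ...   | yes refl | inj₂ c≢j = contradiction (Finₚ.≤-antisym (proj₂ (support-bounds α c∈)) j≤c) c≢j

  module _ {e : Fin n → Fin n → ℕ} (I : IsInversion e) (e⊑f : e ⊑ f) where
    open IsInversion I

    -- Together with `above-arc` this splits the elements below `f` by their entry at (i , j): they
    -- lie below `f⁻` or equal `f`. So `f⁻` is the unique lower cover.
    below-cover : e i j < r → e ⊑ f⁻
    below-cover e<r {a} {c} a<c with a Fin.≟ i | c Fin.≟ j
    ... | no a≢i   | _        = ℕₚ.≤-trans (e⊑f a<c) (ℕₚ.≤-reflexive (sym (f⁻-elsewhere (inj₁ a≢i))))
    ... | yes _    | no c≢j   = ℕₚ.≤-trans (e⊑f a<c) (ℕₚ.≤-reflexive (sym (f⁻-elsewhere (inj₂ c≢j))))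
    ... | yes refl | yes refl = ℕₚ.≤-trans (ℕₚ.<⇒≤pred e<r)
                                  (ℕₚ.≤-reflexive (sym f⁻-ij))

    -- For `c` in `A` the entry at (c , j) is 0 and `s c` is nonzero, so `down` makes column `c`
    -- dominate column `j`. In column `j`, a deficient row `a` after `i` and outside `S` would by
    -- `down` bound `e i j` by `e i a`, which is 0.
    above-arc : r ≤ e i j → f ⊑ e
    above-arc r≤e {a} {c} a<c with toSum (c ∈? S)
    ... | inj₂ c∉ rewrite arcInversions-∉ α {a} c∉ = z≤n
    ... | inj₁ c∈ = ℕₚ.≤-trans (ℕₚ.≤-reflexive (arcInversions-∈ α c∈)) (row≤e (Finₚ.<-cmp a i))
      where
      from-j : ∀ {a} → a Fin.< c → e a j ≤ e a c
      from-j {a} a<c with c Fin.≟ j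
      ... | yes refl = ℕₚ.≤-refl
      ... | no c≢j   = down a<c c<j (ℕₚ.≤-<-trans (e⊑f c<j) (ℕₚ.≤-<-trans
        (ℕₚ.≤-reflexive (trans (arcInversions-∈ α j∈support) (row-∈ (proj₁ (support-bounds α c∈)) c∈)))
        (ℕₚ.n≢0⇒n>0 (proj₂ (proj₂ (Equivalence.to (cover c) (inj₁ (support⇒A c∈ c≢j))))))))
        where
        c<j : c Fin.< j
        c<j = Finₚ.≤∧≢⇒< (proj₂ (support-bounds α c∈)) c≢j
      row≤e : _ → row i r S a ≤ e a c
      row≤e (tri< a<i _ _) = ℕₚ.≤-trans (ℕₚ.≤-reflexive (row-< a<i)) z≤n
      row≤e (tri≈ _ refl _) = ℕₚ.≤-trans (ℕₚ.≤-reflexive (row-≡ {i} {r} {S})) (ℕₚ.≤-trans r≤e (from-j a<c))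
      row≤e (tri> _ _ i<a) with a ∈? S
      ... | yes a∈ = ℕₚ.≤-trans (ℕₚ.≤-reflexive (row-∈ i<a a∈)) z≤n
      ... | no a∉  = ℕₚ.≤-trans (ℕₚ.≤-reflexive (row-∉ i<a a∉)) (ℕₚ.≤-trans s≤e (from-j a<c))
        where
        a<j : a Fin.< j
        a<j = ℕₚ.<-≤-trans a<c (proj₂ (support-bounds α c∈))
        s≤e : s a ≤ e a j
        s≤e with e a j ℕ.<? s a
        ... | no ¬l = ℕₚ.≮⇒≥ ¬l
        ... | yes l = contradiction
          (ℕₚ.≤-trans 1≤r (ℕₚ.≤-trans r≤e (ℕₚ.≤-trans (down i<a a<j l)
            (ℕₚ.≤-trans (e⊑f i<a) (ℕₚ.≤-reflexive (arcInversions-∉ α a∉)))))) λ ()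

  tvee-valid : T (valid s (tveeRaw s α))
  tvee-valid = wellFormed⇒valid _ (represents⇒wellFormed arcInversions-isInversion (tvee-represents α))

  tvee-pos : pos s (tveeRaw s α) ≈ f
  tvee-pos = represents⇒pos arcInversions-isInversion (tvee-represents α)

  module _ (t : STree s) (t-pos : pos s (proj₁ t) ≈ f) where

    private
      f⁻≢f : ∀ {x y : STree s} → pos s (proj₁ x) ≈ f → pos s (proj₁ y) ≈ f⁻ → y ≢ x
      f⁻≢f x≈f y≈f⁻ refl = ℕₚ.<⇒≢ r∸1<r
        (trans (sym f⁻-ij) (trans (sym (y≈f⁻ i<j)) (trans (x≈f i<j) f-ij)))

    contracts⇒collapses : ∀ {R} → Contracts (_≤w_ s) R t → Collapses R f f⁻
    contracts⇒collapses c {x} {y} x≈f y≈f⁻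
      with STree-ext {x} {t} (λ l → trans (x≈f l) (sym (t-pos l)))
    ... | refl = c y
      ( (λ a b l → subst₂ _≤_ (sym (y≈f⁻ l)) (sym (t-pos l)) (f⁻⊑f l))
      , f⁻≢f {t} {y} t-pos y≈f⁻
      , between )
      where
      between : ∀ z → _≤w_ s y z → _≤w_ s z t → z ≡ y ⊎ z ≡ t
      between z y≤z z≤t with pos s (proj₁ z) i j ℕ.<? r
      ... | yes z<r = inj₁ (STree-ext {z} {y} λ l → ℕₚ.≤-antisym
              (ℕₚ.≤-trans (below-cover (STree-isInversion z) z⊑f z<r l) (ℕₚ.≤-reflexive (sym (y≈f⁻ l)))) (y≤z _ _ l))
        where
        z⊑f : pos s (proj₁ z) ⊑ f
        z⊑f l = subst (_ ≤_) (t-pos l) (z≤t _ _ l)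
      ... | no z≮r = inj₂ (STree-ext {z} {t} λ l → ℕₚ.≤-antisym (z≤t _ _ l)
              (ℕₚ.≤-trans (ℕₚ.≤-reflexive (t-pos l)) (above-arc (STree-isInversion z) z⊑f (ℕₚ.≮⇒≥ z≮r) l)))
        where
        z⊑f : pos s (proj₁ z) ⊑ f
        z⊑f l = subst (_ ≤_) (t-pos l) (z≤t _ _ l)

    collapses⇒contracts : ∀ {R} → Collapses R f f⁻ → Contracts (_≤w_ s) R t
    collapses⇒contracts {R} c y (y≤t , y≢t , between) with pos s (proj₁ y) i j ℕ.<? r
    ... | no y≮r = contradiction (STree-ext {y} {t} λ l → ℕₚ.≤-antisym (y≤t _ _ l)
            (ℕₚ.≤-trans (ℕₚ.≤-reflexive (t-pos l)) (above-arc (STree-isInversion y) y⊑f (ℕₚ.≮⇒≥ y≮r) l))) y≢t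
      where
      y⊑f : pos s (proj₁ y) ⊑ f
      y⊑f l = subst (_ ≤_) (t-pos l) (y≤t _ _ l)
    ... | yes y<r with between t⁻
            (λ a b l → subst (_ ≤_) (sym (pos-tree arcInversions⁻-isInversion l))
              (below-cover (STree-isInversion y) (λ l → subst (_ ≤_) (t-pos l) (y≤t _ _ l)) y<r l))
            (λ a b l → subst₂ _≤_ (sym (pos-tree arcInversions⁻-isInversion l)) (sym (t-pos l)) (f⁻⊑f l))
      where
      t⁻ = tree arcInversions⁻-isInversion
    ...   | inj₁ e = subst (R t) e (c t-pos (pos-tree arcInversions⁻-isInversion))
    ...   | inj₂ e = contradiction e
            (f⁻≢f {t} {tree arcInversions⁻-isInversion} t-pos (pos-tree arcInversions⁻-isInversion))

-- From subarcs to forcing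

module SubarcForces {n : ℕ} {s : Fin n → ℕ} {α α′ : Arc s} (sub : Subarc s α α′) where
  open Inversions s
  open Profiles s
  open Contractions s
  open ArcCovers
  private
    module a = Arc α
    module a′ = Arc α′
    S = support α
    S′ = support α′
  open Subarc sub

  collapses-subarc : ∀ {R} → IsCongruence (_≤w_ s) R →
                     Collapses R (arcInversions α) (arcInversions⁻ α) →
                     Collapses R (arcInversions α′) (arcInversions⁻ α′)
  collapses-subarc {R} C c = left (ℕₚ.m≤n⇒m<n∨m≡n i'≤i) c′
    where
    S⊆ : S ⊆ S′ ∪ ⁅ a.j ⁆
    S⊆ k∈ with x∈p∪q⁻ a.A ⁅ a.j ⁆ k∈
    ... | inj₁ k∈A = p⊆p∪q ⁅ a.j ⁆ (A⊆support α′ (A⊆A' k∈A))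
    ... | inj₂ k∈j = q⊆p∪q S′ ⁅ a.j ⁆ k∈j
    S′<j : ∀ {k} → a.i Fin.< k → k Fin.< a.j → k ∈ S′ → k ∈ S
    S′<j {k} i<k k<j k∈ with support⇒A α′ k∈ (λ { refl → ℕₚ.<⇒≱ k<j j≤j' })
    ... | k∈A′ with Equivalence.from (a.cover k)
                      (i<k , k<j , proj₂ (proj₂ (Equivalence.to (a′.cover k) (inj₁ k∈A′))))
    ...   | inj₁ k∈A = A⊆support α k∈A
    ...   | inj₂ k∈B = contradiction (B⊆B' k∈B) (a′.disj k k∈A′)
    c′ : Collapses R (arcProfile a.i a′.j S′ a.r a.r) (arcProfile a.i a′.j S′ a.r (a.r ∸ 1))
    c′ = collapses-along C (extend-right a.i<j j≤j' a.1≤r a.r≤s (j∈support α)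
      (λ k∈ → proj₂ (support-bounds α k∈)) S⊆ (λ k∈ → proj₂ (support-bounds α′ k∈)) S′<j
      (λ j<j′ e → ℕₚ.<⇒≢ j<j′ (cong toℕ (s0 e)))) c
    i<j′ : a.i Fin.< a′.j
    i<j′ = ℕₚ.<-≤-trans a.i<j j≤j'
    1≤s : 1 ≤ s a.i
    1≤s = ℕₚ.≤-trans a.1≤r a.r≤s
    left : a′.i Fin.< a.i ⊎ toℕ a′.i ≡ toℕ a.i →
           Collapses R (arcProfile a.i a′.j S′ a.r a.r) (arcProfile a.i a′.j S′ a.r (a.r ∸ 1)) →
           Collapses R (arcInversions α′) (arcInversions⁻ α′)
    left (inj₂ e) c = subst (λ (i , r) → Collapses R (arcProfile i a′.j S′ r r) (arcProfile i a′.j S′ r (r ∸ 1)))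
      (cong₂ _,_ (sym (Finₚ.toℕ-injective e)) (same (Finₚ.toℕ-injective e))) c
    left (inj₁ i′<i) c with less i′<i
    ... | inj₁ (i∈A′ , r≡1) = collapses-along C
      (extend-left-above i′<i i<j′ a′.r≤s 1≤s (i∉support α′) (j∈support α′)
        (λ k∈ → proj₂ (support-bounds α′ k∈)) (A⊆support α′ i∈A′))
      (subst (λ r → Collapses R (arcProfile a.i a′.j S′ r r) (arcProfile a.i a′.j S′ r (r ∸ 1))) r≡1 c)
    ... | inj₂ (i∈B′ , r≡s) = collapses-along C
      (extend-left-below i′<i i<j′ a′.r≤s 1≤s (i∉support α′) (j∈support α′)
        (λ k∈ → proj₂ (support-bounds α′ k∈)) (B⇒∉support α′ i∈B′))
      (subst (λ r → Collapses R (arcProfile a.i a′.j S′ r r) (arcProfile a.i a′.j S′ r (r ∸ 1))) r≡s c)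

module _ {n : ℕ} {P : Fin n → Set} (P? : Decidable P) where

  comprehension : Subset n
  comprehension = tabulate λ k → does (P? k)

  ∈-comprehension⁺ : ∀ {k} → P k → k ∈ comprehension
  ∈-comprehension⁺ {k} p = Vecₚ.lookup⇒[]= k _ (trans (Vecₚ.lookup∘tabulate _ k) (dec-true (P? k) p))

  ∈-comprehension⁻ : ∀ {k} → k ∈ comprehension → P k
  ∈-comprehension⁻ {k} k∈ with P? k | trans (sym (Vecₚ.lookup∘tabulate (λ k → does (P? k)) k)) (Vecₚ.[]=⇒lookup k∈)
  ... | yes p | _ = p

-- The congruence of an arc

module ArcCongruence {n : ℕ} {s : Fin n → ℕ} (α : Arc s) where
  open Validity s
  open Inversions s
  open Profiles s
  open Contractions s
  open ArcCovers α
  open Arc α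

  A-bounds : ∀ {k} → k ∈ A → i Fin.< k × k Fin.< j × s k ≢ 0
  A-bounds {k} k∈ = Equivalence.to (cover k) (inj₁ k∈)

  B-bounds : ∀ {k} → k ∈ B → i Fin.< k × k Fin.< j × s k ≢ 0
  B-bounds {k} k∈ = Equivalence.to (cover k) (inj₂ k∈)

  -- A subarc of α is determined by its end points: its two sets are those of α cut down to the open
  -- interval, and its last entry is `ρ`. A start other than `i` lies in `A` or `B` by `less`; an
  -- end other than `j` has a nonzero `s` by `s0`, so it lies in `A` or `B` too.
  data Source (k : Fin n) : Set where
    is-i : k ≡ i → Source k
    in-A : k ∈ A → Source k
    in-B : k ∈ B → Source k

  data Target (k : Fin n) : Set where
    is-j : k ≡ j → Target k
    in-A : k ∈ A → Target k
    in-B : k ∈ B → Target k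

  i≤Source : ∀ {k} → Source k → i Fin.≤ k
  i≤Source (is-i refl) = ℕₚ.≤-refl
  i≤Source (in-A k∈)   = ℕₚ.<⇒≤ (proj₁ (A-bounds k∈))
  i≤Source (in-B k∈)   = ℕₚ.<⇒≤ (proj₁ (B-bounds k∈))

  Target≤j : ∀ {k} → Target k → k Fin.≤ j
  Target≤j (is-j refl) = ℕₚ.≤-refl
  Target≤j (in-A k∈)   = ℕₚ.<⇒≤ (proj₁ (proj₂ (A-bounds k∈)))
  Target≤j (in-B k∈)   = ℕₚ.<⇒≤ (proj₁ (proj₂ (B-bounds k∈)))

  -- The last entry of the subarc of α starting at k.
  ρ : Fin n → ℕ
  ρ k with k Fin.≟ i | k ∈? A
  ... | yes _ | _     = r
  ... | no _  | yes _ = 1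
  ... | no _  | no _  = s k

  ρ-i : ρ i ≡ r
  ρ-i with i Fin.≟ i
  ... | yes _ = refl
  ... | no ne = contradiction refl ne

  ρ-A : ∀ {k} → k ∈ A → ρ k ≡ 1
  ρ-A {k} k∈ with k Fin.≟ i | k ∈? A
  ... | yes refl | _     = contradiction (proj₁ (A-bounds k∈)) (ℕₚ.<-irrefl refl)
  ... | no _     | yes _ = refl
  ... | no _     | no k∉ = contradiction k∈ k∉

  ρ-B : ∀ {k} → k ∈ B → ρ k ≡ s k
  ρ-B {k} k∈ with k Fin.≟ i | k ∈? A
  ... | yes refl | _       = contradiction (proj₁ (B-bounds k∈)) (ℕₚ.<-irrefl refl)
  ... | no _     | yes k∈A = contradiction k∈ (disj k k∈A)
  ... | no _     | no _    = refl

  1≤ρ : ∀ {k} → Source k → 1 ≤ ρ k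
  1≤ρ (is-i refl) = subst (1 ≤_) (sym ρ-i) 1≤r
  1≤ρ (in-A k∈)   = subst (1 ≤_) (sym (ρ-A k∈)) ℕₚ.≤-refl
  1≤ρ (in-B k∈)   = subst (1 ≤_) (sym (ρ-B k∈)) (ℕₚ.n≢0⇒n>0 (proj₂ (proj₂ (B-bounds k∈))))

  ρ≤s : ∀ {k} → Source k → ρ k ≤ s k
  ρ≤s (is-i refl) = subst (_≤ s i) (sym ρ-i) r≤s
  ρ≤s (in-A k∈)   = subst (_≤ _) (sym (ρ-A k∈)) (ℕₚ.n≢0⇒n>0 (proj₂ (proj₂ (A-bounds k∈))))
  ρ≤s (in-B k∈)   = ℕₚ.≤-reflexive (ρ-B k∈)

  -- The nonzero entries of T∨ for the subarc from `k` to `l` sit in rows `k` and `B` and in columns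
  -- `A` and `l`. The meet irreducible exchanges `A` and `B`, hence the parameter `X`.
  data StartOr (X : Subset n) (k l : Fin n) : Fin n → Set where
    at-start : StartOr X k l k
    inner : ∀ {c} → c ∈ X → k Fin.< c → c Fin.< l → StartOr X k l c

  data EndOr (X : Subset n) (k l : Fin n) : Fin n → Set where
    at-end   : EndOr X k l l
    inner : ∀ {c} → c ∈ X → k Fin.< c → c Fin.< l → EndOr X k l c

  -- For the subarc β of α from k to l, `Above k l f` says that f lies above T∨(β), and `Below k l f`
  -- that f lies below the meet irreducible of β.
  Above Below : Fin n → Fin n → (Fin n → Fin n → ℕ) → Set
  Above k l f = ∀ {b a} → StartOr B k l b → EndOr A k l a → b Fin.< a → ρ b ≤ f b a
  Below k l f = ∀ {a b} → StartOr A k l a → EndOr B k l b → a Fin.< b → f a b < ρ a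

  record Subpair (k l : Fin n) : Set where
    constructor subpair
    field
      k<l    : k Fin.< l
      source : Source k
      target : Target l

  StartB-Source : ∀ {k l c} → Source k → StartOr B k l c → Source c
  StartB-Source src at-start         = src
  StartB-Source src (inner m _ _) = in-B m

  StartA-Source : ∀ {k l c} → Source k → StartOr A k l c → Source c
  StartA-Source src at-start         = src
  StartA-Source src (inner m _ _) = in-A m

  EndA-Target : ∀ {k l c} → Target l → EndOr A k l c → Target c
  EndA-Target tgt at-end           = tgt
  EndA-Target tgt (inner m _ _) = in-A m

  EndB-Target : ∀ {k l c} → Target l → EndOr B k l c → Target c
  EndB-Target tgt at-end           = tgt
  EndB-Target tgt (inner m _ _) = in-B m

  StartOr-≤ : ∀ {X k l c} → StartOr X k l c → k Fin.≤ c
  StartOr-≤ at-start         = ℕₚ.≤-refl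
  StartOr-≤ (inner _ l _) = ℕₚ.<⇒≤ l

  EndOr-≤ : ∀ {X k l c} → EndOr X k l c → c Fin.≤ l
  EndOr-≤ at-end           = ℕₚ.≤-refl
  EndOr-≤ (inner _ _ l) = ℕₚ.<⇒≤ l

  StartOr-widen : ∀ {X Y k l b a c} → StartOr X k l b → EndOr Y k l a → StartOr X b a c → StartOr X k l c
  StartOr-widen p q at-start         = p
  StartOr-widen p q (inner m x y) = inner m (ℕₚ.≤-<-trans (StartOr-≤ p) x) (ℕₚ.<-≤-trans y (EndOr-≤ q))

  EndOr-widen : ∀ {X Y k l b a c} → StartOr X k l b → EndOr Y k l a → EndOr Y b a c → EndOr Y k l c
  EndOr-widen p q at-end           = q
  EndOr-widen p q (inner m x y) = inner m (ℕₚ.≤-<-trans (StartOr-≤ p) x) (ℕₚ.<-≤-trans y (EndOr-≤ q))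

  Above-restrict : ∀ {k l b a f} → Above k l f → StartOr B k l b → EndOr A k l a → Above b a f
  Above-restrict h p q p′ q′ = h (StartOr-widen p q p′) (EndOr-widen p q q′)

  Below-restrict : ∀ {k l a b f} → Below k l f → StartOr A k l a → EndOr B k l b → Below a b f
  Below-restrict h p q p′ q′ = h (StartOr-widen p q p′) (EndOr-widen p q q′)

  module _ {g : Fin n → Fin n → ℕ} (I : IsInversion g) {k l : Fin n} (P : Subpair k l) where
    open IsInversion I
    open Subpair P

    -- Each (b , l) with `b` in `B` is positive, so `up` carries the shortage at (k , l) over to (k
    -- , b). For `a` in `A` the entry (a , l) must be 0, as otherwise `up` would give
    -- `ρ k ≤ g k a ≤ g k l`. One more `up` settles (a , b).
    almost-Above⇒Below : (∀ {b a} → StartOr B k l b → EndOr A k l a → b Fin.< a → b ≢ k ⊎ a ≢ l → ρ b ≤ g b a) →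
                         g k l < ρ k → Below k l g
    almost-Above⇒Below h g<ρ = below
      where
      positive : ∀ {b} → b ∈ B → k Fin.< b → b Fin.< l → 0 < g b l
      positive b∈ k<b b<l = ℕₚ.<-≤-trans (1≤ρ (in-B b∈))
        (h (inner b∈ k<b b<l) at-end b<l (inj₁ λ { refl → ℕₚ.<-irrefl refl k<b }))
      A-at-end : ∀ {a} → a ∈ A → k Fin.< a → a Fin.< l → g a l < ρ a
      A-at-end {a} a∈ k<a a<l with 0 ℕ.<? g a l
      ... | no ¬pos = ℕₚ.≤-<-trans (ℕₚ.≮⇒≥ ¬pos) (1≤ρ (in-A a∈))
      ... | yes pos = contradiction (up k<a a<l pos) (ℕₚ.<⇒≱ (ℕₚ.<-≤-trans g<ρ
              (h at-start (inner a∈ k<a a<l) k<a (inj₂ λ { refl → ℕₚ.<-irrefl refl a<l }))))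
      below : Below k l g
      below at-start at-end _ = g<ρ
      below at-start (inner b∈ k<b b<l) _ = ℕₚ.≤-<-trans (up k<b b<l (positive b∈ k<b b<l)) g<ρ
      below (inner a∈ k<a a<l) at-end _ = A-at-end a∈ k<a a<l
      below (inner a∈ k<a a<l) (inner b∈ k<b b<l) a<b =
        ℕₚ.≤-<-trans (up a<b b<l (positive b∈ k<b b<l)) (A-at-end a∈ k<a a<l)

    -- Dual to the previous argument: the entries (a , l) are deficient for `a` in `A`, `down`
    -- carries `ρ k` from (k , l) to (k , a), and it forces (b , l) to be full for `b` in `B`.
    almost-Below⇒Above : (∀ {a b} → StartOr A k l a → EndOr B k l b → a Fin.< b → a ≢ k ⊎ b ≢ l → g a b < ρ a) →
                         ρ k ≤ g k l → Above k l g
    almost-Below⇒Above h ρ≤g = above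
      where
      deficient : ∀ {a} → a ∈ A → k Fin.< a → a Fin.< l → g a l < s a
      deficient a∈ k<a a<l = ℕₚ.<-≤-trans
        (h (inner a∈ k<a a<l) at-end a<l (inj₁ λ { refl → ℕₚ.<-irrefl refl k<a })) (ρ≤s (in-A a∈))
      B-at-end : ∀ {b} → b ∈ B → k Fin.< b → b Fin.< l → ρ b ≤ g b l
      B-at-end {b} b∈ k<b b<l with g b l ℕ.<? s b
      ... | no ¬def = ℕₚ.≤-trans (ρ≤s (in-B b∈)) (ℕₚ.≮⇒≥ ¬def)
      ... | yes def = contradiction (down k<b b<l def) (ℕₚ.<⇒≱ (ℕₚ.<-≤-trans
              (h at-start (inner b∈ k<b b<l) k<b (inj₂ λ { refl → ℕₚ.<-irrefl refl b<l })) ρ≤g))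
      above : Above k l g
      above at-start at-end _ = ρ≤g
      above at-start (inner a∈ k<a a<l) _ = ℕₚ.≤-trans ρ≤g (down k<a a<l (deficient a∈ k<a a<l))
      above (inner b∈ k<b b<l) at-end _ = B-at-end b∈ k<b b<l
      above (inner b∈ k<b b<l) (inner a∈ k<a a<l) b<a =
        ℕₚ.≤-trans (B-at-end b∈ k<b b<l) (down b<a a<l (deficient a∈ k<a a<l))

  private
    -- The length of a pair is bounded in the form `l ≤ m + k`, which needs no subtraction; moving
    -- either end inwards lowers `m`.
    shorter : ∀ {m} {k l b a : Fin n} → toℕ l ≤ suc m + toℕ k → k Fin.≤ b → a Fin.≤ l → b ≢ k ⊎ a ≢ l →
              toℕ a ≤ m + toℕ b
    shorter {m} {k} {l} {b} {a} d k≤b a≤l (inj₁ b≢k) = begin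
      toℕ a            ≤⟨ a≤l ⟩
      toℕ l            ≤⟨ d ⟩
      suc m + toℕ k    ≡⟨ ℕₚ.+-suc m (toℕ k) ⟨
      m + suc (toℕ k)  ≤⟨ ℕₚ.+-monoʳ-≤ m (Finₚ.≤∧≢⇒< k≤b (b≢k ∘ sym)) ⟩
      m + toℕ b        ∎
      where open ℕₚ.≤-Reasoning
    shorter {m} {k} {l} {b} {a} d k≤b a≤l (inj₂ a≢l) =
      ℕₚ.≤-trans (ℕₚ.≤-pred (ℕₚ.≤-trans (Finₚ.≤∧≢⇒< a≤l a≢l) d)) (ℕₚ.+-monoʳ-≤ m k≤b)

    not-shorter : ∀ {k l : Fin n} → toℕ l ≤ toℕ k → ¬ k Fin.< l
    not-shorter d l = ℕₚ.<⇒≱ l d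

  module _ {f g : Fin n → Fin n → ℕ} (f-inv : IsInversion f) (g-inv : IsInversion g) where

    -- Induction on length: the shorter pairs already give `g` all entries except (k , l). Were that
    -- one too small, `almost-Above⇒Below` would yield `Below k l g`, hence `Below k l f`, against
    -- the entry of `f` at (k , l).
    Below⇒Above-mono : (∀ {k l} → Subpair k l → Below k l g → Below k l f) →
                       ∀ {k l} → Subpair k l → Above k l f → Above k l g
    Below⇒Above-mono H {k} {l} = go (toℕ l) (ℕₚ.m≤m+n (toℕ l) (toℕ k))
      where
      go : ∀ m {k l} → toℕ l ≤ m + toℕ k → Subpair k l → Above k l f → Above k l g
      go zero    d P _ = contradiction (Subpair.k<l P) (not-shorter d)
      go (suc m) {k} {l} d P h {b} {a} p q b<a = decide (b Fin.≟ k) (a Fin.≟ l) p q b<a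
        where
        elsewhere : ∀ {b a} → StartOr B k l b → EndOr A k l a → b Fin.< a → b ≢ k ⊎ a ≢ l → ρ b ≤ g b a
        elsewhere p q b<a ne = go m (shorter d (StartOr-≤ p) (EndOr-≤ q) ne)
          (subpair b<a (StartB-Source (Subpair.source P) p) (EndA-Target (Subpair.target P) q))
          (Above-restrict h p q) at-start at-end b<a
        decide : ∀ {b a} → Dec (b ≡ k) → Dec (a ≡ l) → StartOr B k l b → EndOr A k l a → b Fin.< a → ρ b ≤ g b a
        decide (no b≢k)   _          p q b<a = elsewhere p q b<a (inj₁ b≢k)
        decide (yes _)    (no a≢l)   p q b<a = elsewhere p q b<a (inj₂ a≢l)
        decide (yes refl) (yes refl) p q b<a with g k l ℕ.<? ρ k
        ... | no ¬l   = ℕₚ.≮⇒≥ ¬l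
        ... | yes g<ρ = contradiction (h at-start at-end b<a)
              (ℕₚ.<⇒≱ (H P (almost-Above⇒Below g-inv P elsewhere g<ρ) at-start at-end b<a))

    Above⇒Below-mono : (∀ {k l} → Subpair k l → Above k l f → Above k l g) →
                       ∀ {k l} → Subpair k l → Below k l g → Below k l f
    Above⇒Below-mono H {k} {l} = go (toℕ l) (ℕₚ.m≤m+n (toℕ l) (toℕ k))
      where
      go : ∀ m {k l} → toℕ l ≤ m + toℕ k → Subpair k l → Below k l g → Below k l f
      go zero    d P _ = contradiction (Subpair.k<l P) (not-shorter d)
      go (suc m) {k} {l} d P h {a} {b} p q a<b = decide (a Fin.≟ k) (b Fin.≟ l) p q a<b
        where
        elsewhere : ∀ {a b} → StartOr A k l a → EndOr B k l b → a Fin.< b → a ≢ k ⊎ b ≢ l → f a b < ρ a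
        elsewhere p q a<b ne = go m (shorter d (StartOr-≤ p) (EndOr-≤ q) ne)
          (subpair a<b (StartA-Source (Subpair.source P) p) (EndB-Target (Subpair.target P) q))
          (Below-restrict h p q) at-start at-end a<b
        decide : ∀ {a b} → Dec (a ≡ k) → Dec (b ≡ l) → StartOr A k l a → EndOr B k l b → a Fin.< b → f a b < ρ a
        decide (no a≢k)   _          p q a<b = elsewhere p q a<b (inj₁ a≢k)
        decide (yes _)    (no b≢l)   p q a<b = elsewhere p q a<b (inj₂ b≢l)
        decide (yes refl) (yes refl) p q a<b with f k l ℕ.<? ρ k
        ... | yes f<ρ = f<ρ
        ... | no ¬l   = contradiction (h at-start at-end a<b)
              (ℕₚ.≤⇒≯ (H P (almost-Below⇒Above f-inv P elsewhere (ℕₚ.≮⇒≥ ¬l)) at-start at-end a<b))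

  complement : (Fin n → Fin n → ℕ) → Fin n → Fin n → ℕ
  complement f a c = s a ∸ f a c

  -- Reflecting a tree turns `f` into `s - f` and exchanges `up` with `down`, so the meet
  -- irreducibles are obtained from profiles.
  complement-isInversion : ∀ {f} → IsInversion f → IsInversion (complement f)
  complement-isInversion {f} I = record
    { bound = λ {i} {k} _ → ℕₚ.m∸n≤m (s i) (f i k)
    ; up    = λ {i} {j} {k} i<j j<k l → ℕₚ.∸-monoʳ-≤ (s i) (down i<j j<k (m<n l))
    ; down  = λ {i} {j} {k} i<j j<k l → ℕₚ.∸-monoʳ-≤ (s i) (up i<j j<k (n>0 l))
    }
    where
    open IsInversion I
    m<n : ∀ {x y} → 0 < x ∸ y → y < x
    m<n {x} {y} l = ℕₚ.≰⇒> λ x≤y → ℕₚ.<-irrefl (sym (ℕₚ.m≤n⇒m∸n≡0 x≤y)) l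
    n>0 : ∀ {x y} → x ∸ y < x → 0 < y
    n>0 {x} {zero}  l = contradiction l (ℕₚ.<-irrefl refl)
    n>0 {x} {suc y} l = s≤s z≤n

  module _ {k l : Fin n} (P : Subpair k l) where
    open Subpair P

    private
      up-to : Subset n → Subset n
      -- Elements of `X` up to `k` may stay: rows before `k` vanish, so their columns are zero.
      up-to X = comprehension λ c → (c Fin.≟ l) ⊎-dec ((c ∈? X) ×-dec (c Fin.<? l))

      up-to-≤ : ∀ {X c} → c ∈ up-to X → c Fin.≤ l
      up-to-≤ {X} c∈ with ∈-comprehension⁻ (λ c → (c Fin.≟ l) ⊎-dec ((c ∈? X) ×-dec (c Fin.<? l))) c∈
      ... | inj₁ refl      = ℕₚ.≤-refl
      ... | inj₂ (_ , c<l) = ℕₚ.<⇒≤ c<l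

      up-to⁺ : ∀ {X c} → EndOr X k l c → c ∈ up-to X
      up-to⁺ {X} at-end = ∈-comprehension⁺ (λ c → (c Fin.≟ l) ⊎-dec ((c ∈? X) ×-dec (c Fin.<? l))) (inj₁ refl)
      up-to⁺ {X} (inner m _ c<l) =
        ∈-comprehension⁺ (λ c → (c Fin.≟ l) ⊎-dec ((c ∈? X) ×-dec (c Fin.<? l))) (inj₂ (m , c<l))

      up-to⁻ : ∀ {X c} → k Fin.< c → c ∈ up-to X → EndOr X k l c
      up-to⁻ {X} k<c c∈ with ∈-comprehension⁻ (λ c → (c Fin.≟ l) ⊎-dec ((c ∈? X) ×-dec (c Fin.<? l))) c∈
      ... | inj₁ refl      = at-end
      ... | inj₂ (m , c<l) = inner m k<c c<l

      in-range : ∀ {c} → k Fin.< c → c Fin.< l → s c ≢ 0 → c ∈ A ⊎ c ∈ B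
      in-range {c} k<c c<l s≢0 = Equivalence.from (cover c)
        (ℕₚ.≤-<-trans (i≤Source source) k<c , ℕₚ.<-≤-trans c<l (Target≤j target) , s≢0)

      cone : Subset n → ℕ → Fin n → Fin n → ℕ
      cone X x = profile (up-to X) l (row k x (up-to X)) (row k x (up-to X))

      cone-∈ : ∀ {X x a c} → c ∈ up-to X → cone X x a c ≡ row k x (up-to X) a
      cone-∈ {X} {x} = profile-flat {h = row k x (up-to X)}

      cone-inv : ∀ {X x} → x ≤ s k → IsInversion (cone X x)
      cone-inv x≤s = row-profile-isInversion x≤s ℕₚ.≤-refl id λ c∈ _ → c∈

      cone-row-≤ : ∀ {X x a c} → a Fin.< k ⊎ k Fin.< a × a ∈ up-to X → cone X x a c ≤ 0
      cone-row-≤ {X} {x} {a} {c} z with toSum (c ∈? up-to X) | z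
      ... | inj₂ c∉ | _               = ℕₚ.≤-reflexive (profile-∉ {hi = row k x (up-to X)} c∉)
      ... | inj₁ c∈ | inj₁ a<k        = ℕₚ.≤-reflexive (trans (cone-∈ {X} {x} c∈) (row-< a<k))
      ... | inj₁ c∈ | inj₂ (k<a , a∈) = ℕₚ.≤-reflexive (trans (cone-∈ {X} {x} c∈) (row-∈ k<a a∈))

    -- T∨ of the subarc from k to l, and its dual.
    joinIrreducible meetIrreducible : Fin n → Fin n → ℕ
    joinIrreducible = cone A (ρ k)
    meetIrreducible = complement (cone B (s k ∸ (ρ k ∸ 1)))

    joinIrreducible-inv : IsInversion joinIrreducible
    joinIrreducible-inv = cone-inv (ρ≤s source)

    meetIrreducible-inv : IsInversion meetIrreducible
    meetIrreducible-inv = complement-isInversion (cone-inv (ℕₚ.m∸n≤m (s k) (ρ k ∸ 1)))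

    Above⇒⊒ : ∀ {f} → Above k l f → joinIrreducible ⊑ f
    Above⇒⊒ {f} h {b} {a} b<a with toSum (a ∈? up-to A)
    ... | inj₂ a∉ = ℕₚ.≤-trans (ℕₚ.≤-reflexive (profile-∉ {hi = row k (ρ k) (up-to A)} a∉)) z≤n
    ... | inj₁ a∈ with Finₚ.<-cmp b k
    ...   | tri< b<k _ _ = ℕₚ.≤-trans (cone-row-≤ {A} {ρ k} (inj₁ b<k)) z≤n
    ...   | tri≈ _ refl _ = ℕₚ.≤-trans (ℕₚ.≤-reflexive (trans (cone-∈ {A} {ρ k} a∈) (row-≡ {k} {ρ k} {up-to A})))
                              (h at-start (up-to⁻ b<a a∈) b<a)
    ...   | tri> _ _ k<b with toSum (b ∈? up-to A)
    ...     | inj₁ b∈ = ℕₚ.≤-trans (cone-row-≤ {A} {ρ k} (inj₂ (k<b , b∈))) z≤n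
    ...     | inj₂ b∉ = ℕₚ.≤-trans (ℕₚ.≤-reflexive (trans (cone-∈ {A} {ρ k} a∈) (row-∉ k<b b∉))) (full (s b ℕ.≟ 0))
      where
      b<l : b Fin.< l
      b<l = ℕₚ.<-≤-trans b<a (up-to-≤ {A} a∈)
      full : Dec (s b ≡ 0) → s b ≤ f b a
      full (yes e) = subst (_≤ f b a) (sym e) z≤n
      full (no ne) with in-range k<b b<l ne
      ... | inj₁ b∈A = contradiction (up-to⁺ (inner b∈A k<b b<l)) b∉
      ... | inj₂ b∈B = ℕₚ.≤-trans (ℕₚ.≤-reflexive (sym (ρ-B b∈B)))
                         (h (inner b∈B k<b b<l) (up-to⁻ (ℕₚ.<-trans k<b b<a) a∈) b<a)

    ⊒⇒Above : ∀ {f} → joinIrreducible ⊑ f → Above k l f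
    ⊒⇒Above {f} h p q b<a = ℕₚ.≤-trans (ℕₚ.≤-reflexive (sym (trans (cone-∈ {A} {ρ k} (up-to⁺ q)) (value p)))) (h b<a)
      where
      value : ∀ {b} → StartOr B k l b → row k (ρ k) (up-to A) b ≡ ρ b
      value at-start = row-≡ {k} {ρ k} {up-to A}
      value (inner {b} b∈B k<b b<l) = trans (row-∉ k<b b∉) (sym (ρ-B b∈B))
        where
        b∉ : b ∉ up-to A
        b∉ b∈ with up-to⁻ {A} k<b b∈
        ... | at-end           = ℕₚ.<-irrefl refl b<l
        ... | inner b∈A _ _ = disj b b∈A b∈B

    -- The entry of the meet irreducible in row `k` is `ρ k ∸ 1`, the largest value below `ρ k`, and
    -- in the rows of `A` it is 0 because `ρ` is 1 there. Wherever the meet irreducible is full, the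
    -- bound of an inversion function is enough.
    Below⇒⊑ : ∀ {f} → IsInversion f → Below k l f → f ⊑ meetIrreducible
    Below⇒⊑ {f} I h {a} {b} a<b with toSum (b ∈? up-to B)
    ... | inj₂ b∉ = ℕₚ.≤-trans (IsInversion.bound I a<b)
            (ℕₚ.≤-reflexive (sym (cong (s a ∸_) (profile-∉ {hi = row k (s k ∸ (ρ k ∸ 1)) (up-to B)} b∉))))
    ... | inj₁ b∈ with Finₚ.<-cmp a k
    ...   | tri< a<k _ _ = ℕₚ.≤-trans (IsInversion.bound I a<b) (ℕₚ.∸-monoʳ-≤ (s a) (cone-row-≤ {B} (inj₁ a<k)))
    ...   | tri≈ _ refl _ = begin
              f k b                                ≤⟨ ℕₚ.<⇒≤pred (h at-start (up-to⁻ a<b b∈) a<b) ⟩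
              ρ k ∸ 1                              ≡⟨ ℕₚ.m∸[m∸n]≡n (ℕₚ.≤-trans (ℕₚ.m∸n≤m (ρ k) 1) (ρ≤s source)) ⟨
              s k ∸ (s k ∸ (ρ k ∸ 1))              ≡⟨ cong (s k ∸_) (trans (cone-∈ {B} b∈) (row-≡ {k} {s k ∸ (ρ k ∸ 1)} {up-to B})) ⟨
              meetIrreducible k b                  ∎
      where open ℕₚ.≤-Reasoning
    ...   | tri> _ _ k<a with toSum (a ∈? up-to B)
    ...     | inj₁ a∈ = ℕₚ.≤-trans (IsInversion.bound I a<b)
                          (ℕₚ.∸-monoʳ-≤ (s a) (cone-row-≤ {B} (inj₂ (k<a , a∈))))
    ...     | inj₂ a∉ = ℕₚ.≤-trans (f≤0 (s a ℕ.≟ 0)) z≤n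
      where
      a<l : a Fin.< l
      a<l = ℕₚ.<-≤-trans a<b (up-to-≤ {B} b∈)
      f≤0 : Dec (s a ≡ 0) → f a b ≤ 0
      f≤0 (yes e) = subst (f a b ≤_) e (IsInversion.bound I a<b)
      f≤0 (no ne) with in-range k<a a<l ne
      ... | inj₂ a∈B = contradiction (up-to⁺ (inner a∈B k<a a<l)) a∉
      ... | inj₁ a∈A = ℕₚ.≤-pred (ℕₚ.≤-trans (h (inner a∈A k<a a<l) (up-to⁻ (ℕₚ.<-trans k<a a<b) b∈) a<b)
                         (ℕₚ.≤-reflexive (ρ-A a∈A)))

    ⊑⇒Below : ∀ {f} → f ⊑ meetIrreducible → Below k l f
    ⊑⇒Below {f} h p q a<b = ℕₚ.≤-<-trans (h a<b) (small p (cone-∈ {B} {s k ∸ (ρ k ∸ 1)} (up-to⁺ q)))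
      where
      small : ∀ {a b} → StartOr A k l a → cone B (s k ∸ (ρ k ∸ 1)) a b ≡ row k (s k ∸ (ρ k ∸ 1)) (up-to B) a →
              meetIrreducible a b < ρ a
      small at-start e = ℕₚ.≤-<-trans
        (ℕₚ.≤-reflexive (trans (cong (s k ∸_) (trans e (row-≡ {k} {s k ∸ (ρ k ∸ 1)} {up-to B})))
          (ℕₚ.m∸[m∸n]≡n (ℕₚ.≤-trans (ℕₚ.m∸n≤m (ρ k) 1) (ρ≤s source)))))
        (ℕₚ.∸-monoʳ-< (s≤s z≤n) (1≤ρ source))
      small (inner {a} a∈A k<a a<l) e = ℕₚ.≤-<-trans
        (ℕₚ.≤-reflexive (trans (cong (s a ∸_) (trans e (row-∉ k<a a∉))) (ℕₚ.n∸n≡0 (s a)))) (1≤ρ (in-A a∈A))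
        where
        a∉ : a ∉ up-to B
        a∉ a∈ with up-to⁻ {B} k<a a∈
        ... | at-end           = ℕₚ.<-irrefl refl a<l
        ... | inner a∈B _ _ = disj a a∈A a∈B

  private
    posₜ : STree s → Fin n → Fin n → ℕ
    posₜ x = pos s (proj₁ x)

  -- `Above k l` describes a principal filter, generated by a tree, so that tree is one of the lower
  -- bounds tested by the meet.
  Above-meet : ∀ {x y z} → IsMeet (_≤w_ s) x y z → ∀ {k l} → Subpair k l →
               Above k l (posₜ x) → Above k l (posₜ y) → Above k l (posₜ z)
  Above-meet {x} {y} {z} (_ , _ , great) P hx hy = ⊒⇒Above P λ l → subst (_≤ _) (pos-tree I l)
    (great (tree I) (λ _ _ l → subst (_≤ _) (sym (pos-tree I l)) (Above⇒⊒ P hx l))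
                    (λ _ _ l → subst (_≤ _) (sym (pos-tree I l)) (Above⇒⊒ P hy l)) _ _ l)
    where
    I = joinIrreducible-inv P

  Below-join : ∀ {x y z} → IsJoin (_≤w_ s) x y z → ∀ {k l} → Subpair k l →
               Below k l (posₜ x) → Below k l (posₜ y) → Below k l (posₜ z)
  Below-join {x} {y} {z} (_ , _ , least) P hx hy = ⊑⇒Below P λ l → subst (_ ≤_) (pos-tree I l)
    (least (tree I)
      (λ _ _ l → subst (_ ≤_) (sym (pos-tree I l)) (Below⇒⊑ P (STree-isInversion x) hx l))
      (λ _ _ l → subst (_ ≤_) (sym (pos-tree I l)) (Below⇒⊑ P (STree-isInversion y) hy l)) _ _ l)
    where
    I = meetIrreducible-inv P

  Above-≤ : ∀ {x y} → _≤w_ s x y → ∀ {k l} → Above k l (posₜ x) → Above k l (posₜ y)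
  Above-≤ x≤y h p q b<a = ℕₚ.≤-trans (h p q b<a) (x≤y _ _ b<a)

  Below-≥ : ∀ {x y} → _≤w_ s x y → ∀ {k l} → Below k l (posₜ y) → Below k l (posₜ x)
  Below-≥ x≤y h p q a<b = ℕₚ.≤-<-trans (x≤y _ _ a<b) (h p q a<b)

  _≲_ : STree s → STree s → Set
  x ≲ y = ∀ {k l} → Subpair k l → Above k l (posₜ x) → Above k l (posₜ y)

  _∼_ : STree s → STree s → Set
  x ∼ y = (x ≲ y) × (y ≲ x)

  private
    -- The detour through `Below`: it passes from `z′` down to `x′` and `y′`, is transported to `x`
    -- and `y`, and from there to the join `z`, since `Below k l` describes a principal ideal. The
    -- exchange then turns this back into `Above`.
    join-mono : ∀ {x x′ y y′ z z′} → x ≲ x′ → y ≲ y′ → IsJoin (_≤w_ s) x y z → IsJoin (_≤w_ s) x′ y′ z′ → z ≲ z′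
    join-mono {x} {x′} {y} {y′} {z} {z′} p q J (x′≤z′ , y′≤z′ , _) =
      Below⇒Above-mono (STree-isInversion z) (STree-isInversion z′) λ P h → Below-join {x} {y} {z} J P
        (Above⇒Below-mono (STree-isInversion x) (STree-isInversion x′) p P (Below-≥ {x′} {z′} x′≤z′ h))
        (Above⇒Below-mono (STree-isInversion y) (STree-isInversion y′) q P (Below-≥ {y′} {z′} y′≤z′ h))

    meet-mono : ∀ {x x′ y y′ z z′} → x ≲ x′ → y ≲ y′ → IsMeet (_≤w_ s) x y z → IsMeet (_≤w_ s) x′ y′ z′ → z ≲ z′
    meet-mono {x} {x′} {y} {y′} {z} {z′} p q (z≤x , z≤y , _) M P h = Above-meet {x′} {y′} {z′} M P
      (p P (Above-≤ {z} {x} z≤x h)) (q P (Above-≤ {z} {y} z≤y h))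

  ∼-isCongruence : IsCongruence (_≤w_ s) _∼_
  ∼-isCongruence = record
    { isEquivalence = record
      { refl  = (λ _ h → h) , (λ _ h → h)
      ; sym   = λ (p , q) → q , p
      ; trans = λ (p , q) (p′ , q′) → (λ P h → p′ P (p P h)) , (λ P h → q P (q′ P h))
      }
    ; join-compat = λ x x′ y y′ z z′ (p , p′) (q , q′) J J′ →
        join-mono {x} {x′} {y} {y′} {z} {z′} p q J J′ , join-mono {x′} {x} {y′} {y} {z′} {z} p′ q′ J′ J
    ; meet-compat = λ x x′ y y′ z z′ (p , p′) (q , q′) M M′ →
        meet-mono {x} {x′} {y} {y′} {z} {z′} p q M M′ , meet-mono {x′} {x} {y′} {y} {z′} {z} p′ q′ M′ M
    }

-- From forcing to subarcs

module ForcesSubarc {n : ℕ} {s : Fin n → ℕ} (α α′ : Arc s) where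
  open Inversions s
  open Profiles s
  open Contractions s
  open ArcCovers
  open ArcCongruence α′
  private
    module a = Arc α
    module a′ = Arc α′
    S = support α
    S′ = support α′
    f = arcInversions α

    f-support : ∀ {k l} → 1 ≤ f k l → a.i Fin.≤ k × l ∈ S
    f-support {k} {l} 1≤f with toSum (l ∈? S)
    ... | inj₂ l∉ = contradiction (subst (1 ≤_) (arcInversions-∉ α l∉) 1≤f) λ ()
    ... | inj₁ l∈ = ℕₚ.≮⇒≥ (λ k<i → contradiction
            (subst (1 ≤_) (trans (arcInversions-∈ α l∈) (row-< k<i)) 1≤f) λ ()) , l∈

  -- The zeros of `f` decide the sides. An element `m` of `A` in `B′` would need `s m ≤ f m j`, but
  -- row `m` is zero at `j`. An element `m` of `B` in `A′` would need `ρ i ≤ f i m`, but column `m`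
  -- is zero.
  subarc : Subpair a.i a.j → Above a.i a.j f → ρ a.i ≡ a.r → Subarc s α α′
  subarc P h ρ≡r = record
    { i'≤i = i≤Source source
    ; j≤j' = Target≤j target
    ; A⊆A' = A⊆A′
    ; B⊆B' = B⊆B′
    ; s0   = s0 target
    ; same = λ e → trans (sym ρ≡r) (trans (cong ρ (sym e)) ρ-i)
    ; less = less source
    }
    where
    open Subpair P
    in-range : ∀ {m} → a.i Fin.< m × m Fin.< a.j × s m ≢ 0 → m ∈ a′.A ⊎ m ∈ a′.B
    in-range {m} (i<m , m<j , s≢0) = Equivalence.from (a′.cover m)
      (ℕₚ.≤-<-trans (i≤Source source) i<m , ℕₚ.<-≤-trans m<j (Target≤j target) , s≢0)
    A⊆A′ : a.A ⊆ a′.A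
    A⊆A′ {m} m∈A with Equivalence.to (a.cover m) (inj₁ m∈A)
    ... | i<m , m<j , s≢0 with in-range (i<m , m<j , s≢0)
    ...   | inj₁ m∈A′ = m∈A′
    ...   | inj₂ m∈B′ = contradiction (ℕₚ.n≤0⇒n≡0 (subst₂ _≤_ (ρ-B m∈B′)
              (trans (arcInversions-∈ α (j∈support α)) (row-∈ i<m (A⊆support α m∈A)))
              (h (inner m∈B′ i<m m<j) at-end m<j))) s≢0
    B⊆B′ : a.B ⊆ a′.B
    B⊆B′ {m} m∈B with Equivalence.to (a.cover m) (inj₂ m∈B)
    ... | i<m , m<j , s≢0 with in-range (i<m , m<j , s≢0)
    ...   | inj₂ m∈B′ = m∈B′
    ...   | inj₁ m∈A′ = contradiction (ℕₚ.≤-trans (1≤ρ source) (subst (ρ a.i ≤_)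
              (arcInversions-∉ α (B⇒∉support α m∈B)) (h at-start (inner m∈A′ i<m m<j) i<m))) λ ()
    s0 : Target a.j → s a.j ≡ 0 → a.j ≡ a′.j
    s0 (is-j e)  _ = e
    s0 (in-A j∈) z = contradiction z (proj₂ (proj₂ (A-bounds j∈)))
    s0 (in-B j∈) z = contradiction z (proj₂ (proj₂ (B-bounds j∈)))
    less : Source a.i → a′.i Fin.< a.i → (a.i ∈ a′.A × a.r ≡ 1) ⊎ (a.i ∈ a′.B × a.r ≡ s a.i)
    less (is-i e)  i′<i = contradiction (cong toℕ (sym e)) (ℕₚ.<⇒≢ i′<i)
    less (in-A i∈) _    = inj₁ (i∈ , trans (sym ρ≡r) (ρ-A i∈))
    less (in-B i∈) _    = inj₂ (i∈ , trans (sym ρ≡r) (ρ-B i∈))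

  -- T∨(α) and its lower cover differ only at (i , j), so they are told apart only by `Above i j`.
  separated⇒subarc : ∀ {k l} → Subpair k l → Above k l f →
                     StartOr a′.B k l a.i → EndOr a′.A k l a.j → a.r ∸ 1 < ρ a.i → Subarc s α α′
  separated⇒subarc {k} {l} P h p q r<ρ
    with f-support (ℕₚ.≤-trans (1≤ρ (Subpair.source P)) (h at-start at-end (Subpair.k<l P)))
  -- The positive entry of `f` at (k , l) gives `a.i ≤ k` and `l ≤ a.j`, while `p` and `q` give the
  -- reverse inequalities; so the pair is (i , j) itself.
  ... | i≤k , l∈ with Finₚ.≤-antisym (StartOr-≤ p) i≤k
                    | Finₚ.≤-antisym (proj₂ (support-bounds α l∈)) (EndOr-≤ q)
  ...   | refl | refl = subarc P h (ℕₚ.≤-antisym (subst (ρ k ≤_) (f-ij α) (h at-start at-end (Subpair.k<l P)))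
            (subst (_≤ ρ k) (ℕₚ.m+[n∸m]≡n a.1≤r) r<ρ))

  -- The congruence refutes forcing for arcs that are not subarcs; decidability turns this
  -- contrapositive into the required implication.
  subarc? : Dec (Subarc s α α′)
  subarc? with a′.i Fin.≤? a.i | a.j Fin.≤? a′.j | a.A ⊆? a′.A | a.B ⊆? a′.B
             | (s a.j ℕ.≟ 0) →-dec (a.j Fin.≟ a′.j) | (a′.i Fin.≟ a.i) →-dec (a.r ℕ.≟ a′.r)
             | (a′.i Fin.<? a.i) →-dec
                 (((a.i ∈? a′.A) ×-dec (a.r ℕ.≟ 1)) ⊎-dec ((a.i ∈? a′.B) ×-dec (a.r ℕ.≟ s a.i)))
  ... | yes i | yes j | yes A | yes B | yes z | yes e | yes l = yes record
        { i'≤i = i ; j≤j' = j ; A⊆A' = A ; B⊆B' = B ; s0 = z ; same = e ; less = l }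
  ... | no x  | _ | _ | _ | _ | _ | _ = no λ sub → x (Subarc.i'≤i sub)
  ... | _ | no x  | _ | _ | _ | _ | _ = no λ sub → x (Subarc.j≤j' sub)
  ... | _ | _ | no x  | _ | _ | _ | _ = no λ sub → x (Subarc.A⊆A' sub)
  ... | _ | _ | _ | no x  | _ | _ | _ = no λ sub → x (Subarc.B⊆B' sub)
  ... | _ | _ | _ | _ | no x  | _ | _ = no λ sub → x (Subarc.s0 sub)
  ... | _ | _ | _ | _ | _ | no x  | _ = no λ sub → x (Subarc.same sub)
  ... | _ | _ | _ | _ | _ | _ | no x  = no λ sub → x (Subarc.less sub)

  ∼-collapses : ¬ Subarc s α α′ → Collapses _∼_ f (arcInversions⁻ α)
  ∼-collapses ¬sub {x} {y} x≈f y≈f⁻ = to , from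
    where
    to : x ≲ y
    to {k} {l} P h {b} {a} p q b<a = subst (ρ b ≤_) (sym (y≈f⁻ b<a)) (ρ≤f⁻ (b Fin.≟ a.i) (a Fin.≟ a.j))
      where
      h′ : Above k l f
      h′ p q b<a = subst (_ ≤_) (x≈f b<a) (h p q b<a)
      ρ≤f⁻ : Dec (b ≡ a.i) → Dec (a ≡ a.j) → ρ b ≤ arcInversions⁻ α b a
      ρ≤f⁻ (no b≢i) _ = subst (ρ b ≤_) (sym (f⁻-elsewhere α (inj₁ b≢i))) (h′ p q b<a)
      ρ≤f⁻ (yes _) (no a≢j) = subst (ρ b ≤_) (sym (f⁻-elsewhere α (inj₂ a≢j))) (h′ p q b<a)
      ρ≤f⁻ (yes refl) (yes refl) with a.r ∸ 1 ℕ.<? ρ b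
      ... | yes l = contradiction (separated⇒subarc P h′ p q l) ¬sub
      ... | no ¬l = subst (ρ b ≤_) (sym (f⁻-ij α)) (ℕₚ.≮⇒≥ ¬l)
    from : y ≲ x
    from P h p q b<a = ℕₚ.≤-trans (h p q b<a)
      (subst₂ _≤_ (sym (y≈f⁻ b<a)) (sym (x≈f b<a)) (f⁻⊑f α b<a))

  ∼-separates : ¬ Collapses _∼_ (arcInversions α′) (arcInversions⁻ α′)
  ∼-separates c = ℕₚ.<⇒≱ (r∸1<r α′) (subst₂ _≤_ ρ-i (trans (pos-tree I⁻ a′.i<j) (f⁻-ij α′))
    (proj₁ (c {tree I} {tree I⁻} (pos-tree I) (pos-tree I⁻))
      (subpair a′.i<j (is-i refl) (is-j refl)) top at-start at-end a′.i<j))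
    where
    I = arcInversions-isInversion α′
    I⁻ = arcInversions⁻-isInversion α′
    EndOr-support : ∀ {a} → EndOr a′.A a′.i a′.j a → a ∈ S′
    EndOr-support at-end         = j∈support α′
    EndOr-support (inner a∈ _ _) = A⊆support α′ a∈
    value : ∀ {b a} → StartOr a′.B a′.i a′.j b → a ∈ S′ → arcInversions α′ b a ≡ ρ b
    value at-start a∈ = trans (arcInversions-∈ α′ a∈) (trans (row-≡ {a′.i} {a′.r} {S′}) (sym ρ-i))
    value (inner b∈ i<b _) a∈ = trans (arcInversions-∈ α′ a∈)
      (trans (row-∉ i<b (B⇒∉support α′ b∈)) (sym (ρ-B b∈)))
    top : Above a′.i a′.j (pos s (proj₁ (tree I)))
    top p q b<a = ℕₚ.≤-reflexive (sym (trans (pos-tree I b<a) (value p (EndOr-support q))))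

theorem72 : (n : ℕ) → 1 ≤ n → (s : Fin n → ℕ) → (α α' : Arc s) →
    Σ (T (valid s (tveeRaw s α))) λ p → Σ (T (valid s (tveeRaw s α'))) λ p' →
    (Forces (_≤w_ s) (tveeRaw s α , p) (tveeRaw s α' , p') ⇔ Subarc s α α')
theorem72 n _ s α α' = tvee-valid α , tvee-valid α' , mk⇔ forces⇒subarc subarc⇒forces
  where
  open ArcCovers
  open ArcCongruence α' using (_∼_; ∼-isCongruence)
  open ForcesSubarc α α' using (subarc?; ∼-collapses; ∼-separates)
  t t' : STree s
  t  = tveeRaw s α , tvee-valid α
  t' = tveeRaw s α' , tvee-valid α'
  forces⇒subarc : Forces (_≤w_ s) t t' → Subarc s α α'
  forces⇒subarc F = decidable-stable subarc? λ ¬sub →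
    ∼-separates (λ {x} {y} → contracts⇒collapses α' t' (tvee-pos α') {_∼_}
      (F _∼_ ∼-isCongruence
        (collapses⇒contracts α t (tvee-pos α) {_∼_} λ {x} {y} → ∼-collapses ¬sub {x} {y})) {x} {y})
  subarc⇒forces : Subarc s α α' → Forces (_≤w_ s) t t'
  subarc⇒forces sub R C c = collapses⇒contracts α' t' (tvee-pos α') {R}
    (SubarcForces.collapses-subarc sub {R} C (contracts⇒collapses α t (tvee-pos α) {R} c))
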